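{- Let $n$ and $r$ be positive integers, let $q$ be a complex number with $q^m\neq 1$ for every positive integer $m<n$, and let $u_1,\ldots,u_{r+2}$ be formal variables. Let $$x_1=\frac{u_1}{1+u_1}$$ and, for $i=2,\ldots,r+2$, $$x_i=\sum_{j=i}^{r+1}(-1)^{j-i}\binom{j-2}{i-2}\left(u_j-\frac{u_{r+2}}{u_1^{r+2-j}}\right)+\frac{u_{r+2}}{u_1^{r+2-i}(1+u_1)^{i-1}}$$ (the sum being empty when $i=r+2$). Then $$\Psi_n^t(u_1,\ldots,u_{r+2};q)=\frac{\prod_{j=1}^{n-1}P^{t-1}(1-q^j)}{\prod_{j=1}^{n-1}P^{t}(1-q^j)},$$ where $$P^t(T)=T^{r+1}-(x_1+tx_2)T^r-t\sum_{i=0}^{r-1}(x_{r+2-i}-x_1x_{r+1-i})T^i,$$ and $P^{t-1}(T)$ is obtained from $P^t(T)$ by replacing $t$ with $t-1$.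
   Context: $\mathbb{N}$ is the set of positive integers and $t$ is a formal parameter. For a multi-index $\mathbf{k}=(k_1,\ldots,k_l)\in\mathbb{N}^l$ define the weight $\mathrm{wt}(\mathbf{k})=k_1+\cdots+k_l$, the depth $\mathrm{dep}(\mathbf{k})=l$, and for $i\in\mathbb{N}$ the $i$-height $\#\{j\mid k_j\geq i+1\}$. For $\mathbf{k}\in\mathbb{N}^l$ with $l\ge 1$, $$\overline{z}_n(\mathbf{k};q)=\sum_{n>m_1>\cdots>m_l>0}\frac{q^{(k_1-1)m_1+\cdots+(k_l-1)m_l}}{(1-q^{m_1})^{k_1}\cdots(1-q^{m_l})^{k_l}},$$ and its interpolated version, a polynomial in $t$, is $$\overline{z}_n^t(\mathbf{k};q)=\sum_{\mathbf{p}}\overline{z}_n(\mathbf{p};q)\,t^{l-\mathrm{dep}(\mathbf{p})},$$ where the sum runs over all $3^{l-1}$ ways of forming $\mathbf{p}=(k_1\Box\cdots\Box k_l)$ by filling each $\Box$ with "," (comma), "$+$" or "$-1+$". For nonnegative integers $k,l,h_1,\ldots,h_r$ let $I(k,l,h_1,\ldots,h_r)$ be the set of multi-indices of weight $k$, depth $l$ and $i$-height $h_i$ for $i=1,\ldots,r$, and $$G_n^t(k,l,h_1,\ldots,h_r;q)=\sum_{\mathbf{k}\in I(k,l,h_1,\ldots,h_r)}\overline{z}_n^t(\mathbf{k};q),$$ which is $0$ when the index set is empty, except that $G_n^t(0,0,\ldots,0;q)=1$. The generating function is $$\Psi_n^t(u_1,\ldots,u_{r+2};q)=\sum_{k,l,h_1,\ldots,h_r\geq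 0}G_n^t(k,l,h_1,\ldots,h_r;q)\,u_1^{k-l-\sum_{j=1}^rh_j}u_2^{l-h_1}u_3^{h_1-h_2}\cdots u_{r+1}^{h_{r-1}-h_r}u_{r+2}^{h_r}.$$ The identity is one of formal power series in $u_1,\ldots,u_{r+2}$ (the negative powers of $u_1$ in $x_i$ cancel, so each $x_i$ is a power series). Empty products equal $1$. -}

module Defs where

open import Level using (Level; 0ℓ; _⊔_)
open import Algebra.Apartness.Bundles using (HeytingField; HeytingCommutativeRing)
open import Algebra.Bundles using (CommutativeRing)
import Algebra.Properties.CommutativeMonoid.Sum as CMSum
import Algebra.Properties.Monoid.Mult as MonoidMult
import Algebra.Properties.Ring as RingProperties
import Algebra.Properties.Semiring.Exp as SemiringExp
import Algebra.Solver.Ring.NaturalCoefficients.Default as NaturalSolver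
open import Algebra.Structures using (IsAbelianGroup; IsCommutativeRing)
open import Data.Empty using (⊥-elim)
open import Data.Fin using (Fin; toℕ)
open import Data.Integer as ℤ using (ℤ; +_)
import Data.Integer.Properties as ℤ
import Data.Integer.Solver as ℤSolver
open import Data.List as List using (List; []; _∷_; length; upTo; foldr; zip; zipWith; filter; concatMap)
open import Data.Nat as ℕ using (ℕ; zero; suc; _∸_)
import Data.Nat.ListAction as ℕ
import Data.Nat.Properties as ℕ
open import Data.Product using (_×_; _,_; proj₁; proj₂; ∃-syntax)
open import Data.Rational as ℚ using (ℚ; 0ℚ; 1ℚ; ½; ∣_∣)
import Data.Rational.Properties as ℚ
open import Data.Rational.Solver using (module +-*-Solver)
open import Data.Sum as Sum using (_⊎_; inj₁; inj₂)
open import Data.Vec as Vec using (Vec; []; _∷_; tabulate)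
import Data.Vec.Properties as Vec
import Relation.Binary.Reasoning.Setoid as SetoidReasoning
open import Relation.Binary.PropositionalEquality as ≡ using (_≡_)
open import Relation.Binary.Structures using (IsEquivalence)
open import Relation.Nullary using (¬_; yes; no)
open import Relation.Nullary.Decidable using (_×-dec_)

private variable
  a c ℓ ℓ₁ ℓ₂ : Level

module Rationals where

  open ≡ using (refl; sym; trans; cong; cong₂; subst)
  open import Data.Rational using (_+_; _*_; _-_; -_; 1/_; _<_; _≤_; positive; nonNegative; Positive; NonZero; ≢-nonZero)
  open +-*-Solver using (solve; _:+_; _:*_; _:-_; :-_; _:=_; con)

  opaque

    <⇒≱ : ∀ {p q} → p < q → ¬ q ≤ p
    <⇒≱ p<q q≤p = ℚ.<-irrefl refl (ℚ.<-≤-trans p<q q≤p)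

    half : ∀ {ε} → 0ℚ < ε → 0ℚ < ½ * ε
    half {ε} 0<ε = subst (_< ½ * ε) (ℚ.*-zeroʳ ½) (ℚ.*-monoʳ-<-pos ½ 0<ε)

    half+half : ∀ ε → ½ * ε + ½ * ε ≡ ε
    half+half ε = trans (sym (ℚ.*-distribʳ-+ ε ½ ½)) (ℚ.*-identityˡ ε)

    *-pos : ∀ {p q} → 0ℚ < p → 0ℚ < q → 0ℚ < p * q
    *-pos {p} {q} 0<p 0<q =
      subst (_< p * q) (ℚ.*-zeroʳ p) (ℚ.*-monoʳ-<-pos p {{positive 0<p}} 0<q)

    recip : ∀ {p} → 0ℚ < p → ∃[ p⁻¹ ] (0ℚ < p⁻¹ × p * p⁻¹ ≡ 1ℚ)
    recip {p} 0<p = 1/ p , ℚ.positive⁻¹ (1/ p) {{ℚ.1/pos⇒pos p}} , ℚ.*-inverseʳ p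
      where instance
        p>0 : Positive p
        p>0 = positive 0<p
        p≢0 : NonZero p
        p≢0 = ℚ.pos⇒nonZero p

    +-small : ∀ {ε} a b → ∣ a ∣ < ½ * ε → ∣ b ∣ < ½ * ε → ∣ a + b ∣ < ε
    +-small {ε} a b a< b< = ℚ.≤-<-trans (ℚ.∣p+q∣≤∣p∣+∣q∣ a b)
      (subst (∣ a ∣ + ∣ b ∣ <_) (half+half ε) (ℚ.+-mono-< a< b<))

    *-mono-≤ : ∀ {p q r s} → 0ℚ ≤ q → 0ℚ ≤ r → p ≤ q → r ≤ s → p * r ≤ q * s
    *-mono-≤ {p} {q} {r} {s} 0≤q 0≤r p≤q r≤s = ℚ.≤-trans
      (ℚ.*-monoʳ-≤-nonNeg r {{nonNegative 0≤r}} p≤q)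
      (ℚ.*-monoˡ-≤-nonNeg q {{nonNegative 0≤q}} r≤s)

    *-bound : ∀ {B C} a b → ∣ a ∣ ≤ B → ∣ b ∣ ≤ C → ∣ a * b ∣ ≤ B * C
    *-bound a b a≤ b≤ = subst (_≤ _) (sym (ℚ.∣p*q∣≡∣p∣*∣q∣ a b))
      (*-mono-≤ (ℚ.≤-trans (ℚ.0≤∣p∣ a) a≤) (ℚ.0≤∣p∣ b) a≤ b≤)

    *-small : ∀ {B ε} → 0ℚ < B → 0ℚ < ε → ∃[ δ ] (0ℚ < δ ×
      (∀ a b → ∣ a ∣ < δ → ∣ b ∣ ≤ B → ∣ a * b ∣ < ε))
    *-small {B} {ε} 0<B 0<ε with recip 0<B
    ... | C , 0<C , BC≡1 = ε * C , *-pos 0<ε 0<C , λ a b a< b≤ →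
      ℚ.≤-<-trans (subst (_≤ ∣ a ∣ * B) (sym (ℚ.∣p*q∣≡∣p∣*∣q∣ a b))
                    (ℚ.*-monoˡ-≤-nonNeg ∣ a ∣ {{nonNegative (ℚ.0≤∣p∣ a)}} b≤))
      (subst (∣ a ∣ * B <_) εCB≡ε (ℚ.*-monoˡ-<-pos B {{positive 0<B}} a<))
      where
      εCB≡ε : ε * C * B ≡ ε
      εCB≡ε = trans (ℚ.*-assoc ε C B)
        (trans (cong (ε *_) (trans (ℚ.*-comm C B) BC≡1)) (ℚ.*-identityʳ ε))

    *-small₂ : ∀ {B ε} → 0ℚ < B → 0ℚ < ε → ∃[ δ ] (0ℚ < δ ×
      (∀ a b c d → ∣ a ∣ < δ → ∣ b ∣ ≤ B → ∣ c ∣ < δ → ∣ d ∣ ≤ B → ∣ a * b + c * d ∣ < ε))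
    *-small₂ 0<B 0<ε with *-small 0<B (half 0<ε)
    ... | δ , 0<δ , small = δ , 0<δ , λ a b c d a< b≤ c< d≤ →
      +-small (a * b) (c * d) (small a b a< b≤) (small c d c< d≤)

    diff-sym : ∀ p q → ∣ p - q ∣ ≡ ∣ q - p ∣
    diff-sym p q = trans (sym (ℚ.∣-p∣≡∣p∣ (p - q)))
      (cong ∣_∣ (solve 2 (λ p q → :- (p :- q) := q :- p) refl p q))

    ∣p-p∣<ε : ∀ {ε} p q → p ≡ q → 0ℚ < ε → ∣ p - q ∣ < ε
    ∣p-p∣<ε p _ refl 0<ε = subst (_< _) (sym (cong ∣_∣ (ℚ.+-inverseʳ p))) 0<ε

    triangle : ∀ {ε} p q r → ∣ p - q ∣ < ½ * ε → ∣ q - r ∣ < ½ * ε → ∣ p - r ∣ < ε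
    triangle {ε} p q r pq qr = subst (λ x → ∣ x ∣ < ε)
      (solve 3 (λ p q r → (p :- q) :+ (q :- r) := p :- r) refl p q r)
      (+-small (p - q) (q - r) pq qr)

    split≤ : ∀ {ε} p q r → ε ≤ ∣ p - r ∣ → (½ * ε ≤ ∣ p - q ∣) ⊎ (½ * ε ≤ ∣ q - r ∣)
    split≤ {ε} p q r far with ½ * ε ℚ.≤? ∣ p - q ∣ | ½ * ε ℚ.≤? ∣ q - r ∣
    ... | yes h | _     = inj₁ h
    ... | no _  | yes h = inj₂ h
    ... | no h  | no h′ = ⊥-elim (<⇒≱ (triangle p q r (ℚ.≰⇒> h) (ℚ.≰⇒> h′)) far)

    +-rearrange : ∀ a b c d → (a + b) - (c + d) ≡ (a - c) + (b - d)
    +-rearrange = solve 4 (λ a b c d → (a :+ b) :- (c :+ d) := (a :- c) :+ (b :- d)) refl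

    *-rearrange : ∀ a b c d → a * b - c * d ≡ (a - c) * b + (b - d) * c
    *-rearrange = solve 4 (λ a b c d → (a :* b) :- (c :* d) := (a :- c) :* b :+ (b :- d) :* c) refl

    neg-rearrange : ∀ a b → (- a) - (- b) ≡ b - a
    neg-rearrange = solve 2 (λ a b → (:- a) :- (:- b) := b :- a) refl

    inv-rearrange : ∀ x y x′ y′ → x * y ≡ 1ℚ → x′ * y′ ≡ 1ℚ → y - y′ ≡ (x′ - x) * (y * y′)
    inv-rearrange x y x′ y′ xy x′y′ = trans
      (solve 2 (λ y y′ → y :- y′ := con 1ℚ :* y :- con 1ℚ :* y′) refl y y′)
      (trans (cong₂ (λ u v → u * y - v * y′) (sym x′y′) (sym xy))
      (solve 4 (λ x y x′ y′ → x′ :* y′ :* y :- x :* y :* y′ := (x′ :- x) :* (y :* y′)) refl x y x′ y′))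

    inverse : ℚ → ℚ
    inverse p with p ℚ.≟ 0ℚ
    ... | yes _ = 0ℚ
    ... | no p≢0 = 1/_ p {{≢-nonZero p≢0}}

    inverse-correct : ∀ p {ε} → 0ℚ < ε → ε ≤ ∣ p ∣ → p * inverse p ≡ 1ℚ
    inverse-correct p 0<ε ε≤p with p ℚ.≟ 0ℚ
    ... | yes refl = ⊥-elim (<⇒≱ 0<ε ε≤p)
    ... | no p≢0 = ℚ.*-inverseʳ p {{≢-nonZero p≢0}}

    -- If ε ≤ |p| and p q = 1 then |q| ≤ 1/ε.
    inverse-bound : ∀ ε C p q → 0ℚ < ε → 0ℚ < C → ε * C ≡ 1ℚ →
                    p * q ≡ 1ℚ → ε ≤ ∣ p ∣ → ∣ q ∣ ≤ C
    inverse-bound ε C p q 0<ε 0<C εC pq ε≤p =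
      ℚ.*-cancelˡ-≤-pos ε {{positive 0<ε}} (ℚ.≤-trans
        (ℚ.*-monoʳ-≤-nonNeg ∣ q ∣ {{nonNegative (ℚ.0≤∣p∣ q)}} ε≤p)
        (ℚ.≤-reflexive (trans (sym (ℚ.∣p*q∣≡∣p∣*∣q∣ p q)) (trans (cong ∣_∣ pq) (sym εC)))))

    ≤-+ʳ : ∀ a b {c} → 0ℚ ≤ b → c ≤ a → c ≤ a + b
    ≤-+ʳ a b {c} 0≤b c≤a =
      subst (_≤ a + b) (ℚ.+-identityʳ c) (ℚ.+-mono-≤ c≤a 0≤b)

    0≤p*p : ∀ p → 0ℚ ≤ p * p
    0≤p*p p with ℚ.∣p∣≡p∨∣p∣≡-p p
    ... | inj₁ e = subst (λ x → 0ℚ ≤ x * x) e 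
          (subst (_≤ ∣ p ∣ * ∣ p ∣) (ℚ.*-zeroʳ 0ℚ) (*-mono-≤ (ℚ.0≤∣p∣ p) ℚ.≤-refl (ℚ.0≤∣p∣ p) (ℚ.0≤∣p∣ p)))
    ... | inj₂ e = subst (0ℚ ≤_) (trans (cong₂ _*_ e e) (solve 1 (λ p → (:- p) :* (:- p) := p :* p) refl p))
          (subst (_≤ ∣ p ∣ * ∣ p ∣) (ℚ.*-zeroʳ 0ℚ) (*-mono-≤ (ℚ.0≤∣p∣ p) ℚ.≤-refl (ℚ.0≤∣p∣ p) (ℚ.0≤∣p∣ p)))

    square-far : ∀ {ε} p → 0ℚ < ε → ε ≤ ∣ p ∣ → ε * ε ≤ p * p
    square-far {ε} p 0<ε ε≤p = subst (ε * ε ≤_)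
      (trans (sym (ℚ.∣p*q∣≡∣p∣*∣q∣ p p)) (ℚ.0≤p⇒∣p∣≡p (0≤p*p p)))
      (*-mono-≤ (ℚ.0≤∣p∣ p) (ℚ.<⇒≤ 0<ε) ε≤p ε≤p)

    p-0 : ∀ p → p - 0ℚ ≡ p
    p-0 = solve 1 (λ p → p :- con 0ℚ := p) refl

    0<1 : 0ℚ < 1ℚ
    0<1 = ℚ.positive⁻¹ 1ℚ

    not-both : ∀ p → ∣ p ∣ < ½ * 1ℚ → ¬ (∣ p - 1ℚ ∣ < ½ * 1ℚ)
    not-both p p<½ p-1<½ = ℚ.<-irrefl refl (triangle {1ℚ} 1ℚ p 0ℚ
      (subst (_< ½ * 1ℚ) (diff-sym p 1ℚ) p-1<½)
      (subst (λ d → ∣ d ∣ < ½ * 1ℚ) (sym (p-0 p)) p<½))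

    cancel : ∀ p q → ∣ (p + - q) - p ∣ ≡ ∣ q - 0ℚ ∣
    cancel p q = trans (cong ∣_∣ (solve 2 (λ p q → (p :+ (:- q)) :- p := :- q) refl p q))
      (trans (ℚ.∣-p∣≡∣p∣ q) (cong ∣_∣ (sym (p-0 q))))

    ℂ-assoc-re : ∀ a b c d e f →
      (a * c + - (b * d)) * e + - ((a * d + b * c) * f) ≡
      a * (c * e + - (d * f)) + - (b * (c * f + d * e))
    ℂ-assoc-re = solve 6 (λ a b c d e f →
      (a :* c :+ :- (b :* d)) :* e :+ :- ((a :* d :+ b :* c) :* f) :=
      a :* (c :* e :+ :- (d :* f)) :+ :- (b :* (c :* f :+ d :* e))) refl

    ℂ-assoc-im : ∀ a b c d e f →
      (a * c + - (b * d)) * f + (a * d + b * c) * e ≡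
      a * (c * f + d * e) + b * (c * e + - (d * f))
    ℂ-assoc-im = solve 6 (λ a b c d e f →
      (a :* c :+ :- (b :* d)) :* f :+ (a :* d :+ b :* c) :* e :=
      a :* (c :* f :+ d :* e) :+ b :* (c :* e :+ :- (d :* f))) refl

    ℂ-comm-re : ∀ a b c d → a * c + - (b * d) ≡ c * a + - (d * b)
    ℂ-comm-re = solve 4 (λ a b c d → a :* c :+ :- (b :* d) := c :* a :+ :- (d :* b)) refl

    ℂ-comm-im : ∀ a b c d → a * d + b * c ≡ c * b + d * a
    ℂ-comm-im = solve 4 (λ a b c d → a :* d :+ b :* c := c :* b :+ d :* a) refl

    ℂ-identity-re : ∀ a b → 1ℚ * a + - (0ℚ * b) ≡ a
    ℂ-identity-re = solve 2 (λ a b → con 1ℚ :* a :+ :- (con 0ℚ :* b) := a) refl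

    ℂ-identity-im : ∀ a b → 1ℚ * b + 0ℚ * a ≡ b
    ℂ-identity-im = solve 2 (λ a b → con 1ℚ :* b :+ con 0ℚ :* a := b) refl

    ℂ-distrib-re : ∀ a b c d e f →
      a * (c + e) + - (b * (d + f)) ≡ (a * c + - (b * d)) + (a * e + - (b * f))
    ℂ-distrib-re = solve 6 (λ a b c d e f →
      a :* (c :+ e) :+ :- (b :* (d :+ f)) :=
      (a :* c :+ :- (b :* d)) :+ (a :* e :+ :- (b :* f))) refl

    ℂ-distrib-im : ∀ a b c d e f →
      a * (d + f) + b * (c + e) ≡ (a * d + b * c) + (a * f + b * e)
    ℂ-distrib-im = solve 6 (λ a b c d e f →
      a :* (d :+ f) :+ b :* (c :+ e) := (a :* d :+ b :* c) :+ (a :* f :+ b :* e)) refl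

    ℂ-inverse-re : ∀ a b s → a * (a * s) + - (b * - (b * s)) ≡ (a * a + b * b) * s
    ℂ-inverse-re = solve 3 (λ a b s →
      a :* (a :* s) :+ :- (b :* :- (b :* s)) := (a :* a :+ b :* b) :* s) refl

    ℂ-inverse-im : ∀ a b s → a * - (b * s) + b * (a * s) ≡ 0ℚ
    ℂ-inverse-im = solve 3 (λ a b s →
      a :* :- (b :* s) :+ b :* (a :* s) := con 0ℚ) refl

-- Reals are Cauchy sequences of rationals; Real._≈_ and Real._#_ are equality and apartness
-- of the limits. Proofs are opaque because conversion checking must not unfold them.
Eventually : (ℕ → Set) → Set
Eventually P = ∃[ N ] ∀ n → N ℕ.≤ n → P n

record ℝ : Set where
  no-eta-equality; pattern
  constructor mkℝ
  field
    seq    : ℕ → ℚ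
    cauchy : ∀ ε → 0ℚ ℚ.< ε →
             ∃[ N ] ∀ m n → N ℕ.≤ m → N ℕ.≤ n → ∣ seq m ℚ.- seq n ∣ ℚ.< ε
open ℝ

module Real where

  open Rationals
  open ≡ using (refl; sym; trans; cong; subst)

  infix 4 _≈_ _#_
  infixl 6 _+_
  infixl 7 _*_
  infix 8 -_

  record _≈_ (x y : ℝ) : Set where
    constructor mk≈
    field close : ∀ ε → 0ℚ ℚ.< ε → Eventually λ n → ∣ seq x n ℚ.- seq y n ∣ ℚ.< ε
  open _≈_ public

  record _#_ (x y : ℝ) : Set where
    constructor mk#
    field
      gap  : ℚ
      0<gap : 0ℚ ℚ.< gap
      far  : Eventually λ n → gap ℚ.≤ ∣ seq x n ℚ.- seq y n ∣

  Cauchy : (ℕ → ℚ) → Set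
  Cauchy s = ∀ ε → 0ℚ ℚ.< ε →
    ∃[ N ] ∀ m n → N ℕ.≤ m → N ℕ.≤ n → ∣ s m ℚ.- s n ∣ ℚ.< ε

  opaque

    bounded : (x : ℝ) → ∃[ B ] (0ℚ ℚ.< B × Eventually λ n → ∣ seq x n ∣ ℚ.≤ B)
    bounded x with cauchy x 1ℚ (ℚ.positive⁻¹ 1ℚ)
    ... | N , close₁ = 1ℚ ℚ.+ ∣ seq x N ∣ ,
      ℚ.<-≤-trans (ℚ.positive⁻¹ 1ℚ) (≤-+ʳ 1ℚ ∣ seq x N ∣ (ℚ.0≤∣p∣ (seq x N)) ℚ.≤-refl) ,
      N , λ n N≤n → ℚ.≤-trans
        (subst (λ p → ∣ p ∣ ℚ.≤ ∣ seq x n ℚ.- seq x N ∣ ℚ.+ ∣ seq x N ∣)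
          (solve 2 (λ a b → (a :- b) :+ b := a) refl (seq x n) (seq x N))
          (ℚ.∣p+q∣≤∣p∣+∣q∣ (seq x n ℚ.- seq x N) (seq x N)))
        (ℚ.+-monoˡ-≤ ∣ seq x N ∣ (ℚ.<⇒≤ (close₁ n N N≤n ℕ.≤-refl)))
      where open +-*-Solver using (solve; _:+_; _:-_; _:=_)

  opaque

    bounded₂ : (x y : ℝ) → ∃[ B ] (0ℚ ℚ.< B ×
      Eventually λ n → ∣ seq x n ∣ ℚ.≤ B × ∣ seq y n ∣ ℚ.≤ B)
    bounded₂ x y = combine (bounded x) (bounded y)
      where
      combine : (∃[ B ] (0ℚ ℚ.< B × Eventually λ n → ∣ seq x n ∣ ℚ.≤ B)) →
                (∃[ B ] (0ℚ ℚ.< B × Eventually λ n → ∣ seq y n ∣ ℚ.≤ B)) →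
                ∃[ B ] (0ℚ ℚ.< B × Eventually λ n → ∣ seq x n ∣ ℚ.≤ B × ∣ seq y n ∣ ℚ.≤ B)
      combine (B , 0<B , M , bx) (C , 0<C , N , by) = B ℚ.+ C , ℚ.<-≤-trans 0<B B≤ , M ℕ.⊔ N , λ n h →
          ℚ.≤-trans (bx n (ℕ.m⊔n≤o⇒m≤o M N h)) B≤ , ℚ.≤-trans (by n (ℕ.m⊔n≤o⇒n≤o M N h)) C≤
        where
        B≤ : B ℚ.≤ B ℚ.+ C
        B≤ = ≤-+ʳ B C (ℚ.<⇒≤ 0<C) ℚ.≤-refl
        C≤ : C ℚ.≤ B ℚ.+ C
        C≤ = subst (C ℚ.≤_) (ℚ.+-comm C B) (≤-+ʳ C B (ℚ.<⇒≤ 0<B) ℚ.≤-refl)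

  opaque

    const-cauchy : ∀ p → Cauchy λ _ → p
    const-cauchy p ε 0<ε = 0 , λ _ _ _ _ → ∣p-p∣<ε p p refl 0<ε

    +-cauchy : ∀ x y → Cauchy λ n → seq x n ℚ.+ seq y n
    +-cauchy x y ε 0<ε =
      let M , cx = cauchy x (½ ℚ.* ε) (half 0<ε)
          N , cy = cauchy y (½ ℚ.* ε) (half 0<ε)
      in M ℕ.⊔ N , λ m n hm hn →
        subst (λ p → ∣ p ∣ ℚ.< ε)
          (sym (+-rearrange (seq x m) (seq y m) (seq x n) (seq y n)))
          (+-small (seq x m ℚ.- seq x n) (seq y m ℚ.- seq y n)
            (cx m n (ℕ.m⊔n≤o⇒m≤o M N hm) (ℕ.m⊔n≤o⇒m≤o M N hn))
            (cy m n (ℕ.m⊔n≤o⇒n≤o M N hm) (ℕ.m⊔n≤o⇒n≤o M N hn)))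

    neg-cauchy : ∀ x → Cauchy λ n → ℚ.- seq x n
    neg-cauchy x ε 0<ε =
      let N , cx = cauchy x ε 0<ε in N , λ m n hm hn →
        subst (λ p → ∣ p ∣ ℚ.< ε) (sym (neg-rearrange (seq x m) (seq x n))) (cx n m hn hm)

    *-cauchy : ∀ x y → Cauchy λ n → seq x n ℚ.* seq y n
    *-cauchy x y ε 0<ε =
      let B , 0<B , K , b = bounded₂ x y
          δ , 0<δ , small = *-small₂ 0<B 0<ε
          M , cx = cauchy x δ 0<δ
          N , cy = cauchy y δ 0<δ
      in K ℕ.⊔ (M ℕ.⊔ N) , λ m n hm hn →
        let hm′ = ℕ.m⊔n≤o⇒n≤o K (M ℕ.⊔ N) hm
            hn′ = ℕ.m⊔n≤o⇒n≤o K (M ℕ.⊔ N) hn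
        in subst (λ p → ∣ p ∣ ℚ.< ε)
          (sym (*-rearrange (seq x m) (seq y m) (seq x n) (seq y n)))
          (small (seq x m ℚ.- seq x n) (seq y m) (seq y m ℚ.- seq y n) (seq x n)
            (cx m n (ℕ.m⊔n≤o⇒m≤o M N hm′) (ℕ.m⊔n≤o⇒m≤o M N hn′))
            (proj₂ (b m (ℕ.m⊔n≤o⇒m≤o K (M ℕ.⊔ N) hm)))
            (cy m n (ℕ.m⊔n≤o⇒n≤o M N hm′) (ℕ.m⊔n≤o⇒n≤o M N hn′))
            (proj₁ (b n (ℕ.m⊔n≤o⇒m≤o K (M ℕ.⊔ N) hn))))

  fromℚ : ℚ → ℝ
  fromℚ p = mkℝ (λ _ → p) (const-cauchy p)

  0ℝ 1ℝ : ℝ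
  0ℝ = fromℚ 0ℚ
  1ℝ = fromℚ 1ℚ

  _+_ _*_ : ℝ → ℝ → ℝ
  x + y = mkℝ (λ n → seq x n ℚ.+ seq y n) (+-cauchy x y)
  x * y = mkℝ (λ n → seq x n ℚ.* seq y n) (*-cauchy x y)

  -_ : ℝ → ℝ
  - x = mkℝ (λ n → ℚ.- seq x n) (neg-cauchy x)

  opaque

    pointwise : ∀ {x y} → (∀ n → seq x n ≡ seq y n) → x ≈ y
    pointwise x≡y = mk≈ λ ε 0<ε → 0 , λ n _ → ∣p-p∣<ε _ _ (x≡y n) 0<ε

    ≈-isEquivalence : IsEquivalence _≈_
    ≈-isEquivalence = record
      { refl  = pointwise λ _ → refl
      ; sym   = λ {x} {y} x≈y → mk≈ λ ε 0<ε → let N , c = close x≈y ε 0<ε in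
          N , λ n h → subst (ℚ._< ε) (diff-sym (seq x n) (seq y n)) (c n h)
      ; trans = λ {x} {y} {z} x≈y y≈z → mk≈ λ ε 0<ε →
          let M , p = close x≈y (½ ℚ.* ε) (half 0<ε)
              N , q = close y≈z (½ ℚ.* ε) (half 0<ε)
          in M ℕ.⊔ N , λ n h → triangle (seq x n) (seq y n) (seq z n)
               (p n (ℕ.m⊔n≤o⇒m≤o M N h)) (q n (ℕ.m⊔n≤o⇒n≤o M N h))
      }

  opaque

    +-cong : ∀ {x y u v} → x ≈ y → u ≈ v → x + u ≈ y + v
    +-cong {x} {y} {u} {v} x≈y u≈v = mk≈ λ ε 0<ε →
      let M , p = close x≈y (½ ℚ.* ε) (half 0<ε)
          N , q = close u≈v (½ ℚ.* ε) (half 0<ε)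
      in M ℕ.⊔ N , λ n h → subst (λ d → ∣ d ∣ ℚ.< ε)
           (sym (+-rearrange (seq x n) (seq u n) (seq y n) (seq v n)))
           (+-small (seq x n ℚ.- seq y n) (seq u n ℚ.- seq v n)
             (p n (ℕ.m⊔n≤o⇒m≤o M N h)) (q n (ℕ.m⊔n≤o⇒n≤o M N h)))

    -‿cong : ∀ {x y} → x ≈ y → - x ≈ - y
    -‿cong {x} {y} x≈y = mk≈ λ ε 0<ε → let N , c = close x≈y ε 0<ε in N , λ n h →
      subst (ℚ._< ε) (trans (diff-sym (seq x n) (seq y n))
        (cong ∣_∣ (sym (neg-rearrange (seq x n) (seq y n))))) (c n h)

    *-cong : ∀ {x y u v} → x ≈ y → u ≈ v → x * u ≈ y * v
    *-cong {x} {y} {u} {v} x≈y u≈v = mk≈ λ ε 0<ε →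
      let B , 0<B , K , b = bounded₂ u y
          δ , 0<δ , small = *-small₂ 0<B 0<ε
          M , p = close x≈y δ 0<δ
          N , q = close u≈v δ 0<δ
      in K ℕ.⊔ (M ℕ.⊔ N) , λ n h →
        let hK = ℕ.m⊔n≤o⇒m≤o K (M ℕ.⊔ N) h
            h′ = ℕ.m⊔n≤o⇒n≤o K (M ℕ.⊔ N) h
        in subst (λ d → ∣ d ∣ ℚ.< ε)
          (sym (*-rearrange (seq x n) (seq u n) (seq y n) (seq v n)))
          (small (seq x n ℚ.- seq y n) (seq u n) (seq u n ℚ.- seq v n) (seq y n)
            (p n (ℕ.m⊔n≤o⇒m≤o M N h′)) (proj₁ (b n hK))
            (q n (ℕ.m⊔n≤o⇒n≤o M N h′)) (proj₂ (b n hK)))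

    +-assoc : ∀ x y z → (x + y) + z ≈ x + (y + z)
    +-assoc x y z = pointwise {(x + y) + z} {x + (y + z)} λ n →
      ℚ.+-assoc (seq x n) (seq y n) (seq z n)

    +-comm : ∀ x y → x + y ≈ y + x
    +-comm x y = pointwise {x + y} {y + x} λ n → ℚ.+-comm (seq x n) (seq y n)

    +-identityˡ : ∀ x → 0ℝ + x ≈ x
    +-identityˡ x = pointwise {0ℝ + x} {x} λ n → ℚ.+-identityˡ (seq x n)

    +-identityʳ : ∀ x → x + 0ℝ ≈ x
    +-identityʳ x = pointwise {x + 0ℝ} {x} λ n → ℚ.+-identityʳ (seq x n)

    -‿inverseˡ : ∀ x → - x + x ≈ 0ℝ
    -‿inverseˡ x = pointwise { - x + x} {0ℝ} λ n → ℚ.+-inverseˡ (seq x n)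

    -‿inverseʳ : ∀ x → x + - x ≈ 0ℝ
    -‿inverseʳ x = pointwise {x + - x} {0ℝ} λ n → ℚ.+-inverseʳ (seq x n)

    *-assoc : ∀ x y z → (x * y) * z ≈ x * (y * z)
    *-assoc x y z = pointwise {(x * y) * z} {x * (y * z)} λ n →
      ℚ.*-assoc (seq x n) (seq y n) (seq z n)

    *-comm : ∀ x y → x * y ≈ y * x
    *-comm x y = pointwise {x * y} {y * x} λ n → ℚ.*-comm (seq x n) (seq y n)

    *-identityˡ : ∀ x → 1ℝ * x ≈ x
    *-identityˡ x = pointwise {1ℝ * x} {x} λ n → ℚ.*-identityˡ (seq x n)

    *-identityʳ : ∀ x → x * 1ℝ ≈ x
    *-identityʳ x = pointwise {x * 1ℝ} {x} λ n → ℚ.*-identityʳ (seq x n)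

    *-distribˡ-+ : ∀ x y z → x * (y + z) ≈ x * y + x * z
    *-distribˡ-+ x y z = pointwise {x * (y + z)} {x * y + x * z} λ n →
      ℚ.*-distribˡ-+ (seq x n) (seq y n) (seq z n)

    *-distribʳ-+ : ∀ x y z → (y + z) * x ≈ y * x + z * x
    *-distribʳ-+ x y z = pointwise {(y + z) * x} {y * x + z * x} λ n →
      ℚ.*-distribʳ-+ (seq x n) (seq y n) (seq z n)

  +-isAbelianGroup : IsAbelianGroup _≈_ _+_ 0ℝ -_
  +-isAbelianGroup = record
    { isGroup = record
      { isMonoid = record
        { isSemigroup = record
          { isMagma = record { isEquivalence = ≈-isEquivalence ; ∙-cong = +-cong }
          ; assoc = +-assoc
          }
        ; identity = +-identityˡ , +-identityʳ
        }
      ; inverse = -‿inverseˡ , -‿inverseʳ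
      ; ⁻¹-cong = -‿cong
      }
    ; comm = +-comm
    }

  isCommutativeRing : IsCommutativeRing _≈_ _+_ _*_ -_ 0ℝ 1ℝ
  isCommutativeRing = record
    { isRing = record
      { +-isAbelianGroup = +-isAbelianGroup
      ; *-cong = *-cong
      ; *-assoc = *-assoc
      ; *-identity = *-identityˡ , *-identityʳ
      ; distrib = *-distribˡ-+ , *-distribʳ-+
      }
    ; *-comm = *-comm
    }

  opaque

    #-irrefl : ∀ {x y} → x ≈ y → ¬ x # y
    #-irrefl x≈y (mk# ε 0<ε (M , f)) with close x≈y ε 0<ε
    ... | N , c = <⇒≱ (c (M ℕ.⊔ N) (ℕ.m≤n⊔m M N)) (f (M ℕ.⊔ N) (ℕ.m≤m⊔n M N))

    #-sym : ∀ {x y} → x # y → y # x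
    #-sym {x} {y} (mk# ε 0<ε (M , f)) = mk# ε 0<ε (M , λ n h →
      subst (ε ℚ.≤_) (diff-sym (seq x n) (seq y n)) (f n h))

    -- One sufficiently late index decides: if ε ≤ |x K - y K| and both sequences
    -- vary by less than ε/4 beyond K, then |x n - y n| stays above ε/2.
    late : ∀ x y {ε} → 0ℚ ℚ.< ε → ∃[ K ] ∀ k → K ℕ.≤ k →
           ε ℚ.≤ ∣ seq x k ℚ.- seq y k ∣ → x # y
    late x y {ε} 0<ε with cauchy x (½ ℚ.* (½ ℚ.* ε)) (half (half 0<ε))
                        | cauchy y (½ ℚ.* (½ ℚ.* ε)) (half (half 0<ε))
    ... | M , cx | N , cy = M ℕ.⊔ N , λ k h far → mk# (½ ℚ.* ε) (half 0<ε)
      (M ℕ.⊔ N , λ n h′ → stays k n h h′ far)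
      where
      stays : ∀ k n → M ℕ.⊔ N ℕ.≤ k → M ℕ.⊔ N ℕ.≤ n → ε ℚ.≤ ∣ seq x k ℚ.- seq y k ∣ →
              ½ ℚ.* ε ℚ.≤ ∣ seq x n ℚ.- seq y n ∣
      stays k n h h′ far with ½ ℚ.* ε ℚ.≤? ∣ seq x n ℚ.- seq y n ∣
      ... | yes p = p
      ... | no ¬p = ⊥-elim (<⇒≱ contra far)
        where
        open +-*-Solver using (solve; _:+_; _:-_; _:=_)
        drift : ∣ (seq x k ℚ.- seq x n) ℚ.+ (seq y n ℚ.- seq y k) ∣ ℚ.< ½ ℚ.* ε
        drift = +-small (seq x k ℚ.- seq x n) (seq y n ℚ.- seq y k) (cx k n (ℕ.m⊔n≤o⇒m≤o M N h) (ℕ.m⊔n≤o⇒m≤o M N h′))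
                            (cy n k (ℕ.m⊔n≤o⇒n≤o M N h′) (ℕ.m⊔n≤o⇒n≤o M N h))
        contra : ∣ seq x k ℚ.- seq y k ∣ ℚ.< ε
        contra = subst (λ d → ∣ d ∣ ℚ.< ε)
          (solve 4 (λ a b c d → (a :- b) :+ (c :- d) :+ (b :- c) := a :- d) refl
            (seq x k) (seq x n) (seq y n) (seq y k))
          (+-small ((seq x k ℚ.- seq x n) ℚ.+ (seq y n ℚ.- seq y k)) (seq x n ℚ.- seq y n) drift (ℚ.≰⇒> ¬p))

  opaque

    #-cotrans : ∀ {x y} → x # y → ∀ z → x # z ⊎ z # y
    #-cotrans {x} {y} (mk# ε 0<ε (M , f)) z =
      let K , xz = late x z (half 0<ε)
          L , zy = late z y (half 0<ε)
          k = M ℕ.⊔ (K ℕ.⊔ L)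
          k≥K⊔L = ℕ.m≤n⊔m M (K ℕ.⊔ L)
      in Sum.map (xz k (ℕ.m⊔n≤o⇒m≤o K L k≥K⊔L)) (zy k (ℕ.m⊔n≤o⇒n≤o K L k≥K⊔L))
           (split≤ (seq x k) (seq z k) (seq y k) (f k (ℕ.m≤m⊔n M (K ℕ.⊔ L))))

    #-tight : ∀ {x y} → ¬ x # y → x ≈ y
    #-tight {x} {y} ¬x#y = mk≈ λ ε 0<ε → let K , l = late x y 0<ε in
      K , λ k h → ℚ.≰⇒> λ far → ¬x#y (l k h far)

  opaque

    #0⇒inverse : ∀ {x} → x # 0ℝ → ∃[ y ] x * y ≈ 1ℝ
    #0⇒inverse {x} (mk# ε 0<ε (M , f)) = mkℝ y y-cauchy , mk≈ λ η 0<η → M , λ n h →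
        ∣p-p∣<ε (seq x n ℚ.* y n) 1ℚ (xy≡1 n h) 0<η
      where
      y : ℕ → ℚ
      y n = inverse (seq x n)

      far : ∀ n → M ℕ.≤ n → ε ℚ.≤ ∣ seq x n ∣
      far n h = subst (λ d → ε ℚ.≤ ∣ d ∣) (p-0 (seq x n)) (f n h)

      xy≡1 : ∀ n → M ℕ.≤ n → seq x n ℚ.* y n ≡ 1ℚ
      xy≡1 n h = inverse-correct (seq x n) 0<ε (far n h)

      C : ℚ
      C = proj₁ (recip 0<ε)

      0<C : 0ℚ ℚ.< C
      0<C = proj₁ (proj₂ (recip 0<ε))

      y≤C : ∀ n → M ℕ.≤ n → ∣ y n ∣ ℚ.≤ C
      y≤C n h = inverse-bound ε C (seq x n) (y n) 0<ε 0<C (proj₂ (proj₂ (recip 0<ε))) (xy≡1 n h) (far n h)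

      y-cauchy : Cauchy y
      y-cauchy η 0<η =
        let δ , 0<δ , small = *-small (*-pos 0<C 0<C) 0<η
            N , cx = cauchy x δ 0<δ
        in M ℕ.⊔ N , λ m n hm hn →
          let hm₁ = ℕ.m⊔n≤o⇒m≤o M N hm
              hn₁ = ℕ.m⊔n≤o⇒m≤o M N hn
          in subst (λ d → ∣ d ∣ ℚ.< η)
            (sym (inv-rearrange (seq x m) (y m) (seq x n) (y n) (xy≡1 m hm₁) (xy≡1 n hn₁)))
            (small (seq x n ℚ.- seq x m) (y m ℚ.* y n)
              (cx n m (ℕ.m⊔n≤o⇒n≤o M N hn) (ℕ.m⊔n≤o⇒n≤o M N hm))
              (*-bound (y m) (y n) (y≤C m hm₁) (y≤C n hn₁)))

  opaque

    inverse⇒#0 : ∀ {x y} → x * y ≈ 1ℝ → x # 0ℝ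
    inverse⇒#0 {x} {y} xy≈1 =
      let B , 0<B , N , b = bounded y
          δ , 0<δ , small = *-small 0<B (half 0<1)
          M , c = close xy≈1 (½ ℚ.* 1ℚ) (half 0<1)
      in mk# δ 0<δ (M ℕ.⊔ N , λ n h → subst (λ d → δ ℚ.≤ ∣ d ∣) (sym (p-0 (seq x n)))
        (ℚ.≮⇒≥ λ x<δ → not-both (seq x n ℚ.* seq y n)
          (small (seq x n) (seq y n) x<δ (b n (ℕ.m⊔n≤o⇒n≤o M N h)))
          (c n (ℕ.m⊔n≤o⇒m≤o M N h))))

  opaque

    squares#0 : ∀ {x} y → x # 0ℝ → x * x + y * y # 0ℝ
    squares#0 {x} y (mk# ε 0<ε (N , f)) = mk# (ε ℚ.* ε) (*-pos 0<ε 0<ε) (N , λ n h →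
      let s≥ = ≤-+ʳ (seq x n ℚ.* seq x n) (seq y n ℚ.* seq y n) (0≤p*p (seq y n)) (square-far (seq x n) 0<ε
                 (subst (λ d → ε ℚ.≤ ∣ d ∣) (p-0 (seq x n)) (f n h)))
      in subst (ε ℚ.* ε ℚ.≤_)
           (trans (sym (ℚ.0≤p⇒∣p∣≡p (ℚ.≤-trans (ℚ.<⇒≤ (*-pos 0<ε 0<ε)) s≥)))
                  (cong ∣_∣ (sym (p-0 (seq x n ℚ.* seq x n ℚ.+ seq y n ℚ.* seq y n))))) s≥)

  opaque

    #⇒-#0 : ∀ {x y} → x # y → x + - y # 0ℝ
    #⇒-#0 {x} {y} (mk# ε 0<ε (N , f)) = mk# ε 0<ε (N , λ n h →
      subst (λ d → ε ℚ.≤ ∣ d ∣) (sym (p-0 (seq x n ℚ.- seq y n))) (f n h))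

    -#0⇒# : ∀ {x y} → x + - y # 0ℝ → x # y
    -#0⇒# {x} {y} (mk# ε 0<ε (N , f)) = mk# ε 0<ε (N , λ n h →
      subst (λ d → ε ℚ.≤ ∣ d ∣) (p-0 (seq x n ℚ.- seq y n)) (f n h))

  open IsEquivalence ≈-isEquivalence public using () renaming (trans to ≈-trans; sym to ≈-sym; refl to ≈-refl)

  opaque

    *#0⇒#0 : ∀ {x y} → x * y # 0ℝ → x # 0ℝ
    *#0⇒#0 {x} {y} xy#0 =
      let u , xyu≈1 = #0⇒inverse {x * y} xy#0
      in inverse⇒#0 {x} {y * u} (≈-trans (≈-sym (*-assoc x y u)) xyu≈1)

    #-respˡ : ∀ {x y z} → x ≈ y → x # z → y # z
    #-respˡ {x} {y} {z} x≈y x#z =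
      Sum.[ (λ x#y → ⊥-elim (#-irrefl x≈y x#y)) , (λ h → h) ]′ (#-cotrans {x} {z} x#z y)

    x-y#x⇒y#0 : ∀ {x y} → x + - y # x → y # 0ℝ
    x-y#x⇒y#0 {x} {y} (mk# ε 0<ε (N , f)) = mk# ε 0<ε (N , λ n h →
      subst (ε ℚ.≤_) (cancel (seq x n) (seq y n)) (f n h))

    difference#0 : ∀ {x y} → x + - y # 0ℝ → x # 0ℝ ⊎ y # 0ℝ
    difference#0 {x} {y} x-y#0 = Sum.[ (λ h → inj₂ (x-y#x⇒y#0 {x} {y} h)) , inj₁ ]′
      (#-cotrans {x + - y} {0ℝ} x-y#0 x)

record ℂ : Set where
  no-eta-equality; pattern
  constructor _+i_
  field
    re im : ℝ
open ℂ

module Complex where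

  open Rationals

  open Real using (0ℝ; 1ℝ)
  module R = Real

  infix 4 _≈_ _#_
  infixl 6 _+_
  infixl 7 _*_
  infix 8 -_

  record _≈_ (z w : ℂ) : Set where
    constructor mk≈
    field
      re≈ : re z R.≈ re w
      im≈ : im z R.≈ im w
  open _≈_

  _#_ : ℂ → ℂ → Set
  z # w = re z R.# re w ⊎ im z R.# im w

  0ℂ 1ℂ : ℂ
  0ℂ = 0ℝ +i 0ℝ
  1ℂ = 1ℝ +i 0ℝ

  _+_ _*_ : ℂ → ℂ → ℂ
  (a +i b) + (c +i d) = (a R.+ c) +i (b R.+ d)
  (a +i b) * (c +i d) = (a R.* c R.+ R.- (b R.* d)) +i (a R.* d R.+ b R.* c)

  -_ : ℂ → ℂ
  - (a +i b) = (R.- a) +i (R.- b)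

  ≈-isEquivalence : IsEquivalence _≈_
  ≈-isEquivalence = record
    { refl  = mk≈ R.≈-refl R.≈-refl
    ; sym   = λ p → mk≈ (R.≈-sym (re≈ p)) (R.≈-sym (im≈ p))
    ; trans = λ p q → mk≈ (R.≈-trans (re≈ p) (re≈ q)) (R.≈-trans (im≈ p) (im≈ q))
    }

  +-cong : ∀ {x y u v} → x ≈ y → u ≈ v → x + u ≈ y + v
  +-cong {_ +i _} {_ +i _} {_ +i _} {_ +i _} p q =
    mk≈ (R.+-cong (re≈ p) (re≈ q)) (R.+-cong (im≈ p) (im≈ q))

  -‿cong : ∀ {x y} → x ≈ y → - x ≈ - y
  -‿cong {_ +i _} {_ +i _} p = mk≈ (R.-‿cong (re≈ p)) (R.-‿cong (im≈ p))

  *-cong : ∀ {x y u v} → x ≈ y → u ≈ v → x * u ≈ y * v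
  *-cong {_ +i _} {_ +i _} {_ +i _} {_ +i _} p q = mk≈
    (R.+-cong (R.*-cong (re≈ p) (re≈ q)) (R.-‿cong (R.*-cong (im≈ p) (im≈ q))))
    (R.+-cong (R.*-cong (re≈ p) (im≈ q)) (R.*-cong (im≈ p) (re≈ q)))

  opaque

    +-assoc : ∀ x y z → (x + y) + z ≈ x + (y + z)
    +-assoc (a +i b) (c +i d) (e +i f) = mk≈ (R.+-assoc a c e) (R.+-assoc b d f)

    +-comm : ∀ x y → x + y ≈ y + x
    +-comm (a +i b) (c +i d) = mk≈ (R.+-comm a c) (R.+-comm b d)

    +-identityˡ : ∀ x → 0ℂ + x ≈ x
    +-identityˡ (a +i b) = mk≈ (R.+-identityˡ a) (R.+-identityˡ b)

    +-identityʳ : ∀ x → x + 0ℂ ≈ x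
    +-identityʳ (a +i b) = mk≈ (R.+-identityʳ a) (R.+-identityʳ b)

    -‿inverseˡ : ∀ x → - x + x ≈ 0ℂ
    -‿inverseˡ (a +i b) = mk≈ (R.-‿inverseˡ a) (R.-‿inverseˡ b)

    -‿inverseʳ : ∀ x → x + - x ≈ 0ℂ
    -‿inverseʳ (a +i b) = mk≈ (R.-‿inverseʳ a) (R.-‿inverseʳ b)

  opaque

    *-assoc : ∀ x y z → (x * y) * z ≈ x * (y * z)
    *-assoc x@(a +i b) y@(c +i d) z@(e +i f) = mk≈
      (R.pointwise {re ((x * y) * z)} {re (x * (y * z))} λ n →
        ℂ-assoc-re (seq a n) (seq b n) (seq c n) (seq d n) (seq e n) (seq f n))
      (R.pointwise {im ((x * y) * z)} {im (x * (y * z))} λ n →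
        ℂ-assoc-im (seq a n) (seq b n) (seq c n) (seq d n) (seq e n) (seq f n))

    *-comm : ∀ x y → x * y ≈ y * x
    *-comm x@(a +i b) y@(c +i d) = mk≈
      (R.pointwise {re (x * y)} {re (y * x)} λ n →
        ℂ-comm-re (seq a n) (seq b n) (seq c n) (seq d n))
      (R.pointwise {im (x * y)} {im (y * x)} λ n →
        ℂ-comm-im (seq a n) (seq b n) (seq c n) (seq d n))

    *-identityˡ : ∀ x → 1ℂ * x ≈ x
    *-identityˡ x@(a +i b) = mk≈
      (R.pointwise {re (1ℂ * x)} {a} λ n → ℂ-identity-re (seq a n) (seq b n))
      (R.pointwise {im (1ℂ * x)} {b} λ n → ℂ-identity-im (seq a n) (seq b n))

    *-distribˡ-+ : ∀ x y z → x * (y + z) ≈ x * y + x * z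
    *-distribˡ-+ x@(a +i b) y@(c +i d) z@(e +i f) = mk≈
      (R.pointwise {re (x * (y + z))} {re (x * y + x * z)} λ n →
        ℂ-distrib-re (seq a n) (seq b n) (seq c n) (seq d n) (seq e n) (seq f n))
      (R.pointwise {im (x * (y + z))} {im (x * y + x * z)} λ n →
        ℂ-distrib-im (seq a n) (seq b n) (seq c n) (seq d n) (seq e n) (seq f n))

  open IsEquivalence ≈-isEquivalence using () renaming (trans to ≈-trans; sym to ≈-sym)

  *-identityʳ : ∀ x → x * 1ℂ ≈ x
  *-identityʳ x = ≈-trans (*-comm x 1ℂ) (*-identityˡ x)

  *-distribʳ-+ : ∀ x y z → (y + z) * x ≈ y * x + z * x
  *-distribʳ-+ x y z = ≈-trans (*-comm (y + z) x)
    (≈-trans (*-distribˡ-+ x y z) (+-cong (*-comm x y) (*-comm x z)))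

  isCommutativeRing : IsCommutativeRing _≈_ _+_ _*_ -_ 0ℂ 1ℂ
  isCommutativeRing = record
    { isRing = record
      { +-isAbelianGroup = record
        { isGroup = record
          { isMonoid = record
            { isSemigroup = record
              { isMagma = record { isEquivalence = ≈-isEquivalence ; ∙-cong = +-cong }
              ; assoc = +-assoc
              }
            ; identity = +-identityˡ , +-identityʳ
            }
          ; inverse = -‿inverseˡ , -‿inverseʳ
          ; ⁻¹-cong = -‿cong
          }
        ; comm = +-comm
        }
      ; *-cong = *-cong
      ; *-assoc = *-assoc
      ; *-identity = *-identityˡ , *-identityʳ
      ; distrib = *-distribˡ-+ , *-distribʳ-+
      }
    ; *-comm = *-comm
    }

  #-irrefl : ∀ {x y} → x ≈ y → ¬ x # y
  #-irrefl p (inj₁ h) = R.#-irrefl (re≈ p) h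
  #-irrefl p (inj₂ h) = R.#-irrefl (im≈ p) h

  #-sym : ∀ {x y} → x # y → y # x
  #-sym {x} {y} = Sum.map (R.#-sym {re x} {re y}) (R.#-sym {im x} {im y})

  #-cotrans : ∀ {x y} → x # y → ∀ z → x # z ⊎ z # y
  #-cotrans {x} {y} (inj₁ h) z = Sum.map inj₁ inj₁ (R.#-cotrans {re x} {re y} h (re z))
  #-cotrans {x} {y} (inj₂ h) z = Sum.map inj₂ inj₂ (R.#-cotrans {im x} {im y} h (im z))

  #-tight : ∀ {x y} → ¬ x # y → x ≈ y
  #-tight ¬h = mk≈ (R.#-tight λ h → ¬h (inj₁ h)) (R.#-tight λ h → ¬h (inj₂ h))

  norm²#0 : ∀ a b → (a +i b) # 0ℂ → a R.* a R.+ b R.* b R.# 0ℝ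
  norm²#0 a b (inj₁ h) = R.squares#0 {a} b h
  norm²#0 a b (inj₂ h) = R.#-respˡ {b R.* b R.+ a R.* a} {a R.* a R.+ b R.* b} {0ℝ}
    (R.+-comm (b R.* b) (a R.* a)) (R.squares#0 {b} a h)

  open import Algebra.Definitions _≈_ using (Invertible)

  opaque

    #0⇒invertible : ∀ {z} → z # 0ℂ → Invertible 1ℂ _*_ z
    #0⇒invertible {z@(a +i b)} z#0 = w , ≈-trans (*-comm w z) zw≈1 , zw≈1
      where
      s : ℝ
      s = proj₁ (R.#0⇒inverse {a R.* a R.+ b R.* b} (norm²#0 a b z#0))
      Ns≈1 : (a R.* a R.+ b R.* b) R.* s R.≈ 1ℝ
      Ns≈1 = proj₂ (R.#0⇒inverse {a R.* a R.+ b R.* b} (norm²#0 a b z#0))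
      w : ℂ
      w = (a R.* s) +i (R.- (b R.* s))
      zw≈1 : z * w ≈ 1ℂ
      zw≈1 = mk≈
        (R.≈-trans (R.pointwise {re (z * w)} {(a R.* a R.+ b R.* b) R.* s} λ n →
          ℂ-inverse-re (seq a n) (seq b n) (seq s n)) Ns≈1)
        (R.pointwise {im (z * w)} {0ℝ} λ n → ℂ-inverse-im (seq a n) (seq b n) (seq s n))

    invertible⇒#0 : ∀ {z} → Invertible 1ℂ _*_ z → z # 0ℂ
    invertible⇒#0 {a +i b} ((c +i d) , _ , zw≈1) = Sum.map (R.*#0⇒#0 {a} {c}) (R.*#0⇒#0 {b} {d})
      (R.difference#0 {a R.* c} {b R.* d} (R.inverse⇒#0 {a R.* c R.+ R.- (b R.* d)} {1ℝ}
        (R.≈-trans (R.*-identityʳ (a R.* c R.+ R.- (b R.* d))) (re≈ zw≈1))))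

  -#0⇒# : ∀ {x y} → x + - y # 0ℂ → x # y
  -#0⇒# {a +i b} {c +i d} = Sum.map (R.-#0⇒# {a} {c}) (R.-#0⇒# {b} {d})

  #⇒-#0 : ∀ {x y} → x # y → x + - y # 0ℂ
  #⇒-#0 {a +i b} {c +i d} = Sum.map (R.#⇒-#0 {a} {c}) (R.#⇒-#0 {b} {d})

ℂ-field : HeytingField 0ℓ 0ℓ 0ℓ
ℂ-field = record
  { Carrier = ℂ ; _≈_ = _≈_ ; _#_ = _#_
  ; _+_ = _+_ ; _*_ = _*_ ; -_ = -_ ; 0# = 0ℂ ; 1# = 1ℂ
  ; isHeytingField = record
    { isHeytingCommutativeRing = record
      { isCommutativeRing   = isCommutativeRing
      ; isApartnessRelation = record
        { irrefl = #-irrefl ; sym = λ {x} {y} → #-sym {x} {y} ; cotrans = λ {x} {y} → #-cotrans {x} {y} }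
      ; #⇒invertible = λ {x} {y} h → #0⇒invertible (#⇒-#0 {x} {y} h)
      ; invertible⇒# = λ {x} {y} h → -#0⇒# {x} {y} (invertible⇒#0 h)
      }
    ; tight = λ x y → #-tight , #-irrefl
    }
  }
  where open Complex

-- R[[X]]: a power series is its sequence of coefficients.
module Powerseries (R : CommutativeRing c ℓ) where

  open CommutativeRing R
  open CMSum +-commutativeMonoid using (sum-cong-≋; ∑-distrib-+; sum-syntax)
  open NaturalSolver commutativeSemiring using (solve; _:+_; _:*_; _:=_)
  open SetoidReasoning setoid

  PS : Set c
  PS = ℕ → Carrier

  infix 4 _≈ₛ_
  infixl 6 _+ₛ_
  infixl 7 _*ₛ_

  _≈ₛ_ : PS → PS → Set ℓ
  f ≈ₛ g = ∀ n → f n ≈ g n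

  const : Carrier → PS
  const a zero    = a
  const a (suc _) = 0#

  X : PS
  X zero          = 0#
  X (suc zero)    = 1#
  X (suc (suc _)) = 0#

  0ₛ 1ₛ : PS
  0ₛ _ = 0#
  1ₛ = const 1#

  _+ₛ_ _*ₛ_ : PS → PS → PS
  (f +ₛ g) n = f n + g n
  (f *ₛ g) n = ∑[ i < suc n ] (f (toℕ i) * g (n ∸ toℕ i))

  -ₛ_ : PS → PS
  (-ₛ f) n = - f n

  private

    tail : PS → PS
    tail f n = f (suc n)

    *ₛ-cong : ∀ {f g h k} → f ≈ₛ g → h ≈ₛ k → f *ₛ h ≈ₛ g *ₛ k
    *ₛ-cong p q n = sum-cong-≋ {suc n} λ i → *-cong (p (toℕ i)) (q (n ∸ toℕ i))

    distribˡ′ : ∀ f g h → f *ₛ (g +ₛ h) ≈ₛ f *ₛ g +ₛ f *ₛ h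
    distribˡ′ f g h n = trans
      (sum-cong-≋ {suc n} λ i → distribˡ (f (toℕ i)) (g (n ∸ toℕ i)) (h (n ∸ toℕ i)))
      (∑-distrib-+ {suc n} (λ i → f (toℕ i) * g (n ∸ toℕ i)) (λ i → f (toℕ i) * h (n ∸ toℕ i)))

    distribʳ′ : ∀ f g h → (g +ₛ h) *ₛ f ≈ₛ g *ₛ f +ₛ h *ₛ f
    distribʳ′ f g h n = trans
      (sum-cong-≋ {suc n} λ i → distribʳ (f (n ∸ toℕ i)) (g (toℕ i)) (h (toℕ i)))
      (∑-distrib-+ {suc n} (λ i → g (toℕ i) * f (n ∸ toℕ i)) (λ i → h (toℕ i) * f (n ∸ toℕ i)))

    scale : Carrier → PS → PS
    scale a f n = a * f n

    scale-*ₛ : ∀ a f g → scale a f *ₛ g ≈ₛ scale a (f *ₛ g)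
    scale-*ₛ a f g zero = solve 3 (λ a x y → a :* x :* y :+ con 0 := a :* (x :* y :+ con 0)) refl a (f 0) (g 0)
      where open NaturalSolver commutativeSemiring using (con)
    scale-*ₛ a f g (suc n) = begin
      a * f 0 * g (suc n) + (scale a (tail f) *ₛ g) n
        ≈⟨ +-congˡ (scale-*ₛ a (tail f) g n) ⟩
      a * f 0 * g (suc n) + a * (tail f *ₛ g) n
        ≈⟨ solve 4 (λ a x y z → a :* x :* y :+ a :* z := a :* (x :* y :+ z)) refl
             a (f 0) (g (suc n)) ((tail f *ₛ g) n) ⟩
      a * (f 0 * g (suc n) + (tail f *ₛ g) n) ∎

    *ₛ-last : ∀ f g n → (f *ₛ g) (suc n) ≈ f (suc n) * g 0 + (f *ₛ tail g) n
    *ₛ-last f g zero = solve 5 (λ x y z w o → x :* y :+ (z :* w :+ o) := z :* w :+ (x :* y :+ o)) refl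
      (f 0) (g 1) (f 1) (g 0) 0#
    *ₛ-last f g (suc n) = begin
      f 0 * g (suc (suc n)) + (tail f *ₛ g) (suc n)
        ≈⟨ +-congˡ (*ₛ-last (tail f) g n) ⟩
      f 0 * g (suc (suc n)) + (f (suc (suc n)) * g 0 + (tail f *ₛ tail g) n)
        ≈⟨ solve 3 (λ x y z → x :+ (y :+ z) := y :+ (x :+ z)) refl
             (f 0 * g (suc (suc n))) (f (suc (suc n)) * g 0) ((tail f *ₛ tail g) n) ⟩
      f (suc (suc n)) * g 0 + (f 0 * g (suc (suc n)) + (tail f *ₛ tail g) n) ∎

    *ₛ-comm : ∀ f g → f *ₛ g ≈ₛ g *ₛ f
    *ₛ-comm f g zero = +-congʳ (*-comm (f 0) (g 0))
    *ₛ-comm f g (suc n) = begin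
      f 0 * g (suc n) + (tail f *ₛ g) n
        ≈⟨ +-cong (*-comm (f 0) (g (suc n))) (*ₛ-comm (tail f) g n) ⟩
      g (suc n) * f 0 + (g *ₛ tail f) n
        ≈⟨ *ₛ-last g f n ⟨
      (g *ₛ f) (suc n) ∎

    *ₛ-assoc : ∀ f g h → (f *ₛ g) *ₛ h ≈ₛ f *ₛ (g *ₛ h)
    *ₛ-assoc f g h zero = solve 3 (λ x y z → (x :* y :+ con 0) :* z :+ con 0 := x :* (y :* z :+ con 0) :+ con 0)
      refl (f 0) (g 0) (h 0)
      where open NaturalSolver commutativeSemiring using (con)
    *ₛ-assoc f g h (suc n) = begin
      (f *ₛ g) 0 * h (suc n) + ((scale (f 0) (tail g) +ₛ tail f *ₛ g) *ₛ h) n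
        ≈⟨ +-cong (*-congʳ (+-identityʳ (f 0 * g 0)))
                  (distribʳ′ h (scale (f 0) (tail g)) (tail f *ₛ g) n) ⟩
      f 0 * g 0 * h (suc n) + ((scale (f 0) (tail g) *ₛ h) n + ((tail f *ₛ g) *ₛ h) n)
        ≈⟨ +-congˡ (+-cong (scale-*ₛ (f 0) (tail g) h n) (*ₛ-assoc (tail f) g h n)) ⟩
      f 0 * g 0 * h (suc n) + (f 0 * (tail g *ₛ h) n + (tail f *ₛ (g *ₛ h)) n)
        ≈⟨ solve 5 (λ x y z u v → x :* y :* z :+ (x :* u :+ v) := x :* (y :* z :+ u) :+ v) refl
             (f 0) (g 0) (h (suc n)) ((tail g *ₛ h) n) ((tail f *ₛ (g *ₛ h)) n) ⟩
      f 0 * (g 0 * h (suc n) + (tail g *ₛ h) n) + (tail f *ₛ (g *ₛ h)) n ∎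

    0*ₛ : ∀ f → 0ₛ *ₛ f ≈ₛ 0ₛ
    0*ₛ f zero    = trans (+-identityʳ (0# * f 0)) (zeroˡ (f 0))
    0*ₛ f (suc n) = trans (+-cong (zeroˡ (f (suc n))) (0*ₛ f n)) (+-identityˡ 0#)

    const-*ₛ : ∀ a f → const a *ₛ f ≈ₛ scale a f
    const-*ₛ a f zero    = +-identityʳ (a * f 0)
    const-*ₛ a f (suc n) = trans (+-congˡ (0*ₛ f n)) (+-identityʳ (a * f (suc n)))

    1*ₛ : ∀ f → 1ₛ *ₛ f ≈ₛ f
    1*ₛ f n = trans (const-*ₛ 1# f n) (*-identityˡ (f n))

  isCommutativeRing-ₛ : IsCommutativeRing _≈ₛ_ _+ₛ_ _*ₛ_ -ₛ_ 0ₛ 1ₛ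
  isCommutativeRing-ₛ = record
    { isRing = record
      { +-isAbelianGroup = record
        { isGroup = record
          { isMonoid = record
            { isSemigroup = record
              { isMagma = record
                { isEquivalence = record
                  { refl  = λ n → refl
                  ; sym   = λ p n → sym (p n)
                  ; trans = λ p q n → trans (p n) (q n)
                  }
                ; ∙-cong = λ p q n → +-cong (p n) (q n)
                }
              ; assoc = λ f g h n → +-assoc (f n) (g n) (h n)
              }
            ; identity = (λ f n → +-identityˡ (f n)) , (λ f n → +-identityʳ (f n))
            }
          ; inverse = (λ f n → -‿inverseˡ (f n)) , (λ f n → -‿inverseʳ (f n))
          ; ⁻¹-cong = λ p n → -‿cong (p n)
          }
        ; comm = λ f g n → +-comm (f n) (g n)
        }
      ; *-cong = λ {f} {g} {h} {k} → *ₛ-cong {f} {g} {h} {k}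
      ; *-assoc = *ₛ-assoc
      ; *-identity = 1*ₛ , (λ f n → trans (*ₛ-comm f 1ₛ n) (1*ₛ f n))
      ; distrib = distribˡ′ , distribʳ′
      }
    ; *-comm = *ₛ-comm
    }

  powerseriesRing : CommutativeRing c ℓ
  powerseriesRing = record { isCommutativeRing = isCommutativeRing-ₛ }

  -- 1/(1+X) = 1 - X + X² - ⋯
  [1+X]⁻¹ : PS
  [1+X]⁻¹ zero    = 1#
  [1+X]⁻¹ (suc n) = - [1+X]⁻¹ n

  X*-zero : ∀ f → (X *ₛ f) 0 ≈ 0#
  X*-zero f = trans (+-identityʳ (0# * f 0)) (zeroˡ (f 0))

  X*-suc : ∀ f n → (X *ₛ f) (suc n) ≈ f n
  X*-suc f n = begin
    0# * f (suc n) + (tail X *ₛ f) n ≈⟨ +-cong (zeroˡ (f (suc n))) (*ₛ-cong {tail X} {1ₛ} {f} {f} tail-X (λ _ → refl) n) ⟩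
    0# + (1ₛ *ₛ f) n                 ≈⟨ +-identityˡ ((1ₛ *ₛ f) n) ⟩
    (1ₛ *ₛ f) n                      ≈⟨ 1*ₛ f n ⟩
    f n                              ∎
    where
    tail-X : tail X ≈ₛ 1ₛ
    tail-X zero    = refl
    tail-X (suc _) = refl

  X-cancel : ∀ f g → X *ₛ f ≈ₛ X *ₛ g → f ≈ₛ g
  X-cancel f g p n = begin
    f n              ≈⟨ X*-suc f n ⟨
    (X *ₛ f) (suc n) ≈⟨ p (suc n) ⟩
    (X *ₛ g) (suc n) ≈⟨ X*-suc g n ⟩
    g n              ∎

  [1+X]*[1+X]⁻¹ : (1ₛ +ₛ X) *ₛ [1+X]⁻¹ ≈ₛ 1ₛ
  [1+X]*[1+X]⁻¹ n = trans (distribʳ′ [1+X]⁻¹ 1ₛ X n)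
    (trans (+-congʳ (1*ₛ [1+X]⁻¹ n)) (go n))
    where
    go : ∀ n → [1+X]⁻¹ n + (X *ₛ [1+X]⁻¹) n ≈ 1ₛ n
    go zero    = trans (+-congˡ (X*-zero [1+X]⁻¹)) (+-identityʳ 1#)
    go (suc n) = trans (+-congˡ (X*-suc [1+X]⁻¹ n)) (-‿inverseˡ ([1+X]⁻¹ n))

-- R[X]: power series with only finitely many nonzero coefficients.
module Polynomial (R : CommutativeRing c ℓ) where

  open CommutativeRing R
  open CMSum +-commutativeMonoid using (sum-cong-≋; sum-replicate-zero; sum)
  open Powerseries R using (PS; _≈ₛ_; _+ₛ_; _*ₛ_; -ₛ_; isCommutativeRing-ₛ) renaming (const to constₛ; X to Xₛ)
  private module S = IsCommutativeRing isCommutativeRing-ₛ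

  record Poly : Set (c ⊔ ℓ) where
    no-eta-equality; pattern
    constructor poly
    field
      coeff  : PS
      bound  : ℕ
      vanish : ∀ n → bound ℕ.≤ n → coeff n ≈ 0#
  open Poly public

  infix 4 _≈ₚ_
  record _≈ₚ_ (p q : Poly) : Set ℓ where
    constructor mk≈ₚ
    field coeff≈ : coeff p ≈ₛ coeff q
  open _≈ₚ_ public

  const : Carrier → Poly
  const a = poly (constₛ a) 1 λ { (suc n) _ → refl }

  X : Poly
  X = poly Xₛ 2 λ { (suc (suc n)) _ → refl ; (suc zero) (ℕ.s≤s ()) }

  private

    vanish-+ : ∀ p q n → bound p ℕ.⊔ bound q ℕ.≤ n → (coeff p +ₛ coeff q) n ≈ 0#
    vanish-+ p q n h = trans
      (+-cong (vanish p n (ℕ.m⊔n≤o⇒m≤o (bound p) (bound q) h))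
              (vanish q n (ℕ.m⊔n≤o⇒n≤o (bound p) (bound q) h)))
      (+-identityˡ 0#)

    either : ∀ a b n i → a ℕ.+ b ℕ.≤ n → a ℕ.≤ i ⊎ b ℕ.≤ n ∸ i
    either a b n i h with ℕ.≤-total a i
    ... | inj₁ a≤i = inj₁ a≤i
    ... | inj₂ i≤a = inj₂ (ℕ.m+n≤o⇒m≤o∸n b
      (ℕ.≤-trans (ℕ.+-monoʳ-≤ b i≤a) (ℕ.≤-trans (ℕ.≤-reflexive (ℕ.+-comm b a)) h)))

    vanish-* : ∀ p q n → bound p ℕ.+ bound q ℕ.≤ n → (coeff p *ₛ coeff q) n ≈ 0#
    vanish-* p q n h = trans (sum-cong-≋ {suc n} term) (sum-replicate-zero (suc n))
      where
      term : (i : Fin (suc n)) → coeff p (toℕ i) * coeff q (n ∸ toℕ i) ≈ 0#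
      term i with either (bound p) (bound q) n (toℕ i) h
      ... | inj₁ h₁ = trans (*-congʳ (vanish p (toℕ i) h₁)) (zeroˡ _)
      ... | inj₂ h₂ = trans (*-congˡ (vanish q (n ∸ toℕ i) h₂)) (zeroʳ _)

    vanish-neg : ∀ p n → bound p ℕ.≤ n → - coeff p n ≈ 0#
    vanish-neg p n h = trans (-‿cong (vanish p n h)) -0#≈0#
      where open RingProperties (CommutativeRing.ring R) using (-0#≈0#)

  _+ₚ_ _*ₚ_ : Poly → Poly → Poly
  p +ₚ q = poly (coeff p +ₛ coeff q) (bound p ℕ.⊔ bound q) (vanish-+ p q)
  p *ₚ q = poly (coeff p *ₛ coeff q) (bound p ℕ.+ bound q) (vanish-* p q)

  -ₚ_ : Poly → Poly
  -ₚ p = poly (-ₛ coeff p) (bound p) (vanish-neg p)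

  0ₚ 1ₚ : Poly
  0ₚ = poly (λ _ → 0#) 0 λ _ _ → refl
  1ₚ = const 1#

  isCommutativeRing-ₚ : IsCommutativeRing _≈ₚ_ _+ₚ_ _*ₚ_ -ₚ_ 0ₚ 1ₚ
  isCommutativeRing-ₚ = record
    { isRing = record
      { +-isAbelianGroup = record
        { isGroup = record
          { isMonoid = record
            { isSemigroup = record
              { isMagma = record
                { isEquivalence = record
                  { refl  = mk≈ₚ λ n → refl
                  ; sym   = λ p → mk≈ₚ λ n → sym (coeff≈ p n)
                  ; trans = λ p q → mk≈ₚ λ n → trans (coeff≈ p n) (coeff≈ q n)
                  }
                ; ∙-cong = λ p q → mk≈ₚ (S.+-cong (coeff≈ p) (coeff≈ q))
                }
              ; assoc = λ p q r → mk≈ₚ (S.+-assoc (coeff p) (coeff q) (coeff r))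
              }
            ; identity = (λ p → mk≈ₚ (S.+-identityˡ (coeff p))) , (λ p → mk≈ₚ (S.+-identityʳ (coeff p)))
            }
          ; inverse = (λ p → mk≈ₚ (S.-‿inverseˡ (coeff p))) , (λ p → mk≈ₚ (S.-‿inverseʳ (coeff p)))
          ; ⁻¹-cong = λ p → mk≈ₚ (S.-‿cong (coeff≈ p))
          }
        ; comm = λ p q → mk≈ₚ (S.+-comm (coeff p) (coeff q))
        }
      ; *-cong = λ {p} {q} {r} {s} p≈q r≈s → mk≈ₚ
          (S.*-cong {coeff p} {coeff q} {coeff r} {coeff s} (coeff≈ p≈q) (coeff≈ r≈s))
      ; *-assoc = λ p q r → mk≈ₚ (S.*-assoc (coeff p) (coeff q) (coeff r))
      ; *-identity = (λ p → mk≈ₚ (S.*-identityˡ (coeff p))) , (λ p → mk≈ₚ (S.*-identityʳ (coeff p)))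
      ; distrib = (λ p q r → mk≈ₚ (S.distribˡ (coeff p) (coeff q) (coeff r)))
                , (λ p q r → mk≈ₚ (S.distribʳ (coeff p) (coeff q) (coeff r)))
      }
    ; *-comm = λ p q → mk≈ₚ (S.*-comm (coeff p) (coeff q))
    }

  polynomialRing : CommutativeRing (c ⊔ ℓ) ℓ
  polynomialRing = record { isCommutativeRing = isCommutativeRing-ₚ }

-- R((X)) as the localisation R[[X]][X⁻¹]: f /X^ m stands for f · X⁻ᵐ.
module Laurent (R : CommutativeRing c ℓ) where

  open Powerseries R using (PS; X-cancel) renaming (powerseriesRing to PSRing; X to Xₛ)
  open CommutativeRing PSRing
  open SemiringExp semiring using (_^_; ^-homo-*)
  open NaturalSolver commutativeSemiring using (solve; _:+_; _:*_; _:=_; con)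
  open SetoidReasoning setoid
  open RingProperties (CommutativeRing.ring PSRing) using (-‿distribʳ-*)

  record Laurentseries : Set c where
    no-eta-equality; pattern
    constructor _/X^_
    field
      num : PS
      ord : ℕ
  open Laurentseries public

  infix 4 _≈ₗ_
  infixl 6 _+ₗ_
  infixl 7 _*ₗ_

  record _≈ₗ_ (a b : Laurentseries) : Set ℓ where
    constructor mk≈ₗ
    field cross : Xₛ ^ ord b * num a ≈ Xₛ ^ ord a * num b
  open _≈ₗ_ public

  _+ₗ_ _*ₗ_ : Laurentseries → Laurentseries → Laurentseries
  (f /X^ m) +ₗ (g /X^ n) = (Xₛ ^ n * f + Xₛ ^ m * g) /X^ (m ℕ.+ n)
  (f /X^ m) *ₗ (g /X^ n) = (f * g) /X^ (m ℕ.+ n)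

  -ₗ_ : Laurentseries → Laurentseries
  -ₗ (f /X^ m) = (- f) /X^ m

  ι : PS → Laurentseries
  ι f = f /X^ 0

  0ₗ 1ₗ X⁻¹ : Laurentseries
  0ₗ = ι 0#
  1ₗ = ι 1#
  X⁻¹ = 1# /X^ 1

  private

    X^-cancel : ∀ m f g → Xₛ ^ m * f ≈ Xₛ ^ m * g → f ≈ g
    X^-cancel zero    f g p = trans (sym (*-identityˡ f)) (trans p (*-identityˡ g))
    X^-cancel (suc m) f g p = X^-cancel m f g (X-cancel (Xₛ ^ m * f) (Xₛ ^ m * g)
      (trans (sym (*-assoc Xₛ (Xₛ ^ m) f)) (trans p (*-assoc Xₛ (Xₛ ^ m) g))))

    ≈ₗ-trans : ∀ {a b d} → a ≈ₗ b → b ≈ₗ d → a ≈ₗ d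
    ≈ₗ-trans {f /X^ m} {g /X^ n} {h /X^ o} (mk≈ₗ p) (mk≈ₗ q) = mk≈ₗ (X^-cancel n (Xₛ ^ o * f) (Xₛ ^ m * h) (begin
      Xₛ ^ n * (Xₛ ^ o * f) ≈⟨ swap (Xₛ ^ n) (Xₛ ^ o) f ⟩
      Xₛ ^ o * (Xₛ ^ n * f) ≈⟨ *-congˡ {Xₛ ^ o} {Xₛ ^ n * f} {Xₛ ^ m * g} p ⟩
      Xₛ ^ o * (Xₛ ^ m * g) ≈⟨ swap (Xₛ ^ o) (Xₛ ^ m) g ⟩
      Xₛ ^ m * (Xₛ ^ o * g) ≈⟨ *-congˡ {Xₛ ^ m} {Xₛ ^ o * g} {Xₛ ^ n * h} q ⟩
      Xₛ ^ m * (Xₛ ^ n * h) ≈⟨ swap (Xₛ ^ m) (Xₛ ^ n) h ⟩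
      Xₛ ^ n * (Xₛ ^ m * h) ∎))
      where
      swap : ∀ x y z → x * (y * z) ≈ y * (x * z)
      swap = solve 3 (λ x y z → x :* (y :* z) := y :* (x :* z)) refl

    same-ord : ∀ {f g m n} → f ≈ g → m ≡ n → f /X^ m ≈ₗ g /X^ n
    same-ord {m = m} f≈g ≡.refl = mk≈ₗ (*-congˡ {Xₛ ^ m} f≈g)

    +ₗ-cong : ∀ {a b d e} → a ≈ₗ b → d ≈ₗ e → a +ₗ d ≈ₗ b +ₗ e
    +ₗ-cong {f /X^ m} {f′ /X^ m′} {g /X^ n} {g′ /X^ n′} (mk≈ₗ p) (mk≈ₗ q) = mk≈ₗ (begin
      Xₛ ^ (m′ ℕ.+ n′) * (Xₛ ^ n * f + Xₛ ^ m * g)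
        ≈⟨ *-congʳ {Xₛ ^ n * f + Xₛ ^ m * g} (^-homo-* Xₛ m′ n′) ⟩
      Xₛ ^ m′ * Xₛ ^ n′ * (Xₛ ^ n * f + Xₛ ^ m * g)
        ≈⟨ solve 6 (λ a a′ b b′ f g → a′ :* b′ :* (b :* f :+ a :* g) :=
             b′ :* b :* (a′ :* f) :+ a′ :* a :* (b′ :* g)) refl
             (Xₛ ^ m) (Xₛ ^ m′) (Xₛ ^ n) (Xₛ ^ n′) f g ⟩
      Xₛ ^ n′ * Xₛ ^ n * (Xₛ ^ m′ * f) + Xₛ ^ m′ * Xₛ ^ m * (Xₛ ^ n′ * g)
        ≈⟨ +-cong (*-congˡ {Xₛ ^ n′ * Xₛ ^ n} p) (*-congˡ {Xₛ ^ m′ * Xₛ ^ m} q) ⟩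
      Xₛ ^ n′ * Xₛ ^ n * (Xₛ ^ m * f′) + Xₛ ^ m′ * Xₛ ^ m * (Xₛ ^ n * g′)
        ≈⟨ solve 6 (λ a a′ b b′ f g → b′ :* b :* (a :* f) :+ a′ :* a :* (b :* g) :=
             a :* b :* (b′ :* f :+ a′ :* g)) refl
             (Xₛ ^ m) (Xₛ ^ m′) (Xₛ ^ n) (Xₛ ^ n′) f′ g′ ⟩
      Xₛ ^ m * Xₛ ^ n * (Xₛ ^ n′ * f′ + Xₛ ^ m′ * g′)
        ≈⟨ *-congʳ {Xₛ ^ n′ * f′ + Xₛ ^ m′ * g′} (^-homo-* Xₛ m n) ⟨
      Xₛ ^ (m ℕ.+ n) * (Xₛ ^ n′ * f′ + Xₛ ^ m′ * g′) ∎)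

    *ₗ-cong : ∀ {a b d e} → a ≈ₗ b → d ≈ₗ e → a *ₗ d ≈ₗ b *ₗ e
    *ₗ-cong {f /X^ m} {f′ /X^ m′} {g /X^ n} {g′ /X^ n′} (mk≈ₗ p) (mk≈ₗ q) = mk≈ₗ (begin
      Xₛ ^ (m′ ℕ.+ n′) * (f * g)       ≈⟨ *-congʳ {f * g} (^-homo-* Xₛ m′ n′) ⟩
      Xₛ ^ m′ * Xₛ ^ n′ * (f * g)      ≈⟨ swap (Xₛ ^ m′) (Xₛ ^ n′) f g ⟩
      (Xₛ ^ m′ * f) * (Xₛ ^ n′ * g)    ≈⟨ *-cong p q ⟩
      (Xₛ ^ m * f′) * (Xₛ ^ n * g′)    ≈⟨ swap (Xₛ ^ m) (Xₛ ^ n) f′ g′ ⟨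
      Xₛ ^ m * Xₛ ^ n * (f′ * g′)      ≈⟨ *-congʳ {f′ * g′} (^-homo-* Xₛ m n) ⟨
      Xₛ ^ (m ℕ.+ n) * (f′ * g′)       ∎)
      where
      swap : ∀ a b f g → a * b * (f * g) ≈ (a * f) * (b * g)
      swap = solve 4 (λ a b f g → a :* b :* (f :* g) := (a :* f) :* (b :* g)) refl

    -ₗ-cong : ∀ {a b} → a ≈ₗ b → -ₗ a ≈ₗ -ₗ b
    -ₗ-cong {f /X^ m} {g /X^ n} (mk≈ₗ p) = mk≈ₗ (begin
      Xₛ ^ n * - f   ≈⟨ -‿distribʳ-* (Xₛ ^ n) f ⟨
      - (Xₛ ^ n * f) ≈⟨ -‿cong p ⟩
      - (Xₛ ^ m * g) ≈⟨ -‿distribʳ-* (Xₛ ^ m) g ⟩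
      Xₛ ^ m * - g   ∎)

    +ₗ-assoc : ∀ a b d → (a +ₗ b) +ₗ d ≈ₗ a +ₗ (b +ₗ d)
    +ₗ-assoc (f /X^ m) (g /X^ n) (h /X^ o) = same-ord (begin
      Xₛ ^ o * (Xₛ ^ n * f + Xₛ ^ m * g) + Xₛ ^ (m ℕ.+ n) * h
        ≈⟨ +-congˡ {Xₛ ^ o * (Xₛ ^ n * f + Xₛ ^ m * g)} (*-congʳ {h} (^-homo-* Xₛ m n)) ⟩
      Xₛ ^ o * (Xₛ ^ n * f + Xₛ ^ m * g) + Xₛ ^ m * Xₛ ^ n * h
        ≈⟨ solve 6 (λ a b d f g h → d :* (b :* f :+ a :* g) :+ a :* b :* h :=
             b :* d :* f :+ a :* (d :* g :+ b :* h)) refl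
             (Xₛ ^ m) (Xₛ ^ n) (Xₛ ^ o) f g h ⟩
      Xₛ ^ n * Xₛ ^ o * f + Xₛ ^ m * (Xₛ ^ o * g + Xₛ ^ n * h)
        ≈⟨ +-congʳ {Xₛ ^ m * (Xₛ ^ o * g + Xₛ ^ n * h)} (*-congʳ {f} (^-homo-* Xₛ n o)) ⟨
      Xₛ ^ (n ℕ.+ o) * f + Xₛ ^ m * (Xₛ ^ o * g + Xₛ ^ n * h) ∎) (ℕ.+-assoc m n o)

    +ₗ-comm : ∀ a b → a +ₗ b ≈ₗ b +ₗ a
    +ₗ-comm (f /X^ m) (g /X^ n) = same-ord (+-comm (Xₛ ^ n * f) (Xₛ ^ m * g)) (ℕ.+-comm m n)

    +ₗ-identityˡ : ∀ a → 0ₗ +ₗ a ≈ₗ a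
    +ₗ-identityˡ (f /X^ m) = same-ord
      (trans (+-cong (zeroʳ (Xₛ ^ m)) (*-identityˡ f)) (+-identityˡ f)) ≡.refl

    -ₗ-inverseˡ : ∀ a → (-ₗ a) +ₗ a ≈ₗ 0ₗ
    -ₗ-inverseˡ (f /X^ m) = mk≈ₗ (begin
      1# * (Xₛ ^ m * - f + Xₛ ^ m * f) ≈⟨ *-identityˡ (Xₛ ^ m * - f + Xₛ ^ m * f) ⟩
      Xₛ ^ m * - f + Xₛ ^ m * f        ≈⟨ distribˡ (Xₛ ^ m) (- f) f ⟨
      Xₛ ^ m * (- f + f)               ≈⟨ *-congˡ {Xₛ ^ m} (-‿inverseˡ f) ⟩
      Xₛ ^ m * 0#                      ≈⟨ zeroʳ (Xₛ ^ m) ⟩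
      0#                               ≈⟨ zeroʳ (Xₛ ^ (m ℕ.+ m)) ⟨
      Xₛ ^ (m ℕ.+ m) * 0#              ∎)

    *ₗ-assoc : ∀ a b d → (a *ₗ b) *ₗ d ≈ₗ a *ₗ (b *ₗ d)
    *ₗ-assoc (f /X^ m) (g /X^ n) (h /X^ o) = same-ord (*-assoc f g h) (ℕ.+-assoc m n o)

    *ₗ-comm : ∀ a b → a *ₗ b ≈ₗ b *ₗ a
    *ₗ-comm (f /X^ m) (g /X^ n) = same-ord (*-comm f g) (ℕ.+-comm m n)

    *ₗ-identityˡ : ∀ a → 1ₗ *ₗ a ≈ₗ a
    *ₗ-identityˡ (f /X^ m) = same-ord (*-identityˡ f) ≡.refl

    distribₗ : ∀ a b d → a *ₗ (b +ₗ d) ≈ₗ a *ₗ b +ₗ a *ₗ d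
    distribₗ (f /X^ m) (g /X^ n) (h /X^ o) = mk≈ₗ (begin
      Xₛ ^ ((m ℕ.+ n) ℕ.+ (m ℕ.+ o)) * (f * (Xₛ ^ o * g + Xₛ ^ n * h))
        ≈⟨ *-congʳ {f * (Xₛ ^ o * g + Xₛ ^ n * h)} (trans (^-homo-* Xₛ (m ℕ.+ n) (m ℕ.+ o))
             (*-cong (^-homo-* Xₛ m n) (^-homo-* Xₛ m o))) ⟩
      Xₛ ^ m * Xₛ ^ n * (Xₛ ^ m * Xₛ ^ o) * (f * (Xₛ ^ o * g + Xₛ ^ n * h))
        ≈⟨ solve 6 (λ a b d f g h → a :* b :* (a :* d) :* (f :* (d :* g :+ b :* h)) :=
             a :* (b :* d) :* (a :* d :* (f :* g) :+ a :* b :* (f :* h))) refl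
             (Xₛ ^ m) (Xₛ ^ n) (Xₛ ^ o) f g h ⟩
      Xₛ ^ m * (Xₛ ^ n * Xₛ ^ o) * (Xₛ ^ m * Xₛ ^ o * (f * g) + Xₛ ^ m * Xₛ ^ n * (f * h))
        ≈⟨ *-cong
             (trans (^-homo-* Xₛ m (n ℕ.+ o)) (*-congˡ {Xₛ ^ m} (^-homo-* Xₛ n o)))
             (+-cong (*-congʳ {f * g} (^-homo-* Xₛ m o)) (*-congʳ {f * h} (^-homo-* Xₛ m n))) ⟨
      Xₛ ^ (m ℕ.+ (n ℕ.+ o)) * (Xₛ ^ (m ℕ.+ o) * (f * g) + Xₛ ^ (m ℕ.+ n) * (f * h)) ∎)

  isCommutativeRing-ₗ : IsCommutativeRing _≈ₗ_ _+ₗ_ _*ₗ_ -ₗ_ 0ₗ 1ₗ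
  isCommutativeRing-ₗ = record
    { isRing = record
      { +-isAbelianGroup = record
        { isGroup = record
          { isMonoid = record
            { isSemigroup = record
              { isMagma = record
                { isEquivalence = record
                  { refl  = mk≈ₗ refl
                  ; sym   = λ p → mk≈ₗ (sym (cross p))
                  ; trans = ≈ₗ-trans
                  }
                ; ∙-cong = +ₗ-cong
                }
              ; assoc = +ₗ-assoc
              }
            ; identity = +ₗ-identityˡ , λ a → ≈ₗ-trans (+ₗ-comm a 0ₗ) (+ₗ-identityˡ a)
            }
          ; inverse = -ₗ-inverseˡ , λ a → ≈ₗ-trans (+ₗ-comm a (-ₗ a)) (-ₗ-inverseˡ a)
          ; ⁻¹-cong = -ₗ-cong
          }
        ; comm = +ₗ-comm
        }
      ; *-cong = *ₗ-cong
      ; *-assoc = *ₗ-assoc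
      ; *-identity = *ₗ-identityˡ , λ a → ≈ₗ-trans (*ₗ-comm a 1ₗ) (*ₗ-identityˡ a)
      ; distrib = distribₗ , λ a b d → ≈ₗ-trans (*ₗ-comm (b +ₗ d) a)
          (≈ₗ-trans (distribₗ a b d) (+ₗ-cong (*ₗ-comm a b) (*ₗ-comm a d)))
      }
    ; *-comm = *ₗ-comm
    }

  laurentRing : CommutativeRing c ℓ
  laurentRing = record { isCommutativeRing = isCommutativeRing-ₗ }

  ι-injective : ∀ f g → ι f ≈ₗ ι g → f ≈ g
  ι-injective f g (mk≈ₗ p) = trans (sym (*-identityˡ f)) (trans p (*-identityˡ g))

-- R[[X₁,…,X_d]] as an iterated power series ring, X₁ being the outermost variable.
Series : CommutativeRing c ℓ → ℕ → CommutativeRing c ℓ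
Series R zero    = R
Series R (suc d) = Powerseries.powerseriesRing (Series R d)

module _ (R : CommutativeRing c ℓ) where

  open CommutativeRing R using (Carrier)

  constant : ∀ d → Carrier → CommutativeRing.Carrier (Series R d)
  constant zero    a = a
  constant (suc d) a = Powerseries.const (Series R d) (constant d a)

  -- var d j is X_j for 1 ≤ j ≤ d, and 0 for any other j.
  var : ∀ d → ℕ → CommutativeRing.Carrier (Series R d)
  var d       zero          = CommutativeRing.0# (Series R d)
  var zero    (suc _)       = CommutativeRing.0# R
  var (suc d) (suc zero)    = Powerseries.X (Series R d)
  var (suc d) (suc (suc j)) = Powerseries.const (Series R d) (var d (suc j))

  -- The series Σ a(e₁,…,e_d) X₁^e₁ ⋯ X_d^e_d.
  fromCoeffs : ∀ d → (Vec ℕ d → Carrier) → CommutativeRing.Carrier (Series R d)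
  fromCoeffs zero    a   = a []
  fromCoeffs (suc d) a e = fromCoeffs d λ es → a (e ∷ es)

MultiIndex : Set
MultiIndex = List ℕ

wt dep : MultiIndex → ℕ
wt  = ℕ.sum
dep = length

height : ℕ → MultiIndex → ℕ
height i ks = length (filter (suc i ℕ.≤?_) ks)

words : {A : Set a} → ℕ → List A → List (List A)
words zero    xs = [] ∷ []
words (suc l) xs = concatMap (λ x → List.map (x ∷_) (words l xs)) xs

-- Multi-indices of weight k have all their entries in {1,…,k}.
I : ∀ {r} → ℕ → ℕ → Vec ℕ r → List MultiIndex
I k l h = filter
  (λ ks → (wt ks ℕ.≟ k) ×-dec Vec.≡-dec ℕ._≟_ (tabulate λ i → height (suc (toℕ i)) ks) h)
  (words l (List.map suc (upTo k)))

data Box : Set where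
  comma plus minus1plus : Box

fill : ℕ → List (Box × ℕ) → MultiIndex
fill k []                       = k ∷ []
fill k ((comma      , k′) ∷ bs) = k ∷ fill k′ bs
fill k ((plus       , k′) ∷ bs) = fill (k ℕ.+ k′) bs
fill k ((minus1plus , k′) ∷ bs) = fill (k ∸ 1 ℕ.+ k′) bs

fillings : MultiIndex → List MultiIndex
fillings []       = [] ∷ []
fillings (k ∷ ks) = List.map (λ bs → fill k (zip bs ks))
  (words (length ks) (comma ∷ plus ∷ minus1plus ∷ []))

-- The lists m₁,…,m_l with n > m₁ > ⋯ > m_l > 0.
decreasing : ℕ → ℕ → List (List ℕ)
decreasing n zero    = [] ∷ []
decreasing n (suc l) = concatMap (λ m → List.map (m ∷_) (decreasing m l)) (List.map suc (upTo (n ∸ 1)))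

differences : ∀ {r} → Vec ℕ (suc r) → Vec ℤ (suc r)
differences (a ∷ [])    = + a ∷ []
differences (a ∷ b ∷ v) = + a ℤ.- + b ∷ differences (b ∷ v)

-- The exponents of u₁,…,u_{r+2} that go with G(k,l,h₁,…,h_r).
exponents : ∀ {r} → ℕ → ℕ → Vec ℕ r → Vec ℤ (suc (suc r))
exponents k l h = + k ℤ.- + l ℤ.- + Vec.sum h ∷ differences (l ∷ h)

suffixSums : ∀ {m} → Vec ℕ m → Vec ℕ m
suffixSums []       = []
suffixSums (e ∷ es) = e ℕ.+ Vec.sum es ∷ suffixSums es

-- The inverse of exponents: index e is the only (k , l ∷ h) whose exponents are e.
index : ∀ {r} → Vec ℕ (suc (suc r)) → ℕ × Vec ℕ (suc r)
index (e ∷ es) = e ℕ.+ Vec.sum (suffixSums es) , suffixSums es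

private

  sub-add : ∀ a b → + (a ℕ.+ b) ℤ.- + b ≡ + a
  sub-add a b = solve 2 (λ a b → a :+ b :- b := a) ≡.refl (+ a) (+ b)
    where open ℤSolver.+-*-Solver

  differences-suffixSums : ∀ {r} (es : Vec ℕ (suc r)) →
    differences (suffixSums es) ≡ Vec.map +_ es
  differences-suffixSums (e ∷ [])      = ≡.cong (λ x → + x ∷ []) (ℕ.+-identityʳ e)
  differences-suffixSums (e ∷ e′ ∷ es) =
    ≡.cong₂ _∷_ (sub-add e (e′ ℕ.+ Vec.sum es)) (differences-suffixSums (e′ ∷ es))

  sub≡⇒≡add : ∀ a b e → + a ℤ.- + b ≡ + e → a ≡ e ℕ.+ b
  sub≡⇒≡add a b e p = ℤ.+-injective (≡.trans
    (solve 2 (λ a b → a := a :- b :+ b) ≡.refl (+ a) (+ b)) (≡.cong (ℤ._+ + b) p))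
    where open ℤSolver.+-*-Solver

  suffixSums-differences : ∀ {r} (v : Vec ℕ (suc r)) (es : Vec ℕ (suc r)) →
    differences v ≡ Vec.map +_ es → v ≡ suffixSums es
  suffixSums-differences (a ∷ []) (e ∷ []) p =
    ≡.cong (_∷ []) (≡.trans (ℤ.+-injective (Vec.∷-injectiveˡ p)) (≡.sym (ℕ.+-identityʳ e)))
  suffixSums-differences (a ∷ b ∷ v) (e ∷ e′ ∷ es) p
    with suffixSums-differences (b ∷ v) (e′ ∷ es) (Vec.∷-injectiveʳ p)
  ... | ≡.refl = ≡.cong (_∷ suffixSums (e′ ∷ es)) (sub≡⇒≡add a b e (Vec.∷-injectiveˡ p))

exponents-index : ∀ {r} (e : Vec ℕ (suc (suc r))) → let k , lh = index e in
  exponents k (Vec.head lh) (Vec.tail lh) ≡ Vec.map +_ e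
exponents-index (e₁ ∷ e₂ ∷ es) = ≡.cong₂ _∷_
  (solve 3 (λ e l s → e :+ (l :+ s) :- l :- s := e) ≡.refl
    (+ e₁) (+ (e₂ ℕ.+ Vec.sum es)) (+ Vec.sum (suffixSums es)))
  (differences-suffixSums (e₂ ∷ es))
  where open ℤSolver.+-*-Solver

index-unique : ∀ {r} k l (h : Vec ℕ r) e →
  exponents k l h ≡ Vec.map +_ e → index e ≡ (k , l ∷ h)
index-unique k l h (e ∷ es) p with suffixSums-differences (l ∷ h) es (Vec.∷-injectiveʳ p)
... | q = ≡.cong₂ _,_ (≡.trans (≡.cong (λ v → e ℕ.+ Vec.sum v) (≡.sym q)) (≡.sym k≡)) (≡.sym q)
  where
  open ℤSolver.+-*-Solver
  k≡ : k ≡ e ℕ.+ (l ℕ.+ Vec.sum h)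
  k≡ = sub≡⇒≡add k (l ℕ.+ Vec.sum h) e (≡.trans
    (solve 3 (λ k l s → k :- (l :+ s) := k :- l :- s) ≡.refl (+ k) (+ l) (+ Vec.sum h))
    (Vec.∷-injectiveˡ p))

fieldRing : HeytingField c ℓ₁ ℓ₂ → CommutativeRing c ℓ₁
fieldRing K = HeytingCommutativeRing.commutativeRing (HeytingField.heytingCommutativeRing K)

-- q^m ≠ 1 for 0 < m < n, with ≠ read as apartness, which is what makes 1 - q^m invertible.
PowersApartFrom1 : (K : HeytingField c ℓ₁ ℓ₂) → ℕ → HeytingField.Carrier K → Set ℓ₂
PowersApartFrom1 K n q = ∀ m → 1 ℕ.≤ m → m ℕ.< n → q ^ m # 1#
  where
  open HeytingField K
  open SemiringExp (CommutativeRing.semiring (fieldRing K)) using (_^_)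

module GeneratingFunction (K : HeytingField c ℓ₁ ℓ₂) (n r : ℕ)
  (q : HeytingField.Carrier K) (q^m#1 : PowersApartFrom1 K n q) where

  open import Data.Nat.Combinatorics using (_C_)

  module K where
    open HeytingField K public using (_#_; #-sym; #⇒invertible)
    open CommutativeRing (fieldRing K) public
    open SemiringExp semiring public using (_^_)

  module K[t] where
    open Polynomial (fieldRing K) public using (const; X)
    open CommutativeRing (Polynomial.polynomialRing (fieldRing K)) public
    open SemiringExp semiring public using (_^_)

  -- 1/(1 - q^m); the value for m outside {1,…,n-1} is never used.
  [1-q^_]⁻¹ : ℕ → K.Carrier
  [1-q^ m ]⁻¹ with 1 ℕ.≤? m | m ℕ.<? n
  ... | yes 1≤m | yes m<n = proj₁ (K.#⇒invertible (K.#-sym (q^m#1 m 1≤m m<n)))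
  ... | _       | _       = K.0#

  z̄-term : MultiIndex → List ℕ → K.Carrier
  z̄-term ks ms = q K.^ ℕ.sum (zipWith (λ k m → (k ∸ 1) ℕ.* m) ks ms)
    K.* foldr K._*_ K.1# (zipWith (λ k m → [1-q^ m ]⁻¹ K.^ k) ks ms)

  -- On the empty multi-index this is the empty product 1.
  z̄ : MultiIndex → K.Carrier
  z̄ ks = foldr K._+_ K.0# (List.map (z̄-term ks) (decreasing n (dep ks)))

  z̄ᵗ : MultiIndex → K[t].Carrier
  z̄ᵗ ks = foldr K[t]._+_ K[t].0#
    (List.map (λ ps → K[t].const (z̄ ps) K[t].* K[t].X K[t].^ (dep ks ∸ dep ps)) (fillings ks))

  -- G(0,0,0,…,0) = 1 because I(0,0,0,…,0) consists of the empty multi-index.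
  G : ℕ → ℕ → Vec ℕ r → K[t].Carrier
  G k l h = foldr K[t]._+_ K[t].0# (List.map z̄ᵗ (I k l h))

  -- K[t][[u₂,…,u_{r+2}]] and K[t][[u₁,…,u_{r+2}]]
  S′ S : CommutativeRing (c ⊔ ℓ₁) ℓ₁
  S′ = Series (Polynomial.polynomialRing (fieldRing K)) (suc r)
  S  = Series (Polynomial.polynomialRing (fieldRing K)) (suc (suc r))

  -- For nonempty I(k,l,h₁,…,h_r) the exponents of (k,l,h₁,…,h_r) are nonnegative, so
  -- every nonzero term of the defining sum is the term at index e for exactly one e.
  Ψ : CommutativeRing.Carrier S
  Ψ = fromCoeffs (Polynomial.polynomialRing (fieldRing K)) (suc (suc r))
    λ e → let k , lh = index e in G k (Vec.head lh) (Vec.tail lh)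

  -- The ring K[t][[u₂,…,u_{r+2}]]((u₁)), which contains K[t][[u₁,…,u_{r+2}]] through ι.
  module L where
    open Laurent S′ public using (ι) renaming (X⁻¹ to u₁⁻¹)
    open CommutativeRing (Laurent.laurentRing S′) public
    open SemiringExp semiring public using (_^_)
    open MonoidMult +-monoid public using () renaming (_×_ to _·_)
    open CMSum +-commutativeMonoid public using (sum-syntax)
    open CMSum *-commutativeMonoid public using () renaming (sum to product)
    open import Algebra.Definitions _≈_ public using (Invertible)

  open L

  scalar : K[t].Carrier → L.Carrier
  scalar a = ι (constant (Polynomial.polynomialRing (fieldRing K)) (suc (suc r)) a)

  t : L.Carrier
  t = scalar K[t].X

  u : ℕ → L.Carrier
  u j = ι (var (Polynomial.polynomialRing (fieldRing K)) (suc (suc r)) j)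

  [1+u₁]⁻¹ : L.Carrier
  [1+u₁]⁻¹ = ι (Powerseries.[1+X]⁻¹ S′)

  1-q^_ : ℕ → L.Carrier
  1-q^ j = scalar (K[t].const (K.1# K.- q K.^ j))

  x₁ : L.Carrier
  x₁ = u 1 * [1+u₁]⁻¹

  -- x i for 2 ≤ i ≤ r+2; the summation index is a = j - i.
  x : ℕ → L.Carrier
  x i = (∑[ a < r ℕ.+ 2 ∸ i ] let j = i ℕ.+ toℕ a in
          (- 1#) ^ (j ∸ i) * (((j ∸ 2) C (i ∸ 2)) · (u j - u (r ℕ.+ 2) * u₁⁻¹ ^ (r ℕ.+ 2 ∸ j))))
      + u (r ℕ.+ 2) * u₁⁻¹ ^ (r ℕ.+ 2 ∸ i) * [1+u₁]⁻¹ ^ (i ∸ 1)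

  -- P s is Pˢ, to be used at s = t and at s = t - 1.
  P : L.Carrier → L.Carrier → L.Carrier
  P s T = T ^ (r ℕ.+ 1) - (x₁ + s * x 2) * T ^ r
    - s * (∑[ i < r ] ((x (r ℕ.+ 2 ∸ toℕ i) - x₁ * x (r ℕ.+ 1 ∸ toℕ i)) * T ^ toℕ i))

  ∏P : L.Carrier → L.Carrier
  ∏P s = product {n ∸ 1} λ i → P s (1-q^ suc (toℕ i))

{-# OPTIONS --safe #-}

-- Put b = q^m, T = 1 - q^m and f k = b^(k-1)/T^k. From b + T = 1 one gets
-- f k * f k′ = f (k + k′) + f (k - 1 + k′), hence, writing z̄ᵗₘ for the sum over m ≥ m₁ > ⋯ > m_l > 0,
--   z̄ᵗₘ(k , 𝐤) = z̄ᵗₘ₋₁(k , 𝐤) + f k * (t * z̄ᵗₘ(𝐤) + (1 - t) * z̄ᵗₘ₋₁(𝐤)).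
-- Multiply by the monomial of (k , 𝐤), which is that of 𝐤 times u_{k+1} if k ≤ r, and times
-- u₁^(k-1-r) u_{r+2} if k > r, and sum: the terms with k > r form a geometric series, and
--   (T^r (T - x₁) - t Q) Ψₘ = (T^r (T - x₁) - (t - 1) Q) Ψₘ₋₁,
--   Q = (T - x₁) ∑_{k<r} u_{k+2} b^k T^(r-1-k) + u_{r+2} b^r / (1 + u₁).
-- By the binomial theorem and two geometric sums the factors are Pᵗ(T) and Pᵗ⁻¹(T), so the
-- product over m telescopes. The factors T^r (T - x₁) - t Q are invertible because their constant
-- term is T^(r+1).

module Submission where

open import Defs
open import Level using (Level; _⊔_)
open import Algebra.Bundles using (CommutativeRing; RawRing)
import Algebra.Properties.CommutativeMonoid.Sum as CMSum
import Algebra.Properties.CommutativeSemiring.Binomial as Binomial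
import Algebra.Properties.Monoid.Mult as MonoidMult
import Algebra.Properties.Ring as RingProperties
import Algebra.Properties.Semiring.Exp as SemiringExp
import Algebra.Properties.Semiring.Mult.TCOptimised as Mult′
import Algebra.Solver.Ring as RingSolver
open import Algebra.Apartness.Bundles using (HeytingField)
open import Algebra.Morphism.Structures using (IsRingHomomorphism)
open import Algebra.Solver.Ring.AlmostCommutativeRing using (fromCommutativeRing; _-Raw-AlmostCommutative⟶_)
open import Data.Empty using (⊥-elim)
open import Data.Fin using (toℕ)
open import Data.Integer as ℤ using (ℤ; +_; -[1+_])
import Data.Integer.Properties as ℤ
open import Data.List as List using (List; []; _∷_; length; upTo; applyUpTo; foldr; zip; zipWith; filter; concatMap)
import Data.List.Properties as List
open import Data.List.Relation.Unary.All using (All; []; _∷_)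
import Data.Maybe as Maybe
open import Data.Nat as ℕ using (ℕ; zero; suc; _∸_; NonZero; z≤n; s≤s)
open import Data.Nat.Combinatorics using (_C_)
import Data.Nat.Properties as ℕ
import Data.Nat.Solver as ℕSolver
import Data.Nat.ListAction as ℕ
open import Data.Product using (Σ-syntax; ∃-syntax; _×_; _,_; proj₁; proj₂)
open import Data.Sum using (_⊎_; inj₁; inj₂)
open import Data.Vec as Vec using (Vec; []; _∷_; tabulate)
import Data.Vec.Properties as Vec
open import Function using (_∘_)
import Relation.Binary.Reasoning.Setoid as SetoidReasoning
open import Relation.Binary.PropositionalEquality as ≡ using (_≡_)
open import Relation.Nullary using (¬_; Dec; yes; no)
open import Relation.Nullary.Decidable using (_×-dec_; dec⇒maybe)

-- As the two mergings of neighbouring entries add up to f k * f k′, a factor t per merging is a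
-- factor t per coincidence: z̄ᵗ is the sum over n > m₁ ≥ ⋯ ≥ m_l > 0 with one t for each equality
-- m_i = m_{i+1}. The recursion asks whether the second summation variable equals m, which produces
-- t Ψₘ + (1 - t) Ψₘ₋₁ and hence the pair Pᵗ, Pᵗ⁻¹. Two obstacles shape the proof. The sum over all
-- first entries k is infinite, while series are coefficient functions; so everything is compared
-- coefficient by coefficient, and the geometric series D is used only through its equation D = (b^r
-- / T^(r+1)) u_{r+2} V + (b/T) u₁ D, where V = t Ψₘ + (1 - t) Ψₘ₋₁. Moreover x_i is written with
-- u₁⁻¹ and lives in a ring of Laurent series, where invertibility cannot be read off a constant
-- term. So the factors of the products have a second form, `core`, free of u₁⁻¹: telescoping and
-- inversion take place among power series, and only the results are mapped by `ι`.

private variable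
  a c ℓ ℓ₁ ℓ₂ ℓ₃ ℓ₄ ℓ₅ : Level

-- Ring identities with integer coefficients.

module IntegerSolver (R : CommutativeRing c ℓ) where

  open CommutativeRing R
  open RingProperties ring using (-0#≈0#; -‿distribˡ-*; -‿distribʳ-*; -‿involutive; -‿+-comm)
  open Mult′ semiring using (×-homo-+; ×1-homo-*; 1+×) renaming (_×_ to _·_)
  open SetoidReasoning setoid

  private

    -- The optimised multiple computes 1 · 1# to 1#, so the constant one of the solver denotes 1# on
    -- the nose.
    ⟦_⟧ℤ : ℤ → Carrier
    ⟦ + n ⟧ℤ      = n · 1#
    ⟦ -[1+ n ] ⟧ℤ = - (suc n · 1#)

    ⊖-homo : ∀ m n → ⟦ m ℤ.⊖ n ⟧ℤ ≈ m · 1# - n · 1#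
    ⊖-homo zero    zero    = sym (-‿inverseʳ 0#)
    ⊖-homo (suc m) zero    = sym (trans (+-congˡ -0#≈0#) (+-identityʳ _))
    ⊖-homo zero    (suc n) = sym (+-identityˡ _)
    ⊖-homo (suc m) (suc n) = begin
      ⟦ suc m ℤ.⊖ suc n ⟧ℤ            ≡⟨ ≡.cong ⟦_⟧ℤ (ℤ.[1+m]⊖[1+n]≡m⊖n m n) ⟩
      ⟦ m ℤ.⊖ n ⟧ℤ                    ≈⟨ ⊖-homo m n ⟩
      m · 1# - n · 1#                 ≈⟨ +-congˡ (+-identityˡ _) ⟨
      m · 1# + (0# - n · 1#)          ≈⟨ +-congˡ (+-congʳ (-‿inverseʳ 1#)) ⟨
      m · 1# + (1# - 1# - n · 1#)     ≈⟨ +-congˡ (+-assoc _ _ _) ⟩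
      m · 1# + (1# + (- 1# - n · 1#)) ≈⟨ +-assoc _ _ _ ⟨
      m · 1# + 1# + (- 1# - n · 1#)   ≈⟨ +-cong (trans (+-comm _ _) (sym (1+× m 1#)))
                                           (trans (-‿+-comm _ _) (-‿cong (sym (1+× n 1#)))) ⟩
      suc m · 1# - suc n · 1#         ∎

    +-homo : ∀ i j → ⟦ i ℤ.+ j ⟧ℤ ≈ ⟦ i ⟧ℤ + ⟦ j ⟧ℤ
    +-homo (+ m)    (+ n)    = ×-homo-+ 1# m n
    +-homo (+ m)    -[1+ n ] = ⊖-homo m (suc n)
    +-homo -[1+ m ] (+ n)    = trans (⊖-homo n (suc m)) (+-comm _ _)
    +-homo -[1+ m ] -[1+ n ] = trans
      (-‿cong (trans (reflexive (≡.cong (λ k → suc k · 1#) (≡.sym (ℕ.+-suc m n)))) (×-homo-+ 1# (suc m) (suc n))))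
      (sym (-‿+-comm _ _))

    neg-homo : ∀ i → ⟦ ℤ.- i ⟧ℤ ≈ - ⟦ i ⟧ℤ
    neg-homo (+ zero)  = sym -0#≈0#
    neg-homo (+ suc n) = refl
    neg-homo -[1+ n ]  = sym (-‿involutive _)

    *-homo⁺ : ∀ m j → ⟦ + m ℤ.* j ⟧ℤ ≈ m · 1# * ⟦ j ⟧ℤ
    *-homo⁺ m (+ n)    = trans (reflexive (≡.cong ⟦_⟧ℤ (≡.sym (ℤ.pos-* m n)))) (×1-homo-* m n)
    *-homo⁺ m -[1+ n ] = begin
      ⟦ + m ℤ.* -[1+ n ] ⟧ℤ       ≡⟨ ≡.cong ⟦_⟧ℤ (ℤ.neg-distribʳ-* (+ m) (+ suc n)) ⟨
      ⟦ ℤ.- (+ m ℤ.* + suc n) ⟧ℤ  ≈⟨ neg-homo (+ m ℤ.* + suc n) ⟩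
      - ⟦ + m ℤ.* + suc n ⟧ℤ      ≈⟨ -‿cong (*-homo⁺ m (+ suc n)) ⟩
      - (m · 1# * (suc n · 1#))   ≈⟨ -‿distribʳ-* _ _ ⟩
      m · 1# * - (suc n · 1#)     ∎

    *-homo : ∀ i j → ⟦ i ℤ.* j ⟧ℤ ≈ ⟦ i ⟧ℤ * ⟦ j ⟧ℤ
    *-homo (+ m)    j = *-homo⁺ m j
    *-homo -[1+ m ] j = begin
      ⟦ -[1+ m ] ℤ.* j ⟧ℤ         ≡⟨ ≡.cong ⟦_⟧ℤ (ℤ.neg-distribˡ-* (+ suc m) j) ⟨
      ⟦ ℤ.- (+ suc m ℤ.* j) ⟧ℤ    ≈⟨ neg-homo (+ suc m ℤ.* j) ⟩
      - ⟦ + suc m ℤ.* j ⟧ℤ        ≈⟨ -‿cong (*-homo⁺ (suc m) j) ⟩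
      - (suc m · 1# * ⟦ j ⟧ℤ)     ≈⟨ -‿distribˡ-* _ _ ⟩
      - (suc m · 1#) * ⟦ j ⟧ℤ     ∎

    ℤ-rawRing : RawRing _ _
    ℤ-rawRing = record
      { Carrier = ℤ ; _≈_ = _≡_ ; _+_ = ℤ._+_ ; _*_ = ℤ._*_ ; -_ = ℤ.-_ ; 0# = + 0 ; 1# = + 1 }

    homomorphism : ℤ-rawRing -Raw-AlmostCommutative⟶ fromCommutativeRing R
    homomorphism = record
      { ⟦_⟧ = ⟦_⟧ℤ ; +-homo = +-homo ; *-homo = *-homo ; -‿homo = neg-homo ; 0-homo = refl ; 1-homo = refl }

  open RingSolver ℤ-rawRing (fromCommutativeRing R) homomorphism
    (λ i j → Maybe.map (λ p → reflexive (≡.cong ⟦_⟧ℤ p)) (dec⇒maybe (i ℤ.≟ j))) public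
    using (solve; con; _:+_; _:*_; _:-_; :-_; _:=_; Polynomial)

  :1 : ∀ {n} → Polynomial n
  :1 = con (+ 1)

-- Sums over initial segments of the natural numbers.

module RangeSum (R : CommutativeRing c ℓ) where

  open CommutativeRing R
  open CMSum +-commutativeMonoid using (sum)
  open SemiringExp semiring using (_^_)
  open IntegerSolver R
  open SetoidReasoning setoid

  -- Summands are functions on ℕ and not on `Fin`, so that splitting, reversing and shifting the
  -- range need no casts of indices.
  Σ< : ℕ → (ℕ → Carrier) → Carrier
  Σ< zero    f = 0#
  Σ< (suc n) f = f 0 + Σ< n (f ∘ suc)

  sum≡Σ< : ∀ n (f : ℕ → Carrier) → sum {n} (f ∘ toℕ) ≡ Σ< n f
  sum≡Σ< zero    f = ≡.refl
  sum≡Σ< (suc n) f = ≡.cong (_+_ (f 0)) (sum≡Σ< n (f ∘ suc))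

  Σ<-cong : ∀ n {f g : ℕ → Carrier} → (∀ i → i ℕ.< n → f i ≈ g i) → Σ< n f ≈ Σ< n g
  Σ<-cong zero    p = refl
  Σ<-cong (suc n) p = +-cong (p 0 (s≤s z≤n)) (Σ<-cong n λ i i<n → p (suc i) (s≤s i<n))

  Σ<-zero : ∀ n {f : ℕ → Carrier} → (∀ i → i ℕ.< n → f i ≈ 0#) → Σ< n f ≈ 0#
  Σ<-zero zero    p = refl
  Σ<-zero (suc n) p = trans (+-cong (p 0 (s≤s z≤n)) (Σ<-zero n λ i i<n → p (suc i) (s≤s i<n))) (+-identityˡ 0#)

  Σ<-+ : ∀ n (f g : ℕ → Carrier) → Σ< n (λ i → f i + g i) ≈ Σ< n f + Σ< n g
  Σ<-+ zero    f g = sym (+-identityˡ 0#)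
  Σ<-+ (suc n) f g = trans (+-congˡ (Σ<-+ n (f ∘ suc) (g ∘ suc)))
    (solve 4 (λ a b d e → (a :+ b) :+ (d :+ e) := (a :+ d) :+ (b :+ e)) refl (f 0) (g 0) _ _)

  Σ<-*ˡ : ∀ n a (f : ℕ → Carrier) → a * Σ< n f ≈ Σ< n (λ i → a * f i)
  Σ<-*ˡ zero    a f = zeroʳ a
  Σ<-*ˡ (suc n) a f = trans (distribˡ a _ _) (+-congˡ (Σ<-*ˡ n a (f ∘ suc)))

  Σ<-*ʳ : ∀ n a (f : ℕ → Carrier) → Σ< n f * a ≈ Σ< n (λ i → f i * a)
  Σ<-*ʳ zero    a f = zeroˡ a
  Σ<-*ʳ (suc n) a f = trans (distribʳ a _ _) (+-congˡ (Σ<-*ʳ n a (f ∘ suc)))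

  Σ<-split : ∀ m n (f : ℕ → Carrier) → Σ< (m ℕ.+ n) f ≈ Σ< m f + Σ< n (λ i → f (m ℕ.+ i))
  Σ<-split zero    n f = sym (+-identityˡ _)
  Σ<-split (suc m) n f = trans (+-congˡ (Σ<-split m n (λ i → f (suc i)))) (sym (+-assoc _ _ _))

  Σ<-last : ∀ n (f : ℕ → Carrier) → Σ< (suc n) f ≈ Σ< n f + f n
  Σ<-last zero    f = +-comm _ _
  Σ<-last (suc n) f = trans (+-congˡ (Σ<-last n (λ i → f (suc i)))) (sym (+-assoc _ _ _))

  -- The factor x - y stays on the left because it need not be invertible. Taking off the term i = 0
  -- leaves y times the sum of length n.
  geometric : ∀ n x y → (x - y) * Σ< n (λ i → x ^ (n ∸ suc i) * y ^ i) ≈ x ^ n - y ^ n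
  geometric zero    x y = trans (zeroʳ _) (sym (-‿inverseʳ 1#))
  geometric (suc n) x y = begin
    (x - y) * (x ^ n * 1# + Σ< n (λ i → x ^ (n ∸ suc i) * (y * y ^ i)))
      ≈⟨ *-congˡ (+-congˡ (trans (Σ<-cong n (λ i _ → swap _ y _)) (sym (Σ<-*ˡ n y _)))) ⟩
    (x - y) * (x ^ n * 1# + y * Σ< n (λ i → x ^ (n ∸ suc i) * y ^ i))
      ≈⟨ solve 4 (λ x y p s → (x :- y) :* (p :* :1 :+ y :* s) := (x :- y) :* p :+ y :* ((x :- y) :* s)) refl x y _ _ ⟩
    (x - y) * x ^ n + y * ((x - y) * Σ< n (λ i → x ^ (n ∸ suc i) * y ^ i))
      ≈⟨ +-congˡ (*-congˡ (geometric n x y)) ⟩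
    (x - y) * x ^ n + y * (x ^ n - y ^ n)
      ≈⟨ solve 4 (λ x y p q → (x :- y) :* p :+ y :* (p :- q) := x :* p :- y :* q) refl x y (x ^ n) (y ^ n) ⟩
    x * x ^ n - y * y ^ n ∎
    where
    swap : ∀ a b d → a * (b * d) ≈ b * (a * d)
    swap = solve 3 (λ a b d → a :* (b :* d) := b :* (a :* d)) refl

-- The polynomial P in closed form.

module PolynomialP (R : CommutativeRing c ℓ) (r : ℕ) where

  open CommutativeRing R
  open SemiringExp semiring using (_^_; ^-homo-*)
  open import Algebra.Properties.CommutativeSemiring.Exp commutativeSemiring using (^-distrib-*)
  open MonoidMult +-monoid using (×-congʳ) renaming (_×_ to _·_)
  open import Algebra.Properties.Semiring.Mult semiring using (×-comm-*)
  open CMSum +-commutativeMonoid using (sum; sum-syntax)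
  open RangeSum R
  open IntegerSolver R
  open SetoidReasoning setoid

  -- `F` receives the two complementary indices separately, so that the induction can shift one of
  -- them alone.
  Σ<-reverse : ∀ n (F : ℕ → ℕ → Carrier) → Σ< n (λ i → F (n ∸ suc i) i) ≈ Σ< n (λ i → F i (n ∸ suc i))
  Σ<-reverse zero    F = refl
  Σ<-reverse (suc n) F = begin
    F n 0 + Σ< n (λ i → F (n ∸ suc i) (suc i))
      ≈⟨ +-congˡ (Σ<-reverse n (λ i j → F i (suc j))) ⟩
    F n 0 + Σ< n (λ i → F i (suc (n ∸ suc i)))
      ≈⟨ +-cong (reflexive (≡.cong (F n) (≡.sym (ℕ.n∸n≡0 n))))
           (Σ<-cong n λ i i<n → reflexive (≡.cong (F i) (≡.sym (ℕ.+-∸-assoc 1 i<n)))) ⟩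
    F n (n ∸ n) + Σ< n (λ i → F i (n ∸ i))
      ≈⟨ +-comm _ _ ⟩
    Σ< n (λ i → F i (n ∸ i)) + F n (n ∸ n)
      ≈⟨ Σ<-last n (λ i → F i (n ∸ i)) ⟨
    Σ< (suc n) (λ i → F i (n ∸ i)) ∎

  Σ<-binomial : ∀ n T → Σ< (suc n) (λ k → T ^ (n ∸ k) * ((- 1#) ^ (n ∸ k) * ((n C k) · 1#))) ≈ (1# - T) ^ n
  Σ<-binomial n T = begin
    Σ< (suc n) (λ k → T ^ (n ∸ k) * ((- 1#) ^ (n ∸ k) * ((n C k) · 1#)))
      ≈⟨ Σ<-cong (suc n) (λ k _ → term k) ⟩
    Σ< (suc n) (λ k → (n C k) · (1# ^ k * (- T) ^ (n ∸ k)))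
      ≡⟨ sum≡Σ< (suc n) (λ k → (n C k) · (1# ^ k * (- T) ^ (n ∸ k))) ⟨
    Binomial.binomialExpansion commutativeSemiring 1# (- T) n
      ≈⟨ Binomial.theorem commutativeSemiring n 1# (- T) ⟨
    (1# - T) ^ n ∎
    where
    1^ : ∀ k → 1# ^ k ≈ 1#
    1^ zero    = refl
    1^ (suc k) = trans (*-identityˡ _) (1^ k)
    term : ∀ k → T ^ (n ∸ k) * ((- 1#) ^ (n ∸ k) * ((n C k) · 1#)) ≈ (n C k) · (1# ^ k * (- T) ^ (n ∸ k))
    term k = begin
      T ^ (n ∸ k) * ((- 1#) ^ (n ∸ k) * ((n C k) · 1#))
        ≈⟨ *-assoc _ _ _ ⟨
      T ^ (n ∸ k) * (- 1#) ^ (n ∸ k) * ((n C k) · 1#)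
        ≈⟨ *-congʳ (^-distrib-* T (- 1#) (n ∸ k)) ⟨
      (T * - 1#) ^ (n ∸ k) * ((n C k) · 1#)
        ≈⟨ ×-comm-* (n C k) _ 1# ⟩
      (n C k) · ((T * - 1#) ^ (n ∸ k) * 1#)
        ≈⟨ ×-congʳ (n C k) (trans (*-comm _ _) (*-cong (sym (1^ k))
             (^-congˡ (n ∸ k) (solve 1 (λ t → t :* :- :1 := :- t) refl T)))) ⟩
      (n C k) · (1# ^ k * (- T) ^ (n ∸ k)) ∎
      where open SemiringExp semiring using (^-congˡ)

  -- With j = k + a, the factor of w j is the sum over k ≤ j of T^(n-1-k) (-1)^(j-k) C(j,k), which
  -- is T^(n-1-j) (1 - T)^j by the binomial theorem. The induction on n detaches from each inner sum
  -- its last term, the one with k + a = n; together these terms form the part with w n.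
  triangle : ∀ n (w : ℕ → Carrier) T →
    Σ< n (λ k → T ^ (n ∸ suc k) * Σ< (n ∸ k) (λ a → (- 1#) ^ a * (((k ℕ.+ a) C k) · w (k ℕ.+ a)))) ≈
    Σ< n (λ j → w j * (T ^ (n ∸ suc j) * (1# - T) ^ j))
  triangle zero    w T = refl
  triangle (suc n) w T = begin
    Σ< (suc n) (λ k → T ^ (n ∸ k) * Σ< (suc n ∸ k) (g k))
      ≈⟨ Σ<-cong (suc n) (λ { k (s≤s k≤n) → trans (*-congˡ (trans
           (reflexive (≡.cong (λ m → Σ< m (g k)) (ℕ.+-∸-assoc 1 k≤n)))
           (Σ<-last (n ∸ k) (g k)))) (distribˡ (T ^ (n ∸ k)) _ _) }) ⟩
    Σ< (suc n) (λ k → T ^ (n ∸ k) * Σ< (n ∸ k) (g k) + T ^ (n ∸ k) * g k (n ∸ k))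
      ≈⟨ Σ<-+ (suc n) (λ k → T ^ (n ∸ k) * Σ< (n ∸ k) (g k)) (λ k → T ^ (n ∸ k) * g k (n ∸ k)) ⟩
    Σ< (suc n) (λ k → T ^ (n ∸ k) * Σ< (n ∸ k) (g k)) + Σ< (suc n) (λ k → T ^ (n ∸ k) * g k (n ∸ k))
      ≈⟨ +-cong (Σ<-last n (λ k → T ^ (n ∸ k) * Σ< (n ∸ k) (g k))) (Σ<-cong (suc n) λ { k (s≤s k≤n) → top k k≤n }) ⟩
    Σ< n (λ k → T ^ (n ∸ k) * Σ< (n ∸ k) (g k)) + T ^ (n ∸ n) * Σ< (n ∸ n) (g n)
      + Σ< (suc n) (λ k → w n * (T ^ (n ∸ k) * ((- 1#) ^ (n ∸ k) * ((n C k) · 1#))))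
      ≈⟨ +-cong
           (+-cong (Σ<-cong n λ k k<n → trans (*-congʳ (reflexive (≡.cong (T ^_) (ℕ.+-∸-assoc 1 k<n)))) (*-assoc _ _ _))
             (trans (*-congˡ (reflexive (≡.cong (λ m → Σ< m (g n)) (ℕ.n∸n≡0 n)))) (zeroʳ _)))
           (trans (sym (Σ<-*ˡ (suc n) (w n) (λ k → T ^ (n ∸ k) * ((- 1#) ^ (n ∸ k) * ((n C k) · 1#))))) (*-congˡ (Σ<-binomial n T))) ⟩
    Σ< n (λ k → T * (T ^ (n ∸ suc k) * Σ< (n ∸ k) (g k))) + 0# + w n * (1# - T) ^ n
      ≈⟨ +-cong (trans (+-identityʳ _) (trans (sym (Σ<-*ˡ n T _)) (trans (*-congˡ (triangle n w T)) (Σ<-*ˡ n T _))))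
           (trans (*-congˡ (sym (*-identityˡ _))) (*-congˡ (*-congʳ (reflexive (≡.cong (T ^_) (≡.sym (ℕ.n∸n≡0 n))))))) ⟩
    Σ< n (λ j → T * (w j * (T ^ (n ∸ suc j) * (1# - T) ^ j))) + w n * (T ^ (n ∸ n) * (1# - T) ^ n)
      ≈⟨ +-congʳ (Σ<-cong n λ j j<n → trans
           (solve 4 (λ t w p d → t :* (w :* (p :* d)) := w :* ((t :* p) :* d)) refl T (w j) _ _)
           (*-congˡ (*-congʳ (reflexive (≡.cong (T ^_) (≡.sym (ℕ.+-∸-assoc 1 j<n))))))) ⟩
    Σ< n (λ j → w j * (T ^ (n ∸ j) * (1# - T) ^ j)) + w n * (T ^ (n ∸ n) * (1# - T) ^ n)
      ≈⟨ Σ<-last n (λ j → w j * (T ^ (n ∸ j) * (1# - T) ^ j)) ⟨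
    Σ< (suc n) (λ j → w j * (T ^ (n ∸ j) * (1# - T) ^ j)) ∎
    where
    g : ℕ → ℕ → Carrier
    g k a = (- 1#) ^ a * (((k ℕ.+ a) C k) · w (k ℕ.+ a))
    top : ∀ k → k ℕ.≤ n → T ^ (n ∸ k) * g k (n ∸ k) ≈ w n * (T ^ (n ∸ k) * ((- 1#) ^ (n ∸ k) * ((n C k) · 1#)))
    top k k≤n = begin
      T ^ (n ∸ k) * g k (n ∸ k)
        ≡⟨ ≡.cong (λ m → T ^ (n ∸ k) * ((- 1#) ^ (n ∸ k) * ((m C k) · w m))) (ℕ.m+[n∸m]≡n k≤n) ⟩
      T ^ (n ∸ k) * ((- 1#) ^ (n ∸ k) * ((n C k) · w n))
        ≈⟨ *-congˡ (*-congˡ (trans (×-congʳ (n C k) (sym (*-identityʳ _))) (sym (×-comm-* (n C k) (w n) 1#)))) ⟩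
      T ^ (n ∸ k) * ((- 1#) ^ (n ∸ k) * (w n * ((n C k) · 1#)))
        ≈⟨ solve 4 (λ a b d e → a :* (b :* (d :* e)) := d :* (a :* (b :* e))) refl _ _ (w n) _ ⟩
      w n * (T ^ (n ∸ k) * ((- 1#) ^ (n ∸ k) * ((n C k) · 1#))) ∎

  -- With c = 1/(1 + u₁) only nonnegative powers of u₁ occur, so these expressions make sense in the
  -- power series ring as well as in the Laurent ring.
  module Core (u : ℕ → Carrier) (c : Carrier) where

    Q : Carrier → Carrier → Carrier
    Q b T = (T - u 1 * c) * Σ< r (λ k → u (2 ℕ.+ k) * (T ^ (r ∸ suc k) * b ^ k)) + c * u (r ℕ.+ 2) * b ^ r

    core : Carrier → Carrier → Carrier → Carrier
    core s b T = T ^ r * (T - u 1 * c) - s * Q b T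

  module _ (u : ℕ → Carrier) (v c : Carrier) where

    open Core u c

    x₁ : Carrier
    x₁ = u 1 * c

    x : ℕ → Carrier
    x i = (∑[ a < r ℕ.+ 2 ∸ i ] let j = i ℕ.+ toℕ a in
            (- 1#) ^ (j ∸ i) * (((j ∸ 2) C (i ∸ 2)) · (u j - u (r ℕ.+ 2) * v ^ (r ℕ.+ 2 ∸ j))))
        + u (r ℕ.+ 2) * v ^ (r ℕ.+ 2 ∸ i) * c ^ (i ∸ 1)

    P : Carrier → Carrier → Carrier
    P s T = T ^ (r ℕ.+ 1) - (x₁ + s * x 2) * T ^ r
      - s * (∑[ i < r ] ((x (r ℕ.+ 2 ∸ toℕ i) - x₁ * x (r ℕ.+ 1 ∸ toℕ i)) * T ^ toℕ i))

    private
      U : Carrier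
      U = u (r ℕ.+ 2)

      w : ℕ → Carrier
      w j = u (2 ℕ.+ j) - U * v ^ (r ∸ j)

      r+2∸ : ∀ m → r ℕ.+ 2 ∸ (2 ℕ.+ m) ≡ r ∸ m
      r+2∸ m = ≡.cong (_∸ (2 ℕ.+ m)) (ℕ.+-comm r 2)

      -- This is `x (2 + k)` with its truncated differences simplified; the shift by 2 lets the
      -- index start at 0.
      X : ℕ → Carrier
      X k = Σ< (r ∸ k) (λ a → (- 1#) ^ a * (((k ℕ.+ a) C k) · w (k ℕ.+ a))) + U * v ^ (r ∸ k) * c ^ suc k

      x≈X : ∀ k → x (2 ℕ.+ k) ≈ X k
      x≈X k = +-cong (begin
        sum {r ℕ.+ 2 ∸ (2 ℕ.+ k)} (λ a → h (toℕ a)) ≡⟨ sum≡Σ< (r ℕ.+ 2 ∸ (2 ℕ.+ k)) h ⟩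
        Σ< (r ℕ.+ 2 ∸ (2 ℕ.+ k)) h ≡⟨ ≡.cong (λ m → Σ< m h) (r+2∸ k) ⟩
        Σ< (r ∸ k) h ≈⟨ Σ<-cong (r ∸ k) (λ a _ → reflexive (≡.cong₂
            (λ i j → (- 1#) ^ i * (((k ℕ.+ a) C k) · (u (2 ℕ.+ (k ℕ.+ a)) - U * v ^ j)))
            (ℕ.m+n∸m≡n k a) (r+2∸ (k ℕ.+ a)))) ⟩
        Σ< (r ∸ k) (λ a → (- 1#) ^ a * (((k ℕ.+ a) C k) · w (k ℕ.+ a))) ∎)
        (reflexive (≡.cong (λ m → U * v ^ m * c ^ suc k) (r+2∸ k)))
        where
        h : ℕ → Carrier
        h a = (- 1#) ^ (k ℕ.+ a ∸ k) * (((k ℕ.+ a) C k) · (u (2 ℕ.+ (k ℕ.+ a)) - U * v ^ (r ℕ.+ 2 ∸ (2 ℕ.+ (k ℕ.+ a)))))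

    -- With Y the sum of X (r-1-i) T^i, the sums of P combine to X r + (T - x₁) Y. Evaluating Y
    -- leaves two geometric sums with ratios taken from z = v T, b and c, and T - x₁ is a multiple
    -- of both z - c and z - b, so it closes both of them.
    P≈core : u 1 * v ≈ 1# → (1# + u 1) * c ≈ 1# → ∀ s b T → 1# - T ≈ b → P s T ≈ core s b T
    P≈core uv≈1 1+u*c≈1 s b T 1-T≈b = begin
      T ^ (r ℕ.+ 1) - (x₁ + s * x 2) * T ^ r - s * sum {r} (λ i → h (toℕ i))
        ≈⟨ +-cong (+-cong (trans (^-homo-* T r 1) (*-congˡ (*-identityʳ T))) (-‿cong (*-congʳ (+-congˡ (*-congˡ (x≈X 0))))))
             (-‿cong (*-congˡ (trans (reflexive (sum≡Σ< r h)) (trans (Σ<-cong r h≈) (Σ<-+ r _ _))))) ⟩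
      T ^ r * T - (x₁ + s * X 0) * T ^ r - s * (Σ< r (λ i → X (r ∸ i) * T ^ i) + Σ< r (λ i → (- x₁) * (X (r ∸ suc i) * T ^ i)))
        ≈⟨ +-congˡ (-‿cong (*-congˡ (+-congˡ (sym (Σ<-*ˡ r (- x₁) _))))) ⟩
      T ^ r * T - (x₁ + s * X 0) * T ^ r - s * (Σ< r (λ i → X (r ∸ i) * T ^ i) + (- x₁) * Y)
        ≈⟨ solve 7 (λ p t x s a z y →
             p :* t :- (x :+ s :* a) :* p :- s :* (z :+ (:- x) :* y) :=
             p :* (t :- x) :- s :* ((z :+ a :* p) :- x :* y)) refl (T ^ r) T x₁ s (X 0) _ Y ⟩
      T ^ r * (T - x₁) - s * (Σ< r (λ i → X (r ∸ i) * T ^ i) + X 0 * T ^ r - x₁ * Y)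
        ≈⟨ +-congˡ (-‿cong (*-congˡ (+-congʳ shiftY))) ⟩
      T ^ r * (T - x₁) - s * (X r + T * Y - x₁ * Y)
        ≈⟨ +-congˡ (-‿cong (*-congˡ Q≈)) ⟩
      T ^ r * (T - x₁) - s * Q b T ∎
      where
      Y A Gb Gc z : Carrier
      Y = Σ< r (λ i → X (r ∸ suc i) * T ^ i)
      A = Σ< r (λ k → u (2 ℕ.+ k) * (T ^ (r ∸ suc k) * b ^ k))
      z = v * T
      Gb = Σ< r (λ i → z ^ (r ∸ suc i) * b ^ i)
      Gc = Σ< r (λ i → z ^ (r ∸ suc i) * c ^ i)

      h : ℕ → Carrier
      h i = (x (r ℕ.+ 2 ∸ i) - x₁ * x (r ℕ.+ 1 ∸ i)) * T ^ i

      h≈ : ∀ i → i ℕ.< r → h i ≈ X (r ∸ i) * T ^ i + (- x₁) * (X (r ∸ suc i) * T ^ i)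
      h≈ i i<r = begin
        (x (r ℕ.+ 2 ∸ i) - x₁ * x (r ℕ.+ 1 ∸ i)) * T ^ i
          ≡⟨ ≡.cong₂ (λ a b → (x a - x₁ * x b) * T ^ i)
               (≡.trans (≡.cong (_∸ i) (ℕ.+-comm r 2)) (ℕ.+-∸-assoc 2 (ℕ.<⇒≤ i<r)))
               (≡.trans (≡.cong (_∸ i) (ℕ.+-comm r 1)) (≡.trans (ℕ.+-∸-assoc 1 (ℕ.<⇒≤ i<r)) (≡.cong suc (ℕ.+-∸-assoc 1 i<r)))) ⟩
        (x (2 ℕ.+ (r ∸ i)) - x₁ * x (2 ℕ.+ (r ∸ suc i))) * T ^ i
          ≈⟨ *-congʳ (+-cong (x≈X _) (-‿cong (*-congˡ (x≈X _)))) ⟩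
        (X (r ∸ i) - x₁ * X (r ∸ suc i)) * T ^ i
          ≈⟨ solve 4 (λ a x d p → (a :- x :* d) :* p := a :* p :+ (:- x) :* (d :* p)) refl _ x₁ _ _ ⟩
        X (r ∸ i) * T ^ i + (- x₁) * (X (r ∸ suc i) * T ^ i) ∎

      shiftY : Σ< r (λ i → X (r ∸ i) * T ^ i) + X 0 * T ^ r ≈ X r + T * Y
      shiftY = begin
        Σ< r (λ i → X (r ∸ i) * T ^ i) + X 0 * T ^ r
          ≡⟨ ≡.cong (λ m → Σ< r (λ i → X (r ∸ i) * T ^ i) + X m * T ^ r) (ℕ.n∸n≡0 r) ⟨
        Σ< r (λ i → X (r ∸ i) * T ^ i) + X (r ∸ r) * T ^ r
          ≈⟨ Σ<-last r (λ i → X (r ∸ i) * T ^ i) ⟨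
        X r * 1# + Σ< r (λ i → X (r ∸ suc i) * (T * T ^ i))
          ≈⟨ +-cong (*-identityʳ _) (trans
               (Σ<-cong r λ i _ → solve 3 (λ a t p → a :* (t :* p) := t :* (a :* p)) refl _ T _)
               (sym (Σ<-*ˡ r T _))) ⟩
        X r + T * Y ∎

      -- As r - i exceeds r - suc i by one, a single v is left over when the powers of v and T are
      -- paired to powers of z. It serves d = 1# with powers of b, and d = c with powers of c.
      zpow : ∀ d i k → i ℕ.< r → U * v ^ (r ∸ i) * d * T ^ (r ∸ suc i) * k ≈ U * v * d * (z ^ (r ∸ suc i) * k)
      zpow d i k i<r = begin
        U * v ^ (r ∸ i) * d * T ^ (r ∸ suc i) * k
          ≡⟨ ≡.cong (λ m → U * v ^ m * d * T ^ (r ∸ suc i) * k) (ℕ.+-∸-assoc 1 i<r) ⟩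
        U * (v * v ^ (r ∸ suc i)) * d * T ^ (r ∸ suc i) * k
          ≈⟨ solve 6 (λ U v p d q k → U :* (v :* p) :* d :* q :* k := U :* v :* d :* ((p :* q) :* k)) refl U v _ d _ k ⟩
        U * v * d * ((v ^ (r ∸ suc i) * T ^ (r ∸ suc i)) * k)
          ≈⟨ *-congˡ (*-congʳ (^-distrib-* v T (r ∸ suc i))) ⟨
        U * v * d * (z ^ (r ∸ suc i) * k) ∎

      -- After reversal the binomial sums are those of `triangle`. In each w j the part u_{j+2}
      -- contributes to A and the part with U to Gb; the last summand of X contributes Gc.
      Y≈ : Y ≈ A - U * v * 1# * Gb + U * v * c * Gc
      Y≈ = begin
        Y ≈⟨ Σ<-reverse r (λ k i → X k * T ^ i) ⟩
        Σ< r (λ k → X k * T ^ (r ∸ suc k))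
          ≈⟨ Σ<-cong r (λ k k<r → trans (distribʳ _ _ _) (+-cong (*-comm _ _)
               (trans (solve 4 (λ a p d e → a :* (p :* d) :* e := a :* p :* e :* d) refl _ c _ _)
                      (zpow c k (c ^ k) k<r)))) ⟩
        Σ< r (λ k → T ^ (r ∸ suc k) * Σ< (r ∸ k) (λ a → (- 1#) ^ a * (((k ℕ.+ a) C k) · w (k ℕ.+ a)))
                    + U * v * c * (z ^ (r ∸ suc k) * c ^ k))
          ≈⟨ Σ<-+ r _ (λ k → U * v * c * (z ^ (r ∸ suc k) * c ^ k)) ⟩
        _ + Σ< r (λ k → U * v * c * (z ^ (r ∸ suc k) * c ^ k))
          ≈⟨ +-cong (triangle r w T) (sym (Σ<-*ˡ r _ _)) ⟩
        Σ< r (λ j → w j * (T ^ (r ∸ suc j) * (1# - T) ^ j)) + U * v * c * Gc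
          ≈⟨ +-congʳ (Σ<-cong r λ j j<r → begin
               w j * (T ^ (r ∸ suc j) * (1# - T) ^ j)
                 ≈⟨ *-congˡ (*-congˡ (^-congˡ j 1-T≈b)) ⟩
               (u (2 ℕ.+ j) - U * v ^ (r ∸ j)) * (T ^ (r ∸ suc j) * b ^ j)
                 ≈⟨ solve 4 (λ a d e f → (a :- d) :* (e :* f) := a :* (e :* f) :+ :- :1 :* (d :* :1 :* e :* f)) refl _ _ _ _ ⟩
               u (2 ℕ.+ j) * (T ^ (r ∸ suc j) * b ^ j) + - 1# * (U * v ^ (r ∸ j) * 1# * T ^ (r ∸ suc j) * b ^ j)
                 ≈⟨ +-congˡ (*-congˡ (zpow 1# j (b ^ j) j<r)) ⟩
               u (2 ℕ.+ j) * (T ^ (r ∸ suc j) * b ^ j) + - 1# * (U * v * 1# * (z ^ (r ∸ suc j) * b ^ j)) ∎) ⟩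
        Σ< r (λ j → u (2 ℕ.+ j) * (T ^ (r ∸ suc j) * b ^ j) + - 1# * (U * v * 1# * (z ^ (r ∸ suc j) * b ^ j)))
          + U * v * c * Gc
          ≈⟨ +-congʳ (trans (Σ<-+ r _ _) (+-congˡ (trans (sym (Σ<-*ˡ r (- 1#) _)) (*-congˡ (sym (Σ<-*ˡ r _ _)))))) ⟩
        A + - 1# * (U * v * 1# * Gb) + U * v * c * Gc
          ≈⟨ +-congʳ (+-congˡ (solve 1 (λ a → :- :1 :* a := :- a) refl _)) ⟩
        A - U * v * 1# * Gb + U * v * c * Gc ∎
        where open SemiringExp semiring using (^-congˡ)

      Q≈ : X r + T * Y - x₁ * Y ≈ Q b T
      Q≈ = begin
        X r + T * Y - x₁ * Y
          ≈⟨ +-cong (+-cong Xr≈ (*-congˡ Y≈)) (-‿cong (*-congˡ Y≈)) ⟩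
        U * c * c ^ r + T * (A - U * v * 1# * Gb + U * v * c * Gc) - x₁ * (A - U * v * 1# * Gb + U * v * c * Gc)
          ≈⟨ solve 10 (λ U c cr T A v gb gc x u →
               U :* c :* cr :+ T :* (A :- U :* v :* :1 :* gb :+ U :* v :* c :* gc) :- x :* (A :- U :* v :* :1 :* gb :+ U :* v :* c :* gc) :=
               (T :- x) :* A :+ U :* (c :* cr :+ ((T :- x) :* (v :* c :* gc) :- (T :- x) :* (v :* gb)))) refl
               U c (c ^ r) T A v Gb Gc x₁ (u 1) ⟩
        (T - x₁) * A + U * (c * c ^ r + ((T - x₁) * (v * c * Gc) - (T - x₁) * (v * Gb)))
          ≈⟨ +-congˡ (*-congˡ (+-congˡ (+-cong c-part (-‿cong b-part)))) ⟩
        (T - x₁) * A + U * (c * c ^ r + (c * (z ^ r - c ^ r) - c * (z ^ r - b ^ r)))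
          -- The power z^r, the carrier of the negative powers of u₁, cancels between the two
          -- geometric sums, and c^r cancels against X r.
          ≈⟨ +-congˡ (solve 5 (λ U c cr zr br → U :* (c :* cr :+ (c :* (zr :- cr) :- c :* (zr :- br))) := c :* U :* br) refl
               U c (c ^ r) (z ^ r) (b ^ r)) ⟩
        (T - x₁) * A + c * U * b ^ r ∎
        where
        Xr≈ : X r ≈ U * c * c ^ r
        Xr≈ = begin
          X r ≡⟨ ≡.cong (λ m → Σ< m (λ a → (- 1#) ^ a * (((r ℕ.+ a) C r) · w (r ℕ.+ a))) + U * v ^ m * c ^ suc r) (ℕ.n∸n≡0 r) ⟩
          0# + U * 1# * (c * c ^ r)
            ≈⟨ solve 3 (λ U c p → con (ℤ.+ 0) :+ U :* :1 :* (c :* p) := U :* c :* p) refl U c (c ^ r) ⟩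
          U * c * c ^ r ∎
        -- From u₁ v = 1 one gets T - x₁ = u₁ (z - c).
        c-part : (T - x₁) * (v * c * Gc) ≈ c * (z ^ r - c ^ r)
        c-part = begin
          (T - u 1 * c) * (v * c * Gc)
            ≈⟨ *-congʳ (+-congʳ (trans (sym (*-identityˡ T)) (*-congʳ (sym uv≈1)))) ⟩
          (u 1 * v * T - u 1 * c) * (v * c * Gc)
            ≈⟨ solve 5 (λ u v T c g → (u :* v :* T :- u :* c) :* (v :* c :* g) := u :* v :* (c :* ((v :* T :- c) :* g))) refl (u 1) v T c Gc ⟩
          u 1 * v * (c * ((z - c) * Gc))
            ≈⟨ trans (*-congʳ uv≈1) (*-identityˡ _) ⟩
          c * ((z - c) * Gc)
            ≈⟨ *-congˡ (geometric r z c) ⟩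
          c * (z ^ r - c ^ r) ∎
        -- Writing T as (1 + u₁) c T and using 1 - T = b gives T - x₁ = c (T - u₁ b) = c u₁ (z - b).
        b-part : (T - x₁) * (v * Gb) ≈ c * (z ^ r - b ^ r)
        b-part = begin
          (T - u 1 * c) * (v * Gb)
            ≈⟨ *-congʳ (+-congʳ (trans (sym (*-identityˡ T)) (*-congʳ (sym 1+u*c≈1)))) ⟩
          ((1# + u 1) * c * T - u 1 * c) * (v * Gb)
            ≈⟨ *-congʳ (solve 3 (λ u c T → (:1 :+ u) :* c :* T :- u :* c := c :* (:1 :* T :- u :* (:1 :- T))) refl (u 1) c T) ⟩
          c * (1# * T - u 1 * (1# - T)) * (v * Gb)
            ≈⟨ *-congʳ (*-congˡ (+-cong (*-congʳ (sym uv≈1)) (-‿cong (*-congˡ 1-T≈b)))) ⟩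
          c * (u 1 * v * T - u 1 * b) * (v * Gb)
            ≈⟨ solve 6 (λ u v T c b g → c :* (u :* v :* T :- u :* b) :* (v :* g) := u :* v :* (c :* ((v :* T :- b) :* g))) refl (u 1) v T c b Gb ⟩
          u 1 * v * (c * ((z - b) * Gb))
            ≈⟨ trans (*-congʳ uv≈1) (*-identityˡ _) ⟩
          c * ((z - b) * Gb)
            ≈⟨ *-congˡ (geometric r z b) ⟩
          c * (z ^ r - b ^ r) ∎

-- Ring homomorphisms.

module _ (R : CommutativeRing c ℓ₁) (S : CommutativeRing a ℓ₂) where

  private
    module R = CommutativeRing R
    module S = CommutativeRing S

  IsHom : (R.Carrier → S.Carrier) → Set _
  IsHom = IsRingHomomorphism R.rawRing S.rawRing

  mkHom : ∀ {f} → (∀ {x y} → x R.≈ y → f x S.≈ f y) → (∀ x y → f (x R.+ y) S.≈ f x S.+ f y) →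
          (∀ x y → f (x R.* y) S.≈ f x S.* f y) → f R.1# S.≈ S.1# → IsHom f
  mkHom {f} cong +-homo *-homo 1-homo = record
    { isSemiringHomomorphism = record
      { isNearSemiringHomomorphism = record
        { +-isMonoidHomomorphism = record
          { isMagmaHomomorphism = record { isRelHomomorphism = record { cong = cong } ; homo = +-homo }
          ; ε-homo = 0-homo
          }
        ; *-homo = *-homo
        }
      ; 1#-homo = 1-homo
      }
    ; -‿homo = neg-homo
    }
    where
    open RingProperties S.ring using (x+x≈x⇒x≈0; +-inverseʳ-unique)
    0-homo : f R.0# S.≈ S.0#
    0-homo = x+x≈x⇒x≈0 (f R.0#) (S.trans (S.sym (+-homo R.0# R.0#)) (cong (R.+-identityˡ R.0#)))
    neg-homo : ∀ x → f (R.- x) S.≈ S.- f x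
    neg-homo x = +-inverseʳ-unique (f x) (f (R.- x)) (S.trans (S.sym (+-homo x (R.- x)))
      (S.trans (cong (R.-‿inverseʳ x)) 0-homo))

  module Hom {f : R.Carrier → S.Carrier} (isHom : IsHom f) where

    open IsRingHomomorphism isHom public renaming (⟦⟧-cong to f-cong)
    private
      module Rˢ = RangeSum R
      module Sˢ = RangeSum S
      module Rᵉ = SemiringExp R.semiring
      module Sᵉ = SemiringExp S.semiring

    sub-homo : ∀ x y → f (x R.- y) S.≈ f x S.- f y
    sub-homo x y = S.trans (+-homo x (R.- y)) (S.+-congˡ (-‿homo y))

    ^-homo : ∀ x n → f (x Rᵉ.^ n) S.≈ f x Sᵉ.^ n
    ^-homo x zero    = 1#-homo
    ^-homo x (suc n) = S.trans (*-homo x (x Rᵉ.^ n)) (S.*-congˡ (^-homo x n))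

    Σ<-homo : ∀ n g → f (Rˢ.Σ< n g) S.≈ Sˢ.Σ< n (f ∘ g)
    Σ<-homo zero    g = 0#-homo
    Σ<-homo (suc n) g = S.trans (+-homo (g 0) _) (S.+-congˡ (Σ<-homo n (g ∘ suc)))

    -- Applied to `ι`, which moves the telescoping factors into the Laurent ring, and to `ε`, which
    -- yields their constant terms.
    core-homo : ∀ r u c s b T →
      f (PolynomialP.Core.core R r u c s b T) S.≈ PolynomialP.Core.core S r (f ∘ u) (f c) (f s) (f b) (f T)
    core-homo r u c s b T = S.trans (sub-homo _ _) (S.+-cong
      (S.trans (*-homo _ _) (S.*-cong (^-homo T r) T-x₁))
      (S.-‿cong (S.trans (*-homo _ _) (S.*-congˡ (S.trans (+-homo _ _) (S.+-cong
        (S.trans (*-homo _ _) (S.*-cong T-x₁ (S.trans (Σ<-homo r _) (Sˢ.Σ<-cong r λ k _ →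
          S.trans (*-homo _ _) (S.*-congˡ (S.trans (*-homo _ _) (S.*-cong (^-homo T (r ∸ suc k)) (^-homo b k))))))))
        (S.trans (*-homo _ _) (S.*-cong (*-homo _ _) (^-homo b r)))))))))
      where
      T-x₁ : f (T R.- u 1 R.* c) S.≈ f T S.- f (u 1) S.* f c
      T-x₁ = S.trans (sub-homo _ _) (S.+-congˡ (S.-‿cong (*-homo _ _)))

-- Inverses of power series.

module Inverse (R : CommutativeRing c ℓ) where

  open CommutativeRing R
  open Powerseries R using (PS; powerseriesRing; _*ₛ_; 1ₛ)
  open RangeSum R
  open IntegerSolver R
  open SetoidReasoning setoid

  *ₛ-coeff : ∀ f g n → (f *ₛ g) n ≡ Σ< (suc n) (λ i → f i * g (n ∸ i))
  *ₛ-coeff f g n = sum≡Σ< (suc n) (λ i → f i * g (n ∸ i))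

  module _ (f : PS) (a : Carrier) (fa≈1 : f 0 * a ≈ 1#) where

    private
      tail : PS
      tail n = f (suc n)

      -- approx m agrees with 1/f in degrees ≤ m.
      approx : ℕ → PS
      approx m       zero    = a
      approx zero    (suc k) = 0#
      approx (suc m) (suc k) = - (a * (tail *ₛ approx m) k)

      *ₛ-cong≤ : ∀ f {g h} n → (∀ k → k ℕ.≤ n → g k ≈ h k) → (f *ₛ g) n ≈ (f *ₛ h) n
      *ₛ-cong≤ f {g} {h} n p = begin
        (f *ₛ g) n                          ≡⟨ *ₛ-coeff f g n ⟩
        Σ< (suc n) (λ i → f i * g (n ∸ i)) ≈⟨ Σ<-cong (suc n) (λ i _ → *-congˡ {f i} (p (n ∸ i) (ℕ.m∸n≤m n i))) ⟩
        Σ< (suc n) (λ i → f i * h (n ∸ i)) ≡⟨ *ₛ-coeff f h n ⟨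
        (f *ₛ h) n                          ∎

      -- The convolution in degree k reads only degrees up to k, so every fuel of at least k gives
      -- the same coefficient. This justifies the diagonal `approx n n`.
      stable : ∀ m m′ k → k ℕ.≤ m → k ℕ.≤ m′ → approx m k ≈ approx m′ k
      stable m       m′       zero    _         _          = refl
      stable (suc m) (suc m′) (suc k) (s≤s k≤m) (s≤s k≤m′) = -‿cong (*-congˡ (*ₛ-cong≤ tail k λ j j≤k →
        stable m m′ j (ℕ.≤-trans j≤k k≤m) (ℕ.≤-trans j≤k k≤m′)))

    inverse : PS
    inverse n = approx n n

    *-inverse : CommutativeRing._≈_ powerseriesRing (f *ₛ inverse) 1ₛ
    *-inverse zero    = trans (+-identityʳ _) fa≈1
    *-inverse (suc k) = begin
      f 0 * - (a * (tail *ₛ approx k) k) + (tail *ₛ inverse) k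
        ≈⟨ +-congʳ (*-congˡ (-‿cong (*-congˡ (*ₛ-cong≤ tail k λ j j≤k → stable k j j j≤k ℕ.≤-refl)))) ⟩
      f 0 * - (a * (tail *ₛ inverse) k) + (tail *ₛ inverse) k
        ≈⟨ solve 3 (λ f a s → f :* :- (a :* s) :+ s := (:1 :- f :* a) :* s) refl (f 0) a _ ⟩
      (1# - f 0 * a) * (tail *ₛ inverse) k
        ≈⟨ *-congʳ (trans (+-congˡ (-‿cong fa≈1)) (-‿inverseʳ 1#)) ⟩
      0# * (tail *ₛ inverse) k
        ≈⟨ zeroˡ _ ⟩
      0# ∎

-- Multivariate series and their coefficient functions.

-- The coefficients of the product of f with the variable number j + 1. Running off the end gives
-- `0#`, in agreement with `var`, which is zero for such indices.
shift : {A : Set a} → A → ∀ {d} → ℕ → (Vec ℕ d → A) → Vec ℕ d → A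
shift 0# j       f []           = 0#
shift 0# zero    f (zero  ∷ es) = 0#
shift 0# zero    f (suc e ∷ es) = f (e ∷ es)
shift 0# (suc j) f (e ∷ es)     = shift 0# j (f ∘ (e ∷_)) es

module _ (R : CommutativeRing c ℓ) where

  open CommutativeRing R
  open Powerseries R

  const-*ₛ : ∀ a f n → (const a *ₛ f) n ≈ a * f n
  const-*ₛ a f zero    = +-identityʳ _
  const-*ₛ a f (suc n) = trans (+-congˡ (CommutativeRing.zeroˡ powerseriesRing f n)) (+-identityʳ _)

module Multivariate (R : CommutativeRing c ℓ) where

  private
    module R = CommutativeRing R
    module S d = CommutativeRing (Series R d)

  fromCoeffs-cong : ∀ d {f g} → (∀ e → f e R.≈ g e) → S._≈_ d (fromCoeffs R d f) (fromCoeffs R d g)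
  fromCoeffs-cong zero    p   = p []
  fromCoeffs-cong (suc d) p e = fromCoeffs-cong d λ es → p (e ∷ es)

  fromCoeffs-+ : ∀ d f g → S._≈_ d (fromCoeffs R d λ e → f e R.+ g e) (S._+_ d (fromCoeffs R d f) (fromCoeffs R d g))
  fromCoeffs-+ zero    f g   = R.refl
  fromCoeffs-+ (suc d) f g e = fromCoeffs-+ d (f ∘ (e ∷_)) (g ∘ (e ∷_))

  fromCoeffs-0 : ∀ d {f} → (∀ e → f e R.≈ R.0#) → S._≈_ d (fromCoeffs R d f) (S.0# d)
  fromCoeffs-0 zero    p   = p []
  fromCoeffs-0 (suc d) p e = fromCoeffs-0 d λ es → p (e ∷ es)

  fromCoeffs-1 : ∀ d {f} → f (Vec.replicate d 0) R.≈ R.1# → (∀ e → ¬ e ≡ Vec.replicate d 0 → f e R.≈ R.0#) →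
    S._≈_ d (fromCoeffs R d f) (S.1# d)
  fromCoeffs-1 zero    p q         = p
  fromCoeffs-1 (suc d) p q zero    = fromCoeffs-1 d p λ es es≢0 → q (0 ∷ es) λ eq → es≢0 (Vec.∷-injectiveʳ eq)
  fromCoeffs-1 (suc d) p q (suc e) = fromCoeffs-0 d λ es → q (suc e ∷ es) λ ()

  fromCoeffs-scale : ∀ d k f →
    S._≈_ d (S._*_ d (constant R d k) (fromCoeffs R d f)) (fromCoeffs R d λ e → k R.* f e)
  fromCoeffs-scale zero    k f   = R.refl
  fromCoeffs-scale (suc d) k f e = S.trans d (const-*ₛ (Series R d) (constant R d k) (fromCoeffs R (suc d) f) e)
    (fromCoeffs-scale d k (f ∘ (e ∷_)))

  fromCoeffs-Σ : ∀ d n (f : ℕ → Vec ℕ d → R.Carrier) →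
    S._≈_ d (fromCoeffs R d λ e → RangeSum.Σ< R n λ i → f i e) (RangeSum.Σ< (Series R d) n λ i → fromCoeffs R d (f i))
  fromCoeffs-Σ d zero    f = fromCoeffs-0 d λ _ → R.refl
  fromCoeffs-Σ d (suc n) f = S.trans d (fromCoeffs-+ d (f 0) _) (S.+-congˡ d (fromCoeffs-Σ d n (f ∘ suc)))

  var-* : ∀ d j f → S._≈_ d (S._*_ d (var R d (suc j)) (fromCoeffs R d f)) (fromCoeffs R d (shift R.0# j f))
  var-* zero    j       f         = R.zeroˡ (f [])
  var-* (suc d) zero    f zero    = S.trans d (Powerseries.X*-zero (Series R d) (fromCoeffs R (suc d) f)) (S.sym d (fromCoeffs-0 d λ _ → R.refl))
  var-* (suc d) zero    f (suc e) = Powerseries.X*-suc (Series R d) (fromCoeffs R (suc d) f) e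
  var-* (suc d) (suc j) f e       = S.trans d (const-*ₛ (Series R d) (var R d (suc j)) (fromCoeffs R (suc d) f) e)
    (var-* d j (f ∘ (e ∷_)))

  constant-hom : ∀ d → IsHom R (Series R d) (constant R d)
  constant-hom d = mkHom R (Series R d) (cong d) (+-homo d) (*-homo d) (1-homo d)
    where
    cong : ∀ d {x y} → x R.≈ y → S._≈_ d (constant R d x) (constant R d y)
    cong zero    p         = p
    cong (suc d) p zero    = cong d p
    cong (suc d) p (suc e) = S.refl d
    +-homo : ∀ d x y → S._≈_ d (constant R d (x R.+ y)) (S._+_ d (constant R d x) (constant R d y))
    +-homo zero    x y         = R.refl
    +-homo (suc d) x y zero    = +-homo d x y
    +-homo (suc d) x y (suc e) = S.sym d (S.+-identityˡ d _)
    *-homo : ∀ d x y → S._≈_ d (constant R d (x R.* y)) (S._*_ d (constant R d x) (constant R d y))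
    *-homo zero    x y   = R.refl
    *-homo (suc d) x y e = S.trans d (lemma e) (S.sym d (const-*ₛ (Series R d) (constant R d x) (constant R (suc d) y) e))
      where
      lemma : ∀ e → S._≈_ d (constant R (suc d) (x R.* y) e) (S._*_ d (constant R d x) (constant R (suc d) y e))
      lemma zero    = *-homo d x y
      lemma (suc e) = S.sym d (S.zeroʳ d _)
    1-homo : ∀ d → S._≈_ d (constant R d R.1#) (S.1# d)
    1-homo zero            = R.refl
    1-homo (suc d) zero    = 1-homo d
    1-homo (suc d) (suc e) = S.refl d

  constantTerm : ∀ d → S.Carrier d → R.Carrier
  constantTerm zero    f = f
  constantTerm (suc d) f = constantTerm d (f 0)

  constantTerm-cong : ∀ d {f g} → S._≈_ d f g → constantTerm d f R.≈ constantTerm d g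
  constantTerm-cong zero    p = p
  constantTerm-cong (suc d) p = constantTerm-cong d (p 0)

  constantTerm-hom : ∀ d → IsHom (Series R d) R (constantTerm d)
  constantTerm-hom d = mkHom (Series R d) R (constantTerm-cong d) (+-homo d) (*-homo d) (1-homo d)
    where
    +-homo : ∀ d f g → constantTerm d (S._+_ d f g) R.≈ constantTerm d f R.+ constantTerm d g
    +-homo zero    f g = R.refl
    +-homo (suc d) f g = +-homo d (f 0) (g 0)
    *-homo : ∀ d f g → constantTerm d (S._*_ d f g) R.≈ constantTerm d f R.* constantTerm d g
    *-homo zero    f g = R.refl
    *-homo (suc d) f g = R.trans (constantTerm-cong d (S.+-identityʳ d _)) (*-homo d (f 0) (g 0))
    1-homo : ∀ d → constantTerm d (S.1# d) R.≈ R.1#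
    1-homo zero    = R.refl
    1-homo (suc d) = 1-homo d

  constantTerm-constant : ∀ d x → constantTerm d (constant R d x) ≡ x
  constantTerm-constant zero    x = ≡.refl
  constantTerm-constant (suc d) x = constantTerm-constant d x

  constantTerm-var : ∀ d j → constantTerm d (var R d j) R.≈ R.0#
  constantTerm-var d       zero          = Hom.0#-homo (Series R d) R (constantTerm-hom d)
  constantTerm-var zero    (suc j)       = R.refl
  constantTerm-var (suc d) (suc zero)    = Hom.0#-homo (Series R d) R (constantTerm-hom d)
  constantTerm-var (suc d) (suc (suc j)) = constantTerm-var d (suc j)

  -- The coefficient f 0 is a series in one variable fewer with the same constant term, and an
  -- inverse of it is all that `Inverse` asks for.
  invertible : ∀ d f x → constantTerm d f R.* x R.≈ R.1# → Σ[ g ∈ S.Carrier d ] S._≈_ d (S._*_ d f g) (S.1# d)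
  invertible zero    f x p = x , p
  invertible (suc d) f x p with invertible d (f 0) x p
  ... | y , q = Inverse.inverse (Series R d) f y q , Inverse.*-inverse (Series R d) f y q

-- Sums over lists.

module ListSum (R : CommutativeRing c ℓ) where

  open CommutativeRing R
  open RangeSum R

  Σ[] : {A : Set a} → List A → (A → Carrier) → Carrier
  Σ[] xs g = foldr _+_ 0# (List.map g xs)

  Σ[]-cong : {A : Set a} (xs : List A) {g h : A → Carrier} → (∀ x → g x ≈ h x) → Σ[] xs g ≈ Σ[] xs h
  Σ[]-cong []       p = refl
  Σ[]-cong (x ∷ xs) p = +-cong (p x) (Σ[]-cong xs p)

  Σ[]-*ˡ : {A : Set a} (xs : List A) (b : Carrier) (g : A → Carrier) → b * Σ[] xs g ≈ Σ[] xs (λ x → b * g x)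
  Σ[]-*ˡ []       b g = zeroʳ b
  Σ[]-*ˡ (x ∷ xs) b g = trans (distribˡ b _ _) (+-congˡ (Σ[]-*ˡ xs b g))

  Σ[]-map : {A : Set a} {B : Set ℓ₁} (h : A → B) (xs : List A) (g : B → Carrier) → Σ[] (List.map h xs) g ≡ Σ[] xs (g ∘ h)
  Σ[]-map h xs g = ≡.cong (foldr _+_ 0#) (≡.sym (List.map-∘ xs))

  Σ[]-++ : {A : Set a} (xs ys : List A) (g : A → Carrier) → Σ[] (xs List.++ ys) g ≈ Σ[] xs g + Σ[] ys g
  Σ[]-++ []       ys g = sym (+-identityˡ _)
  Σ[]-++ (x ∷ xs) ys g = trans (+-congˡ (Σ[]-++ xs ys g)) (sym (+-assoc _ _ _))

  Σ[]-concatMap : {A : Set a} {B : Set ℓ₁} (h : A → List B) (xs : List A) (g : B → Carrier) →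
    Σ[] (concatMap h xs) g ≈ Σ[] xs (λ x → Σ[] (h x) g)
  Σ[]-concatMap h []       g = refl
  Σ[]-concatMap h (x ∷ xs) g = trans (Σ[]-++ (h x) (concatMap h xs) g) (+-congˡ (Σ[]-concatMap h xs g))

  Σ[]-words : {A : Set a} (l : ℕ) (xs : List A) (g : List A → Carrier) →
    Σ[] (words (suc l) xs) g ≈ Σ[] xs (λ x → Σ[] (words l xs) (g ∘ (x ∷_)))
  Σ[]-words l xs g = trans (Σ[]-concatMap _ xs g)
    (Σ[]-cong xs λ x → reflexive (Σ[]-map (x ∷_) (words l xs) g))

  Σ[]-range : ∀ n (g : ℕ → Carrier) → Σ[] (List.map suc (upTo n)) g ≈ Σ< n (g ∘ suc)
  Σ[]-range n g = trans (reflexive (Σ[]-map suc (upTo n) g)) (go n (λ i → i))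
    where
    go : ∀ n (h : ℕ → ℕ) → Σ[] (applyUpTo h n) (g ∘ suc) ≈ Σ< n (g ∘ suc ∘ h)
    go zero    h = refl
    go (suc n) h = +-congˡ (go n (h ∘ suc))

  -- The Iverson bracket of P times a value. Filtered sums become full sums with brackets, in which
  -- equivalent conditions can be exchanged termwise.
  on : {P : Set a} → Dec P → Carrier → Carrier
  on (yes _) b = b
  on (no  _) b = 0#

  on-cong : {P : Set a} (P? : Dec P) {b d : Carrier} → (P → b ≈ d) → on P? b ≈ on P? d
  on-cong (yes p) q = q p
  on-cong (no  _) q = refl

  on-⇔ : {P : Set a} {Q : Set ℓ₁} (P? : Dec P) (Q? : Dec Q) (b : Carrier) → (P → Q) → (Q → P) → on P? b ≈ on Q? b
  on-⇔ (yes p) (yes q) b f g = refl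
  on-⇔ (yes p) (no ¬q) b f g = ⊥-elim (¬q (f p))
  on-⇔ (no ¬p) (yes q) b f g = ⊥-elim (¬p (g q))
  on-⇔ (no ¬p) (no ¬q) b f g = refl

  on-false : {P : Set a} (P? : Dec P) (b : Carrier) → ¬ P → on P? b ≈ 0#
  on-false (yes p) b ¬p = ⊥-elim (¬p p)
  on-false (no  _) b ¬p = refl

  Σ[]-filter : {A : Set a} {P : A → Set ℓ₁} (P? : ∀ x → Dec (P x)) (xs : List A) (g : A → Carrier) →
    Σ[] (filter P? xs) g ≈ Σ[] xs (λ x → on (P? x) (g x))
  Σ[]-filter P? []       g = refl
  Σ[]-filter P? (x ∷ xs) g with P? x
  ... | yes p = +-congˡ (Σ[]-filter P? xs g)
  ... | no ¬p = trans (Σ[]-filter P? xs g) (sym (+-identityˡ _))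

Positive : MultiIndex → Set
Positive = All (1 ℕ.≤_)

-- The interpolated sums and their recursion.

module Interpolation (R : CommutativeRing c ℓ) (t : CommutativeRing.Carrier R) where

  open CommutativeRing R
  open SemiringExp semiring using (_^_)
  open IntegerSolver R
  open RangeSum R
  open ListSum R
  open SetoidReasoning setoid

  module _ (f : ℕ → ℕ → Carrier) where

    -- z m ks is the sum of ∏ f kᵢ mᵢ over m ≥ m₁ > ⋯ > m_l > 0.
    z : ℕ → MultiIndex → Carrier
    z m       []       = 1#
    z zero    (k ∷ ks) = 0#
    z (suc m) (k ∷ ks) = z m (k ∷ ks) + f k (suc m) * z m ks

    z-Σ : ∀ m k ks → z m (k ∷ ks) ≈ Σ< m (λ i → f k (suc i) * z i ks)
    z-Σ zero    k ks = refl
    z-Σ (suc m) k ks = trans (+-congʳ (z-Σ m k ks)) (sym (Σ<-last m (λ i → f k (suc i) * z i ks)))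

    -- `decreasing n` bounds m₁ strictly and `z m` weakly, whence n ∸ 1. The choice m₁ = suc i
    -- leaves `decreasing (suc i)`, which is `z i` again.
    Σ-decreasing : ∀ n ks →
      Σ[] (decreasing n (length ks)) (λ ms → foldr _*_ 1# (zipWith f ks ms)) ≈ z (n ∸ 1) ks
    Σ-decreasing n []       = +-identityʳ 1#
    Σ-decreasing n (k ∷ ks) = begin
      Σ[] (decreasing n (suc (length ks))) g
        ≈⟨ Σ[]-concatMap _ (List.map suc (upTo (n ∸ 1))) g ⟩
      Σ[] (List.map suc (upTo (n ∸ 1))) (λ m → Σ[] (List.map (m ∷_) (decreasing m (length ks))) g)
        ≈⟨ Σ[]-range (n ∸ 1) _ ⟩
      Σ< (n ∸ 1) (λ i → Σ[] (List.map (suc i ∷_) (decreasing (suc i) (length ks))) g)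
        ≈⟨ Σ<-cong (n ∸ 1) (λ i _ → begin
             Σ[] (List.map (suc i ∷_) (decreasing (suc i) (length ks))) g
               ≡⟨ Σ[]-map (suc i ∷_) (decreasing (suc i) (length ks)) g ⟩
             Σ[] (decreasing (suc i) (length ks)) (λ ms → f k (suc i) * foldr _*_ 1# (zipWith f ks ms))
               ≈⟨ Σ[]-*ˡ (decreasing (suc i) (length ks)) (f k (suc i)) _ ⟨
             f k (suc i) * Σ[] (decreasing (suc i) (length ks)) (λ ms → foldr _*_ 1# (zipWith f ks ms))
               ≈⟨ *-congˡ (Σ-decreasing (suc i) ks) ⟩
             f k (suc i) * z i ks ∎) ⟩
      Σ< (n ∸ 1) (λ i → f k (suc i) * z i ks)
        ≈⟨ z-Σ (n ∸ 1) k ks ⟨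
      z (n ∸ 1) (k ∷ ks) ∎
      where
      g : List ℕ → Carrier
      g ms = foldr _*_ 1# (zipWith f (k ∷ ks) ms)

  private
    boxes : List Box
    boxes = comma ∷ plus ∷ minus1plus ∷ []

  -- The argument k is the current entry, possibly merged already. A comma freezes it and moves it
  -- into g; either merging absorbs the next entry at the cost of one t.
  Σfill : (MultiIndex → Carrier) → ℕ → MultiIndex → Carrier
  Σfill g k []        = g (k ∷ [])
  Σfill g k (k′ ∷ ks) = Σfill (g ∘ (k ∷_)) k′ ks + t * (Σfill g (k ℕ.+ k′) ks + Σfill g (k ∸ 1 ℕ.+ k′) ks)

  Σfillings : (MultiIndex → Carrier) → MultiIndex → Carrier
  Σfillings g []       = g []
  Σfillings g (k ∷ ks) = Σfill g k ks

  -- Makes the truncated exponent of t exact, so that one merging yields precisely one factor t.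
  dep-fill : ∀ k bs ks → dep (fill k (zip bs ks)) ℕ.≤ suc (length ks)
  dep-fill k []                []        = s≤s z≤n
  dep-fill k []                (k′ ∷ ks) = s≤s z≤n
  dep-fill k (b ∷ bs)          []        = s≤s z≤n
  dep-fill k (comma ∷ bs)      (k′ ∷ ks) = s≤s (dep-fill k′ bs ks)
  dep-fill k (plus ∷ bs)       (k′ ∷ ks) = ℕ.m≤n⇒m≤1+n (dep-fill (k ℕ.+ k′) bs ks)
  dep-fill k (minus1plus ∷ bs) (k′ ∷ ks) = ℕ.m≤n⇒m≤1+n (dep-fill (k ∸ 1 ℕ.+ k′) bs ks)

  Σfill-correct : ∀ g k ks →
    Σ[] (words (length ks) boxes) (λ bs → g (fill k (zip bs ks)) * t ^ (suc (length ks) ∸ dep (fill k (zip bs ks)))) ≈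
    Σfill g k ks
  Σfill-correct g k []        = trans (+-identityʳ _) (*-identityʳ _)
  Σfill-correct g k (k′ ∷ ks) = begin
    Σ[] (words (suc (length ks)) boxes) G
      ≈⟨ Σ[]-words (length ks) boxes G ⟩
    Σ[] W (G ∘ (comma ∷_)) + (Σ[] W (G ∘ (plus ∷_)) + (Σ[] W (G ∘ (minus1plus ∷_)) + 0#))
      ≈⟨ +-cong (Σfill-correct (g ∘ (k ∷_)) k′ ks) (+-cong (merge (k ℕ.+ k′)) (+-congʳ (merge (k ∸ 1 ℕ.+ k′)))) ⟩
    Σfill (g ∘ (k ∷_)) k′ ks + (t * Σfill g (k ℕ.+ k′) ks + (t * Σfill g (k ∸ 1 ℕ.+ k′) ks + 0#))
      ≈⟨ solve 4 (λ t a b d → a :+ (t :* b :+ (t :* d :+ con (ℤ.+ 0))) := a :+ t :* (b :+ d)) refl t _ _ _ ⟩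
    Σfill g k (k′ ∷ ks) ∎
    where
    W : List (List Box)
    W = words (length ks) boxes
    G : List Box → Carrier
    G bs = g (fill k (zip bs (k′ ∷ ks))) * t ^ (suc (suc (length ks)) ∸ dep (fill k (zip bs (k′ ∷ ks))))
    merge : ∀ m → Σ[] W (λ bs → g (fill m (zip bs ks)) * t ^ (suc (suc (length ks)) ∸ dep (fill m (zip bs ks)))) ≈ t * Σfill g m ks
    merge m = trans (Σ[]-cong W λ bs → trans
        (*-congˡ (reflexive (≡.cong (t ^_) (ℕ.+-∸-assoc 1 (dep-fill m bs ks)))))
        (solve 3 (λ a t b → a :* (t :* b) := t :* (a :* b)) refl _ t _))
      (trans (sym (Σ[]-*ˡ W t _)) (*-congˡ (Σfill-correct g m ks)))

  Σfillings-correct : ∀ g ks → Σ[] (fillings ks) (λ ps → g ps * t ^ (dep ks ∸ dep ps)) ≈ Σfillings g ks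
  Σfillings-correct g []       = trans (+-identityʳ _) (*-identityʳ _)
  Σfillings-correct g (k ∷ ks) = trans
    (reflexive (Σ[]-map (λ bs → fill k (zip bs ks)) (words (length ks) boxes) _)) (Σfill-correct g k ks)

  Σfill-linear : ∀ a g h k ks → Σfill (λ ps → g ps + a * h ps) k ks ≈ Σfill g k ks + a * Σfill h k ks
  Σfill-linear a g h k []        = refl
  Σfill-linear a g h k (k′ ∷ ks) = trans
    (+-cong (Σfill-linear a (g ∘ (k ∷_)) (h ∘ (k ∷_)) k′ ks)
      (*-congˡ (+-cong (Σfill-linear a g h (k ℕ.+ k′) ks) (Σfill-linear a g h (k ∸ 1 ℕ.+ k′) ks))))
    (solve 8 (λ a t g₁ h₁ g₂ h₂ g₃ h₃ → (g₁ :+ a :* h₁) :+ t :* ((g₂ :+ a :* h₂) :+ (g₃ :+ a :* h₃)) :=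
      (g₁ :+ t :* (g₂ :+ g₃)) :+ a :* (h₁ :+ t :* (h₂ :+ h₃))) refl a t _ _ _ _ _ _)

  module _ (f : ℕ → ℕ → Carrier) (m : ℕ)
    (f-* : ∀ {k k′} → 1 ℕ.≤ k → 1 ℕ.≤ k′ →
      f k (suc m) * f k′ (suc m) ≈ f (k ℕ.+ k′) (suc m) + f (k ∸ 1 ℕ.+ k′) (suc m)) where

    private
      Z Z′ : MultiIndex → Carrier
      Z  = Σfillings (z f m)
      Z′ = Σfillings (z f (suc m))

    -- The comma contributes f k * Z (k′ ∷ ks). The two mergings have the same tail V, and by `f-*`
    -- their increments add up to f k * f k′ * (t * V), where f k′ * V is the increment of Z at k′ ∷
    -- ks by induction. The total is f k times a combination of Z and Z′ with weights 1 - t and t.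
    -- Positivity passes to the merged entries because k ∸ 1 + k′ ≥ k′.
    Σfillings-step : ∀ k ks → 1 ℕ.≤ k → Positive ks →
      Z′ (k ∷ ks) ≈ Z (k ∷ ks) + f k (suc m) * (t * Z′ ks + (1# - t) * Z ks)
    Σfillings-step k [] _ _ = +-congˡ (*-congˡ (solve 1 (λ t → :1 := t :* :1 :+ (:1 :- t) :* :1) refl t))
    Σfillings-step k (k′ ∷ ks) 1≤k (1≤k′ ∷ pos) = begin
      Σfill (λ ps → z f m (k ∷ ps) + f k (suc m) * z f m ps) k′ ks + t * (Z′ (k ℕ.+ k′ ∷ ks) + Z′ (k ∸ 1 ℕ.+ k′ ∷ ks))
        ≈⟨ +-cong (Σfill-linear (f k (suc m)) (z f m ∘ (k ∷_)) (z f m) k′ ks)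
             (*-congˡ (+-cong (Σfillings-step (k ℕ.+ k′) ks (ℕ.≤-trans 1≤k (ℕ.m≤m+n k k′)) pos)
                              (Σfillings-step (k ∸ 1 ℕ.+ k′) ks (ℕ.≤-trans 1≤k′ (ℕ.m≤n+m k′ (k ∸ 1))) pos))) ⟩
      Σfill (z f m ∘ (k ∷_)) k′ ks + fk * Z (k′ ∷ ks)
        + t * ((Z (k ℕ.+ k′ ∷ ks) + f (k ℕ.+ k′) (suc m) * V) + (Z (k ∸ 1 ℕ.+ k′ ∷ ks) + f (k ∸ 1 ℕ.+ k′) (suc m) * V))
        ≈⟨ solve 9 (λ a fk z t z₁ f₁ z₂ f₂ V →
             a :+ fk :* z :+ t :* ((z₁ :+ f₁ :* V) :+ (z₂ :+ f₂ :* V)) :=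
             a :+ t :* (z₁ :+ z₂) :+ (fk :* z :+ (f₁ :+ f₂) :* (t :* V))) refl
             _ fk (Z (k′ ∷ ks)) t _ (f (k ℕ.+ k′) (suc m)) _ (f (k ∸ 1 ℕ.+ k′) (suc m)) V ⟩
      Z (k ∷ k′ ∷ ks) + (fk * Z (k′ ∷ ks) + (f (k ℕ.+ k′) (suc m) + f (k ∸ 1 ℕ.+ k′) (suc m)) * (t * V))
        ≈⟨ +-congˡ (+-congˡ (*-congʳ (f-* 1≤k 1≤k′))) ⟨
      Z (k ∷ k′ ∷ ks) + (fk * Z (k′ ∷ ks) + fk * f k′ (suc m) * (t * V))
        ≈⟨ +-congˡ (solve 5 (λ fk fk′ z t V → fk :* z :+ fk :* fk′ :* (t :* V) :=
             fk :* (t :* (z :+ fk′ :* V) :+ (:1 :- t) :* z)) refl fk (f k′ (suc m)) (Z (k′ ∷ ks)) t V) ⟩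
      Z (k ∷ k′ ∷ ks) + fk * (t * (Z (k′ ∷ ks) + f k′ (suc m) * V) + (1# - t) * Z (k′ ∷ ks))
        ≈⟨ +-congˡ (*-congˡ (+-congʳ (*-congˡ (sym (Σfillings-step k′ ks 1≤k′ pos))))) ⟩
      Z (k ∷ k′ ∷ ks) + fk * (t * Z′ (k′ ∷ ks) + (1# - t) * Z (k′ ∷ ks)) ∎
      where
      fk V : Carrier
      fk = f k (suc m)
      V = t * Z′ ks + (1# - t) * Z ks

  Σfill-cong : ∀ {g h} → (∀ ps → g ps ≈ h ps) → ∀ k ks → Σfill g k ks ≈ Σfill h k ks
  Σfill-cong p k []        = p (k ∷ [])
  Σfill-cong p k (k′ ∷ ks) = +-cong (Σfill-cong (p ∘ (k ∷_)) k′ ks)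
    (*-congˡ (+-cong (Σfill-cong p (k ℕ.+ k′) ks) (Σfill-cong p (k ∸ 1 ℕ.+ k′) ks)))

  Σfill-0 : ∀ f k ks → Σfill (z f 0) k ks ≈ 0#
  Σfill-0 f k ks = go (z f 0) (λ _ _ → refl) k ks
    where
    -- Vanishing on all nonempty multi-indices is inherited by g ∘ (k ∷_), unlike the special form
    -- `z f 0`.
    go : ∀ g → (∀ k ps → g (k ∷ ps) ≈ 0#) → ∀ k ks → Σfill g k ks ≈ 0#
    go g p k []        = p k []
    go g p k (k′ ∷ ks) = trans (+-cong (go (g ∘ (k ∷_)) (λ j ps → p k (j ∷ ps)) k′ ks)
      (*-congˡ (+-cong (go g p (k ℕ.+ k′) ks) (go g p (k ∸ 1 ℕ.+ k′) ks))))
      (solve 1 (λ t → con (ℤ.+ 0) :+ t :* (con (ℤ.+ 0) :+ con (ℤ.+ 0)) := con (ℤ.+ 0)) refl t)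

-- Exponent vectors of the monomials.

inc : ∀ {d} → ℕ → Vec ℕ d → Vec ℕ d
inc j       []       = []
inc zero    (e ∷ es) = suc e ∷ es
inc (suc j) (e ∷ es) = e ∷ inc j es

inc-injective : ∀ {d} j {v w : Vec ℕ d} → inc j v ≡ inc j w → v ≡ w
inc-injective j       {[]}    {[]}    _  = ≡.refl
inc-injective zero    {e ∷ _} {_ ∷ _} p  =
  ≡.cong₂ _∷_ (ℕ.suc-injective (Vec.∷-injectiveˡ p)) (Vec.∷-injectiveʳ p)
inc-injective (suc j) {e ∷ _} {_ ∷ _} p  =
  ≡.cong₂ _∷_ (Vec.∷-injectiveˡ p) (inc-injective j (Vec.∷-injectiveʳ p))

-- `shift` is extension by a default value along the map `inc j`. The case distinction is
-- independent of the function shifted, so it can be made once per exponent.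
shift-cases : ∀ {d} j (e : Vec ℕ d) → j ℕ.< d →
  (∃[ e′ ] (inc j e′ ≡ e × (∀ {A : Set a} (o : A) f → shift o j f e ≡ f e′))) ⊎
  ((∀ e′ → ¬ inc j e′ ≡ e) × (∀ {A : Set a} (o : A) f → shift o j f e ≡ o))
shift-cases zero    (zero ∷ es)  _       = inj₂ ((λ { (_ ∷ _) () }) , λ _ _ → ≡.refl)
shift-cases zero    (suc e ∷ es) _       = inj₁ (e ∷ es , ≡.refl , λ _ _ → ≡.refl)
shift-cases (suc j) (e ∷ es)     (s≤s p) with shift-cases j es p
... | inj₁ (es′ , q , h) = inj₁ (e ∷ es′ , ≡.cong (e ∷_) q , λ o f → h o (f ∘ (e ∷_)))
... | inj₂ (q , h)       = inj₂ ((λ { (_ ∷ es′) eq → q es′ (Vec.∷-injectiveʳ eq) }) , λ o f → h o (f ∘ (e ∷_)))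

-- The effect on (l, h₁, ..., h_r) of prepending a positive entry n: the depth and the i-heights
-- with i < n grow by one.
raiseFirst : ∀ {d} → ℕ → Vec ℕ d → Vec ℕ d
raiseFirst n       []       = []
raiseFirst zero    (s ∷ ss) = s ∷ ss
raiseFirst (suc n) (s ∷ ss) = suc s ∷ raiseFirst n ss

raiseFirst-0 : ∀ {d} (ss : Vec ℕ d) → raiseFirst 0 ss ≡ ss
raiseFirst-0 []       = ≡.refl
raiseFirst-0 (s ∷ ss) = ≡.refl

raiseFirst-⊓ : ∀ d n (ss : Vec ℕ d) → raiseFirst (d ℕ.⊓ n) ss ≡ raiseFirst n ss
raiseFirst-⊓ zero    n       []       = ≡.refl
raiseFirst-⊓ (suc d) zero    (s ∷ ss) = ≡.refl
raiseFirst-⊓ (suc d) (suc n) (s ∷ ss) = ≡.cong (suc s ∷_) (raiseFirst-⊓ d n ss)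

sum-raiseFirst : ∀ {d} n (ss : Vec ℕ d) → n ℕ.≤ d → Vec.sum (raiseFirst n ss) ≡ n ℕ.+ Vec.sum ss
sum-raiseFirst n       []       z≤n     = ≡.refl
sum-raiseFirst zero    (s ∷ ss) _       = ≡.refl
sum-raiseFirst (suc n) (s ∷ ss) (s≤s p) = ≡.cong suc (≡.trans (≡.cong (s ℕ.+_) (sum-raiseFirst n ss p))
  (≡.trans (≡.sym (ℕ.+-assoc s n _)) (≡.trans (≡.cong (ℕ._+ Vec.sum ss) (ℕ.+-comm s n)) (ℕ.+-assoc n s _))))

sum-inc : ∀ {d} j (es : Vec ℕ d) → j ℕ.< d → Vec.sum (inc j es) ≡ suc (Vec.sum es)
sum-inc zero    (e ∷ es) _       = ≡.refl
sum-inc (suc j) (e ∷ es) (s≤s p) = ≡.trans (≡.cong (e ℕ.+_) (sum-inc j es p)) (ℕ.+-suc e _)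

-- Coordinate j occurs exactly in the suffix sums that start at the positions 0, ..., j.
suffixSums-inc : ∀ {d} j (es : Vec ℕ d) → j ℕ.< d → suffixSums (inc j es) ≡ raiseFirst (suc j) (suffixSums es)
suffixSums-inc zero    (e ∷ es) _       = ≡.cong (suc (e ℕ.+ Vec.sum es) ∷_) (≡.sym (raiseFirst-0 _))
suffixSums-inc (suc j) (e ∷ es) (s≤s p) =
  ≡.cong₂ _∷_ (≡.trans (≡.cong (e ℕ.+_) (sum-inc j es p)) (ℕ.+-suc e _)) (suffixSums-inc j es p)

tabulate-raiseFirst : ∀ d n (F G : ℕ → ℕ) → (∀ i → i ℕ.< n → F i ≡ suc (G i)) → (∀ i → n ℕ.≤ i → F i ≡ G i) →
  tabulate {n = d} (F ∘ toℕ) ≡ raiseFirst n (tabulate (G ∘ toℕ))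
tabulate-raiseFirst zero    n       F G p q = ≡.refl
tabulate-raiseFirst (suc d) zero    F G p q = ≡.cong₂ _∷_ (q 0 z≤n)
  (≡.trans (tabulate-raiseFirst d 0 (F ∘ suc) (G ∘ suc) (λ _ ()) (λ i _ → q (suc i) z≤n)) (raiseFirst-0 _))
tabulate-raiseFirst (suc d) (suc n) F G p q = ≡.cong₂ _∷_ (p 0 (s≤s z≤n))
  (tabulate-raiseFirst d n (F ∘ suc) (G ∘ suc) (λ i i<n → p (suc i) (s≤s i<n)) (λ i n≤i → q (suc i) (s≤s n≤i)))

index-injective : ∀ {r} {e e′ : Vec ℕ (suc (suc r))} → index e ≡ index e′ → e ≡ e′
index-injective {e = e} {e′} p = map-+-injective (≡.trans (≡.sym (exponents-index e))
  (≡.trans (≡.cong (λ (k , lh) → exponents k (Vec.head lh) (Vec.tail lh)) p) (exponents-index e′)))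
  where
  map-+-injective : ∀ {d} {v w : Vec ℕ d} → Vec.map (+_) v ≡ Vec.map (+_) w → v ≡ w
  map-+-injective {v = []}    {[]}    _ = ≡.refl
  map-+-injective {v = _ ∷ _} {_ ∷ _} p =
    ≡.cong₂ _∷_ (ℤ.+-injective (Vec.∷-injectiveˡ p)) (map-+-injective (Vec.∷-injectiveʳ p))

weight level : ∀ {r} → Vec ℕ (suc (suc r)) → ℕ
weight e = proj₁ (index e)
level  e = Vec.head (proj₂ (index e))

-- Prepending the entry suc x to a multi-index multiplies its monomial by u_{x+2} if x < r,
-- and by u₁^{x-r} u_{r+2} otherwise.
bump : ∀ {r} → ℕ → Vec ℕ (suc (suc r)) → Vec ℕ (suc (suc r))
bump {r} x (e ∷ es) = x ∸ r ℕ.+ e ∷ inc (r ℕ.⊓ x) es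

⊓<suc : ∀ r x → r ℕ.⊓ x ℕ.< suc r
⊓<suc r x = s≤s (ℕ.m⊓n≤m r x)

-- The weight gains x ∸ r from the exponent of u₁ and 1 + min(r, x) from the suffix sums, together 1
-- + x.
index-bump : ∀ {r} x (e : Vec ℕ (suc (suc r))) → let k , lh = index e in
  index (bump x e) ≡ (suc x ℕ.+ k , raiseFirst (suc x) lh)
index-bump {r} x (e ∷ es) = ≡.cong₂ _,_ weight≡ suffix≡
  where
  open ≡.≡-Reasoning
  suffix≡ : suffixSums (inc (r ℕ.⊓ x) es) ≡ raiseFirst (suc x) (suffixSums es)
  suffix≡ = ≡.trans (suffixSums-inc (r ℕ.⊓ x) es (⊓<suc r x)) (raiseFirst-⊓ (suc r) (suc x) (suffixSums es))
  s : ℕ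
  s = Vec.sum (suffixSums es)
  weight≡ : x ∸ r ℕ.+ e ℕ.+ Vec.sum (suffixSums (inc (r ℕ.⊓ x) es)) ≡ suc x ℕ.+ (e ℕ.+ s)
  weight≡ = begin
    x ∸ r ℕ.+ e ℕ.+ Vec.sum (suffixSums (inc (r ℕ.⊓ x) es))
      ≡⟨ ≡.cong (λ v → x ∸ r ℕ.+ e ℕ.+ Vec.sum v) (suffixSums-inc (r ℕ.⊓ x) es (⊓<suc r x)) ⟩
    x ∸ r ℕ.+ e ℕ.+ Vec.sum (raiseFirst (suc (r ℕ.⊓ x)) (suffixSums es))
      ≡⟨ ≡.cong (x ∸ r ℕ.+ e ℕ.+_) (sum-raiseFirst (suc (r ℕ.⊓ x)) (suffixSums es) (⊓<suc r x)) ⟩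
    x ∸ r ℕ.+ e ℕ.+ (suc (r ℕ.⊓ x) ℕ.+ s)
      ≡⟨ solve 4 (λ a e b s → a :+ e :+ (con 1 :+ b :+ s) := con 1 :+ (b :+ a) :+ (e :+ s)) ≡.refl (x ∸ r) e (r ℕ.⊓ x) s ⟩
    suc (r ℕ.⊓ x ℕ.+ (x ∸ r)) ℕ.+ (e ℕ.+ s)
      ≡⟨ ≡.cong (λ y → suc y ℕ.+ (e ℕ.+ s)) (ℕ.m⊓n+n∸m≡n r x) ⟩
    suc x ℕ.+ (e ℕ.+ s) ∎
    where open ℕSolver.+-*-Solver using (solve; _:+_; _:=_; con)

bump-injective : ∀ {r} x {v w : Vec ℕ (suc (suc r))} → bump x v ≡ bump x w → v ≡ w
bump-injective {r} x {_ ∷ _} {_ ∷ _} p = ≡.cong₂ _∷_ (ℕ.+-cancelˡ-≡ (x ∸ r) _ _ (Vec.∷-injectiveˡ p))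
  (inc-injective (r ℕ.⊓ x) (Vec.∷-injectiveʳ p))

weight-bump : ∀ {r} x (e : Vec ℕ (suc (suc r))) → weight (bump x e) ≡ suc x ℕ.+ weight e
weight-bump x e = ≡.cong proj₁ (index-bump x e)

level-bump : ∀ {r} x (e : Vec ℕ (suc (suc r))) → level (bump x e) ≡ suc (level e)
level-bump x e@(_ ∷ _ ∷ _) = ≡.cong (Vec.head ∘ proj₂) (index-bump x e)

exps : ∀ r → MultiIndex → Vec ℕ (suc (suc r))
exps r []           = Vec.replicate _ 0
exps r (zero  ∷ ks) = exps r ks
exps r (suc x ∷ ks) = bump x (exps r ks)

heights : ∀ r → MultiIndex → Vec ℕ r
heights r ks = tabulate λ i → height (suc (toℕ i)) ks

-- Prepending suc x acts on the exponents by `bump x` and on weight, depth and heights by the same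
-- change of `index`. With `index-injective` this turns membership in `I` into the single equation
-- `exps r ks ≡ e`.
index-exps : ∀ r ks → Positive ks → index (exps r ks) ≡ (wt ks , dep ks ∷ heights r ks)
index-exps r [] _ = ≡.cong₂ _,_ (sum-zeros (suc r)) (suffixSums-zeros r)
  where
  zeros : ∀ d → suffixSums (Vec.replicate d 0) ≡ Vec.replicate d 0
  sum-0 : ∀ d → Vec.sum (Vec.replicate d 0) ≡ 0
  sum-0 zero    = ≡.refl
  sum-0 (suc d) = sum-0 d
  zeros zero    = ≡.refl
  zeros (suc d) = ≡.cong₂ _∷_ (sum-0 d) (zeros d)
  sum-zeros : ∀ d → Vec.sum (suffixSums (Vec.replicate d 0)) ≡ 0
  sum-zeros d = ≡.trans (≡.cong Vec.sum (zeros d)) (sum-0 d)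
  tabulate-zeros : ∀ d → Vec.replicate d 0 ≡ tabulate λ _ → 0
  tabulate-zeros zero    = ≡.refl
  tabulate-zeros (suc d) = ≡.cong (0 ∷_) (tabulate-zeros d)
  suffixSums-zeros : ∀ r → suffixSums (Vec.replicate (suc r) 0) ≡ 0 ∷ heights r []
  suffixSums-zeros r = ≡.cong₂ _∷_ (sum-0 r) (≡.trans (zeros r) (tabulate-zeros r))
index-exps r (suc x ∷ ks) (_ ∷ pos) = ≡.trans (index-bump x (exps r ks))
  (≡.trans (≡.cong (λ (k , lh) → suc x ℕ.+ k , raiseFirst (suc x) lh) (index-exps r ks pos))
  -- Position i of `heights` counts the entries that are at least i + 2, so suc x is counted exactly
  -- when i < x.
  (≡.cong (λ v → suc x ℕ.+ wt ks , suc (dep ks) ∷ v) (≡.sym (tabulate-raiseFirst r x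
    (λ i → height (suc i) (suc x ∷ ks)) (λ i → height (suc i) ks)
    (λ i i<x → ≡.cong length (List.filter-accept (suc (suc i) ℕ.≤?_) {suc x} {ks} (s≤s i<x)))
    (λ i x≤i → ≡.cong length (List.filter-reject (suc (suc i) ℕ.≤?_) {suc x} {ks} (λ { (s≤s i<x) → ℕ.<⇒≱ i<x x≤i })))))))

-- Coefficients of the generating function.

module Coefficients (R : CommutativeRing c ℓ) (r : ℕ) where

  open CommutativeRing R
  open RangeSum R
  open ListSum R
  open SetoidReasoning setoid

  _≟_ : (v w : Vec ℕ (suc (suc r))) → Dec (v ≡ w)
  _≟_ = Vec.≡-dec ℕ._≟_

  -- The bound K on the entries is decoupled from the weight, so that coefficients at different
  -- exponents can be summed over the same words.
  W : ℕ → ℕ → (MultiIndex → Carrier) → Carrier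
  W K zero    g = g []
  W K (suc l) g = Σ< K λ x → W K l (g ∘ (suc x ∷_))

  Σ[]-words≈W : ∀ K l g → Σ[] (words l (List.map suc (upTo K))) g ≈ W K l g
  Σ[]-words≈W K zero    g = +-identityʳ _
  Σ[]-words≈W K (suc l) g = trans (Σ[]-words l (List.map suc (upTo K)) g) (trans (Σ[]-range K _)
    (Σ<-cong K λ x _ → Σ[]-words≈W K l (g ∘ (suc x ∷_))))

  W-cong : ∀ K l {g h} → (∀ ks → dep ks ≡ l → Positive ks → g ks ≈ h ks) → W K l g ≈ W K l h
  W-cong K zero    p = p [] ≡.refl []
  W-cong K (suc l) p = Σ<-cong K λ x _ → W-cong K l λ ks q pos → p (suc x ∷ ks) (≡.cong suc q) (s≤s z≤n ∷ pos)

  W-zero : ∀ K l {g} → (∀ ks → dep ks ≡ l → Positive ks → g ks ≈ 0#) → W K l g ≈ 0#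
  W-zero K zero    p = p [] ≡.refl []
  W-zero K (suc l) p = Σ<-zero K λ x _ → W-zero K l λ ks q pos → p (suc x ∷ ks) (≡.cong suc q) (s≤s z≤n ∷ pos)

  W-*ˡ : ∀ K l a g → a * W K l g ≈ W K l (λ ks → a * g ks)
  W-*ˡ K zero    a g = refl
  W-*ˡ K (suc l) a g = trans (Σ<-*ˡ K a _) (Σ<-cong K λ x _ → W-*ˡ K l a (g ∘ (suc x ∷_)))

  -- A word with an entry above K has weight above K, where g vanishes.
  W-raise : ∀ K N l g → (∀ ks → Positive ks → K ℕ.< wt ks → g ks ≈ 0#) → W (K ℕ.+ N) l g ≈ W K l g
  W-raise K N zero    g p = refl
  W-raise K N (suc l) g p = begin
    Σ< (K ℕ.+ N) (λ x → W (K ℕ.+ N) l (g ∘ (suc x ∷_)))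
      ≈⟨ Σ<-split K N _ ⟩
    Σ< K (λ x → W (K ℕ.+ N) l (g ∘ (suc x ∷_))) + Σ< N (λ i → W (K ℕ.+ N) l (g ∘ (suc (K ℕ.+ i) ∷_)))
      ≈⟨ +-cong
           (Σ<-cong K λ x _ → W-raise K N l (g ∘ (suc x ∷_)) λ ks pos K<wt →
             p (suc x ∷ ks) (s≤s z≤n ∷ pos) (ℕ.≤-trans K<wt (ℕ.m≤n+m (wt ks) (suc x))))
           (Σ<-zero N λ i _ → W-zero (K ℕ.+ N) l λ ks _ pos →
             p (suc (K ℕ.+ i) ∷ ks) (s≤s z≤n ∷ pos) (s≤s (ℕ.≤-trans (ℕ.m≤m+n K i) (ℕ.m≤m+n (K ℕ.+ i) (wt ks))))) ⟩
    Σ< K (λ x → W K l (g ∘ (suc x ∷_))) + 0#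
      ≈⟨ +-identityʳ _ ⟩
    Σ< K (λ x → W K l (g ∘ (suc x ∷_))) ∎

  coeff : (MultiIndex → Carrier) → Vec ℕ (suc (suc r)) → Carrier
  coeff g e = let k , lh = index e in Σ[] (I k (Vec.head lh) (Vec.tail lh)) g

  -- Allowing any K from the weight of e upwards makes it possible to compare e with the smaller
  -- exponent left after removing the first entry.
  coeff≈W : ∀ g e K l → weight e ℕ.≤ K → level e ≡ l → coeff g e ≈ W K l (λ ks → on (exps r ks ≟ e) (g ks))
  coeff≈W g e@(_ ∷ _ ∷ _) K l w≤K ≡.refl with ℕ.m≤n⇒∃[o]m+o≡n w≤K
  ... | N , ≡.refl = begin
    coeff g e
      ≈⟨ Σ[]-filter P? (words l (List.map suc (upTo (weight e)))) g ⟩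
    Σ[] (words l (List.map suc (upTo (weight e)))) (λ ks → on (P? ks) (g ks))
      ≈⟨ Σ[]-words≈W (weight e) l _ ⟩
    W (weight e) l (λ ks → on (P? ks) (g ks))
      ≈⟨ W-cong (weight e) l (λ ks q pos → on-⇔ (P? ks) (exps r ks ≟ e) (g ks)
           (λ { (p₁ , p₂) → index-injective (≡.trans (index-exps r ks pos) (≡.cong₂ _,_ p₁ (≡.cong₂ _∷_ q p₂))) })
           (λ p → let eq = ≡.trans (≡.sym (index-exps r ks pos)) (≡.cong index p)
                  in ≡.cong proj₁ eq , ≡.cong (Vec.tail ∘ proj₂) eq)) ⟩
    W (weight e) l (λ ks → on (exps r ks ≟ e) (g ks))
      ≈⟨ W-raise (weight e) N l _ (λ ks pos w<wt → on-false (exps r ks ≟ e) (g ks) λ p → ℕ.<-irrefl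
           (≡.cong proj₁ (≡.trans (≡.cong index (≡.sym p)) (index-exps r ks pos))) w<wt) ⟨
    W (weight e ℕ.+ N) l (λ ks → on (exps r ks ≟ e) (g ks)) ∎
    where
    P? : ∀ ks → Dec (wt ks ≡ weight e × heights r ks ≡ Vec.tail (proj₂ (index e)))
    P? ks = (wt ks ℕ.≟ weight e) ×-dec Vec.≡-dec ℕ._≟_ (heights r ks) (Vec.tail (proj₂ (index e)))

  coeff-cong : ∀ {g h} → (∀ ks → Positive ks → g ks ≈ h ks) → ∀ e → coeff g e ≈ coeff h e
  coeff-cong {g} {h} p e = trans (coeff≈W g e _ _ ℕ.≤-refl ≡.refl) (trans
    (W-cong (weight e) (level e) λ ks _ pos → on-cong (exps r ks ≟ e) λ _ → p ks pos)
    (sym (coeff≈W h e _ _ ℕ.≤-refl ≡.refl)))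

  coeff-+ : ∀ g h e → coeff (λ ks → g ks + h ks) e ≈ coeff g e + coeff h e
  coeff-+ g h e = go (I (weight e) (level e) (Vec.tail (proj₂ (index e))))
    where
    open IntegerSolver R
    go : ∀ kss → Σ[] kss (λ ks → g ks + h ks) ≈ Σ[] kss g + Σ[] kss h
    go []         = sym (+-identityˡ 0#)
    go (ks ∷ kss) = trans (+-congˡ (go kss))
      (solve 4 (λ a b d e → (a :+ b) :+ (d :+ e) := (a :+ d) :+ (b :+ e)) refl (g ks) (h ks) _ _)

  coeff-*ˡ : ∀ a g e → coeff (λ ks → a * g ks) e ≈ a * coeff g e
  coeff-*ˡ a g e = sym (Σ[]-*ˡ (I (weight e) (level e) (Vec.tail (proj₂ (index e)))) a g)

  module _ (f : ℕ → Carrier) (g V : MultiIndex → Carrier) (g[] : g [] ≈ 0#)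
    (g∷ : ∀ x ks → Positive ks → g (suc x ∷ ks) ≈ f x * V ks) where

    private
      -- The coefficient of the series of V times the monomial of an entry suc x: the exponent of u₁
      -- drops by x ∸ r and one further exponent by 1, with value `0#` if this is impossible.
      unbump : ℕ → Vec ℕ (suc (suc r)) → Carrier
      unbump x (e ∷ es) with x ∸ r ℕ.≤? e
      ... | yes _ = shift 0# (r ℕ.⊓ x) (coeff V ∘ (e ∸ (x ∸ r) ∷_)) es
      ... | no  _ = 0#

      unbump-cases : ∀ x e → (∃[ e′ ] (bump x e′ ≡ e × unbump x e ≡ coeff V e′)) ⊎
        ((∀ e′ → ¬ bump x e′ ≡ e) × unbump x e ≡ 0#)
      unbump-cases x (e ∷ es) with x ∸ r ℕ.≤? e
      ... | no ≰e = inj₂ ((λ { (e′ ∷ _) p → ≰e (ℕ.≤-trans (ℕ.m≤m+n (x ∸ r) e′) (ℕ.≤-reflexive (Vec.∷-injectiveˡ p))) }) , ≡.refl)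
      ... | yes ≤e with shift-cases (r ℕ.⊓ x) es (⊓<suc r x)
      ...   | inj₁ (es′ , p , h) = inj₁ (e ∸ (x ∸ r) ∷ es′ , ≡.cong₂ _∷_ (ℕ.m+[n∸m]≡n ≤e) p , h 0# _)
      ...   | inj₂ (p , h)       = inj₂ ((λ { (_ ∷ es′) q → p es′ (Vec.∷-injectiveʳ q) }) , h 0# _)

      -- Multi-indices are sorted by their first entry suc x. Those with exponent e correspond to
      -- tails with exponent e′ where `bump x e′ ≡ e`, and e′ is unique. At level 0 only the empty
      -- multi-index is left, where g vanishes, and no bumped exponent has level 0.
      coeff≈Σ : ∀ e K → weight e ℕ.≤ K → coeff g e ≈ Σ< K (λ x → f x * unbump x e)
      coeff≈Σ e K w≤K = go (level e) ≡.refl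
        where
        go : ∀ l → level e ≡ l → coeff g e ≈ Σ< K (λ x → f x * unbump x e)
        go zero eq = begin
          coeff g e                  ≈⟨ coeff≈W g e K 0 w≤K eq ⟩
          on (exps r [] ≟ e) (g [])  ≈⟨ on-0 (exps r [] ≟ e) ⟩
          0#                         ≈⟨ Σ<-zero K (λ x _ → trans (*-congˡ (vanish x (unbump-cases x e))) (zeroʳ _)) ⟨
          Σ< K (λ x → f x * unbump x e) ∎
          where
          on-0 : ∀ {p} {P : Set p} (P? : Dec P) → on P? (g []) ≈ 0#
          on-0 (yes _) = g[]
          on-0 (no  _) = refl
          vanish : ∀ x → _ → unbump x e ≈ 0#
          vanish x (inj₂ (_ , p))      = reflexive p
          vanish x (inj₁ (e′ , p , _)) with ≡.trans (≡.sym (level-bump x e′)) (≡.trans (≡.cong level p) eq)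
          ... | ()
        go (suc l) eq = begin
          coeff g e
            ≈⟨ coeff≈W g e K (suc l) w≤K eq ⟩
          Σ< K (λ x → W K l (λ ks → on (exps r (suc x ∷ ks) ≟ e) (g (suc x ∷ ks))))
            ≈⟨ Σ<-cong K (λ x _ → term x (unbump-cases x e)) ⟩
          Σ< K (λ x → f x * unbump x e) ∎
          where
          term : ∀ x → (∃[ e′ ] (bump x e′ ≡ e × unbump x e ≡ coeff V e′)) ⊎ ((∀ e′ → ¬ bump x e′ ≡ e) × unbump x e ≡ 0#) →
            W K l (λ ks → on (exps r (suc x ∷ ks) ≟ e) (g (suc x ∷ ks))) ≈ f x * unbump x e
          term x (inj₂ (p , q)) = trans
            (W-zero K l λ ks _ _ → on-false (exps r (suc x ∷ ks) ≟ e) _ (p (exps r ks)))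
            (sym (trans (*-congˡ (reflexive q)) (zeroʳ _)))
          term x (inj₁ (e′ , p , q)) = begin
            W K l (λ ks → on (exps r (suc x ∷ ks) ≟ e) (g (suc x ∷ ks)))
              ≈⟨ W-cong K l (λ ks _ pos → trans
                   (on-⇔ (exps r (suc x ∷ ks) ≟ e) (exps r ks ≟ e′) _
                     (λ s → bump-injective x (≡.trans s (≡.sym p))) (λ s → ≡.trans (≡.cong (bump x) s) p))
                   (trans (on-cong (exps r ks ≟ e′) λ _ → g∷ x ks pos) (on-* (exps r ks ≟ e′)))) ⟩
            W K l (λ ks → f x * on (exps r ks ≟ e′) (V ks))
              ≈⟨ W-*ˡ K l (f x) _ ⟨
            f x * W K l (λ ks → on (exps r ks ≟ e′) (V ks))
              ≈⟨ *-congˡ (coeff≈W V e′ K l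
                   (ℕ.≤-trans (ℕ.m≤n+m (weight e′) (suc x)) (ℕ.≤-trans (ℕ.≤-reflexive (≡.trans (≡.sym (weight-bump x e′)) (≡.cong weight p))) w≤K))
                   (ℕ.suc-injective (≡.trans (≡.sym (level-bump x e′)) (≡.trans (≡.cong level p) eq)))) ⟨
            f x * coeff V e′
              ≡⟨ ≡.cong (f x *_) q ⟨
            f x * unbump x e ∎
            where
            on-* : ∀ {p} {P : Set p} (P? : Dec P) {b : Carrier} → on P? (f x * b) ≈ f x * on P? b
            on-* (yes _) = refl
            on-* (no  _) = sym (zeroʳ _)

    -- The contribution of the multi-indices whose first entry exceeds r.
    large : Vec ℕ (suc (suc r)) → Carrier
    large (e ∷ es) = Σ< (suc e) λ i → f (r ℕ.+ i) * shift 0# (suc r) (coeff V) (e ∸ i ∷ es)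

    -- The bound r + (suc e + w) is at least the weight w and breaks at the right places: entries
    -- with x < r cost no u₁, those with x = r + i and i ≤ e cost u₁^i, and a larger i exceeds the
    -- available exponent e and contributes nothing.
    coeff-split : ∀ e → coeff g e ≈ Σ< r (λ x → f x * shift 0# (suc x) (coeff V) e) + large e
    coeff-split (e ∷ es) = begin
      coeff g (e ∷ es)
        ≈⟨ coeff≈Σ (e ∷ es) (r ℕ.+ (suc e ℕ.+ w)) (ℕ.≤-trans (ℕ.m≤n+m w (suc e)) (ℕ.m≤n+m (suc e ℕ.+ w) r)) ⟩
      Σ< (r ℕ.+ (suc e ℕ.+ w)) (λ x → f x * unbump x (e ∷ es))
        ≈⟨ trans (Σ<-split r _ _) (+-congˡ (Σ<-split (suc e) w (λ i → f (r ℕ.+ i) * unbump (r ℕ.+ i) (e ∷ es)))) ⟩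
      Σ< r (λ x → f x * unbump x (e ∷ es)) + (Σ< (suc e) (λ i → f (r ℕ.+ i) * unbump (r ℕ.+ i) (e ∷ es))
        + Σ< w (λ i → f (r ℕ.+ (suc e ℕ.+ i)) * unbump (r ℕ.+ (suc e ℕ.+ i)) (e ∷ es)))
        ≈⟨ +-cong (Σ<-cong r λ x x<r → *-congˡ (small x x<r))
             (trans (+-cong (Σ<-cong (suc e) λ { i (s≤s i≤e) → *-congˡ {f (r ℕ.+ i)} (big i i≤e) })
               (Σ<-zero w λ i _ → trans (*-congˡ (huge i)) (zeroʳ _))) (+-identityʳ _)) ⟩
      Σ< r (λ x → f x * shift 0# (suc x) (coeff V) (e ∷ es)) + large (e ∷ es) ∎
      where
      w : ℕ
      w = weight (e ∷ es)
      small : ∀ x → x ℕ.< r → unbump x (e ∷ es) ≈ shift 0# x (coeff V ∘ (e ∷_)) es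
      small x x<r with x ∸ r ℕ.≤? e
      ... | yes _ = reflexive (≡.cong₂ (λ i j → shift 0# i (coeff V ∘ (e ∸ j ∷_)) es)
                      (ℕ.m≥n⇒m⊓n≡n (ℕ.<⇒≤ x<r)) (ℕ.m≤n⇒m∸n≡0 (ℕ.<⇒≤ x<r)))
      ... | no ≰e = ⊥-elim (≰e (ℕ.≤-trans (ℕ.≤-reflexive (ℕ.m≤n⇒m∸n≡0 (ℕ.<⇒≤ x<r))) z≤n))
      big : ∀ i → i ℕ.≤ e → unbump (r ℕ.+ i) (e ∷ es) ≈ shift 0# r (coeff V ∘ (e ∸ i ∷_)) es
      big i i≤e with r ℕ.+ i ∸ r ℕ.≤? e
      ... | yes _ = reflexive (≡.cong₂ (λ k j → shift 0# k (coeff V ∘ (e ∸ j ∷_)) es)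
                      (ℕ.m≤n⇒m⊓n≡m (ℕ.m≤m+n r i)) (ℕ.m+n∸m≡n r i))
      ... | no ≰e = ⊥-elim (≰e (ℕ.≤-trans (ℕ.≤-reflexive (ℕ.m+n∸m≡n r i)) i≤e))
      huge : ∀ i → unbump (r ℕ.+ (suc e ℕ.+ i)) (e ∷ es) ≈ 0#
      huge i with r ℕ.+ (suc e ℕ.+ i) ∸ r ℕ.≤? e
      ... | no _  = refl
      ... | yes ≤e = ⊥-elim (ℕ.<⇒≱ (s≤s (ℕ.m≤m+n e i)) (ℕ.≤-trans (ℕ.≤-reflexive (≡.sym (ℕ.m+n∸m≡n r (suc e ℕ.+ i)))) ≤e))

    -- The term i = 0 stands alone, and the rest is ρ times the same sum with the exponent of u₁
    -- lowered by one. This linear equation takes the place of summing the geometric series.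
    large-step : ∀ ρ → (∀ x → f (suc x) ≈ ρ * f x) → ∀ e →
      large e ≈ f r * shift 0# (suc r) (coeff V) e + ρ * shift 0# 0 large e
    large-step ρ f-suc (zero ∷ es)  = +-cong (*-congʳ (reflexive (≡.cong f (ℕ.+-identityʳ r)))) (sym (zeroʳ ρ))
    large-step ρ f-suc (suc e ∷ es) = +-cong (*-congʳ (reflexive (≡.cong f (ℕ.+-identityʳ r)))) (begin
      Σ< (suc e) (λ i → f (r ℕ.+ suc i) * shift 0# (suc r) (coeff V) (e ∸ i ∷ es))
        ≈⟨ Σ<-cong (suc e) (λ i _ → trans
             (*-congʳ (trans (reflexive (≡.cong f (ℕ.+-suc r i))) (f-suc (r ℕ.+ i)))) (*-assoc ρ (f (r ℕ.+ i)) (shift 0# (suc r) (coeff V) (e ∸ i ∷ es)))) ⟩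
      Σ< (suc e) (λ i → ρ * (f (r ℕ.+ i) * shift 0# (suc r) (coeff V) (e ∸ i ∷ es)))
        ≈⟨ Σ<-*ˡ (suc e) ρ (λ i → f (r ℕ.+ i) * shift 0# (suc r) (coeff V) (e ∸ i ∷ es)) ⟨
      ρ * large (e ∷ es) ∎)

-- Products and telescoping.

module RangeProduct (R : CommutativeRing c ℓ) where

  open CommutativeRing R
  open CMSum *-commutativeMonoid using () renaming (sum to product)
  open IntegerSolver R
  open SetoidReasoning setoid

  Π< : ℕ → (ℕ → Carrier) → Carrier
  Π< zero    f = 1#
  Π< (suc n) f = f 0 * Π< n (f ∘ suc)

  product≡Π< : ∀ n (f : ℕ → Carrier) → product {n} (f ∘ toℕ) ≡ Π< n f
  product≡Π< zero    f = ≡.refl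
  product≡Π< (suc n) f = ≡.cong (_*_ (f 0)) (product≡Π< n (f ∘ suc))

  Π<-cong : ∀ n {f g : ℕ → Carrier} → (∀ i → i ℕ.< n → f i ≈ g i) → Π< n f ≈ Π< n g
  Π<-cong zero    p = refl
  Π<-cong (suc n) p = *-cong (p 0 (s≤s z≤n)) (Π<-cong n λ i i<n → p (suc i) (s≤s i<n))

  -- Stated without division: no Φ i is cancelled, and only the whole product of the f i has to be
  -- inverted afterwards.
  telescope : ∀ n (f g Φ : ℕ → Carrier) → (∀ i → i ℕ.< n → f i * Φ (suc i) ≈ g i * Φ i) →
    Π< n f * Φ n ≈ Π< n g * Φ 0
  telescope zero    f g Φ p = refl
  telescope (suc n) f g Φ p = begin
    f 0 * Π< n (f ∘ suc) * Φ (suc n)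
      ≈⟨ *-assoc _ _ _ ⟩
    f 0 * (Π< n (f ∘ suc) * Φ (suc n))
      ≈⟨ *-congˡ (telescope n (f ∘ suc) (g ∘ suc) (Φ ∘ suc) λ i i<n → p (suc i) (s≤s i<n)) ⟩
    f 0 * (Π< n (g ∘ suc) * Φ 1)
      ≈⟨ solve 3 (λ a b d → a :* (b :* d) := b :* (a :* d)) refl (f 0) _ (Φ 1) ⟩
    Π< n (g ∘ suc) * (f 0 * Φ 1)
      ≈⟨ *-congˡ (p 0 (s≤s z≤n)) ⟩
    Π< n (g ∘ suc) * (g 0 * Φ 0)
      ≈⟨ solve 3 (λ a b d → a :* (b :* d) := b :* a :* d) refl _ (g 0) (Φ 0) ⟩
    g 0 * Π< n (g ∘ suc) * Φ 0 ∎

  Π<-invertible : ∀ n f → (∀ i → i ℕ.< n → ∃[ y ] f i * y ≈ 1#) → ∃[ y ] Π< n f * y ≈ 1#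
  Π<-invertible zero    f p = 1# , *-identityˡ 1#
  Π<-invertible (suc n) f p with p 0 (s≤s z≤n) | Π<-invertible n (f ∘ suc) (λ i i<n → p (suc i) (s≤s i<n))
  ... | y , q | y′ , q′ = y * y′ , trans
    (solve 4 (λ a b d e → a :* b :* (d :* e) := (a :* d) :* (b :* e)) refl (f 0) _ y y′)
    (trans (*-cong q q′) (*-identityˡ 1#))

  quotient : ∀ {a b d y} → a * b ≈ d → a * y ≈ 1# → b ≈ d * y
  quotient {a} {b} {d} {y} p q = begin
    b           ≈⟨ *-identityˡ b ⟨
    1# * b      ≈⟨ *-congʳ q ⟨
    a * y * b   ≈⟨ solve 3 (λ a y b → a :* y :* b := a :* b :* y) refl a y b ⟩
    a * b * y   ≈⟨ *-congʳ p ⟩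
    d * y       ∎

Π<-homo : (R : CommutativeRing c ℓ₁) (S : CommutativeRing a ℓ₂) →
  let module R = CommutativeRing R; module S = CommutativeRing S in
  {h : R.Carrier → S.Carrier} → IsHom R S h →
  ∀ n f → h (RangeProduct.Π< R n f) S.≈ RangeProduct.Π< S n (h ∘ f)
Π<-homo R S isHom zero    f = IsRingHomomorphism.1#-homo isHom
Π<-homo R S isHom (suc n) f = S.trans (IsRingHomomorphism.*-homo isHom (f 0) _) (S.*-congˡ (Π<-homo R S isHom n (f ∘ suc)))
  where module S = CommutativeRing S

-- The step from one generating function to the next.

module Recurrence (R : CommutativeRing c ℓ) (r : ℕ) where

  open CommutativeRing R
  open SemiringExp semiring using (_^_; ^-homo-*)
  open import Algebra.Properties.CommutativeSemiring.Exp commutativeSemiring using (^-distrib-*)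
  open RangeSum R
  open IntegerSolver R
  open PolynomialP R r using (module Core)
  open SetoidReasoning setoid

  ^-inverse : ∀ {x y} → x * y ≈ 1# → ∀ n → x ^ n * y ^ n ≈ 1#
  ^-inverse p zero    = *-identityˡ 1#
  ^-inverse {x} {y} p (suc n) = trans
    (solve 4 (λ x y a b → x :* a :* (y :* b) := x :* y :* (a :* b)) refl x y (x ^ n) (y ^ n))
    (trans (*-cong p (^-inverse p n)) (*-identityˡ 1#))

  core-0 : ∀ {u} → (∀ j → u j ≈ 0#) → ∀ c s b T → Core.core u c s b T ≈ T ^ r * T
  core-0 {u} u≈0 c s b T = begin
    T ^ r * (T - u 1 * c) - s * ((T - u 1 * c) * Σ< r (λ k → u (2 ℕ.+ k) * (T ^ (r ∸ suc k) * b ^ k)) + c * u (r ℕ.+ 2) * b ^ r)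
      ≈⟨ +-cong (*-congˡ (+-congˡ (-‿cong (*-congʳ (u≈0 1))))) (-‿cong (*-congˡ (+-cong
           (*-congˡ (Σ<-zero r λ k _ → trans (*-congʳ (u≈0 (2 ℕ.+ k))) (zeroˡ _))) (*-congʳ (*-congˡ (u≈0 (r ℕ.+ 2))))))) ⟩
    T ^ r * (T - 0# * c) - s * ((T - u 1 * c) * 0# + c * 0# * b ^ r)
      ≈⟨ solve 6 (λ p T c s b a → p :* (T :- con (ℤ.+ 0) :* c) :- s :* (a :* con (ℤ.+ 0) :+ c :* con (ℤ.+ 0) :* b) := p :* T) refl
           (T ^ r) T c s (b ^ r) _ ⟩
    T ^ r * T ∎

  -- The difference of the two sides is T^r S (Φ′ - Φ) - Q V. The entries up to r contribute S A V
  -- to the first product; for the others, S = c (T - b u₁) is a multiple of the factor that solves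
  -- the equation for D.
  core-step : ∀ u {c t b T y Φ Φ′ V D} → (1# + u 1) * c ≈ 1# → 1# - T ≈ b → T * y ≈ 1# →
    V ≈ t * Φ′ + (1# - t) * Φ →
    Φ′ ≈ Φ + (Σ< r (λ x → (b ^ x * y ^ suc x) * (u (2 ℕ.+ x) * V)) + D) →
    D ≈ (b ^ r * y ^ suc r) * (u (2 ℕ.+ r) * V) + b * y * (u 1 * D) →
    Core.core u c t b T * Φ′ ≈ Core.core u c (t - 1#) b T * Φ
  core-step u {c} {t} {b} {T} {y} {Φ} {Φ′} {V} {D} 1+u*c≈1 1-T≈b Ty≈1 V≈ Φ′≈ D≈ = begin
    (T ^ r * S - t * Q) * Φ′
      ≈⟨ solve 5 (λ p t Q Φ Φ′ → (p :- t :* Q) :* Φ′ :=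
           (p :- (t :- :1) :* Q) :* Φ :+ (p :* (Φ′ :- Φ) :- Q :* (t :* Φ′ :+ (:1 :- t) :* Φ))) refl (T ^ r * S) t Q Φ Φ′ ⟩
    (T ^ r * S - (t - 1#) * Q) * Φ + (T ^ r * S * (Φ′ - Φ) - Q * (t * Φ′ + (1# - t) * Φ))
      ≈⟨ +-congˡ (trans (+-cong difference (-‿cong (*-congˡ (sym V≈)))) (-‿inverseʳ _)) ⟩
    (T ^ r * S - (t - 1#) * Q) * Φ + 0#
      ≈⟨ +-identityʳ _ ⟩
    (T ^ r * S - (t - 1#) * Q) * Φ ∎
    where
    S Q A : Carrier
    S = T - u 1 * c
    Q = Core.Q u c b T
    A = Σ< r (λ k → u (2 ℕ.+ k) * (T ^ (r ∸ suc k) * b ^ k))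
    S≈ : S ≈ c * (T - b * u 1)
    S≈ = begin
      T - u 1 * c                          ≈⟨ +-congʳ (*-identityˡ T) ⟨
      1# * T - u 1 * c                     ≈⟨ +-congʳ (*-congʳ 1+u*c≈1) ⟨
      (1# + u 1) * c * T - u 1 * c         ≈⟨ solve 3 (λ u c T → (:1 :+ u) :* c :* T :- u :* c := c :* (T :- (:1 :- T) :* u)) refl (u 1) c T ⟩
      c * (T - (1# - T) * u 1)             ≈⟨ *-congˡ (+-congˡ (-‿cong (*-congʳ 1-T≈b))) ⟩
      c * (T - b * u 1)                    ∎
    term : ∀ x → x ℕ.< r → T ^ r * ((b ^ x * y ^ suc x) * (u (2 ℕ.+ x) * V)) ≈ u (2 ℕ.+ x) * (T ^ (r ∸ suc x) * b ^ x) * V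
    term x x<r = begin
      T ^ r * ((b ^ x * y ^ suc x) * (u (2 ℕ.+ x) * V))
        ≈⟨ *-congʳ (trans (reflexive (≡.cong (T ^_) (≡.sym (ℕ.m∸n+n≡m x<r)))) (^-homo-* T (r ∸ suc x) (suc x))) ⟩
      T ^ (r ∸ suc x) * T ^ suc x * ((b ^ x * y ^ suc x) * (u (2 ℕ.+ x) * V))
        ≈⟨ solve 6 (λ p q b y u V → p :* q :* ((b :* y) :* (u :* V)) := u :* (p :* b) :* V :* (q :* y)) refl
             (T ^ (r ∸ suc x)) (T ^ suc x) (b ^ x) (y ^ suc x) _ V ⟩
      u (2 ℕ.+ x) * (T ^ (r ∸ suc x) * b ^ x) * V * (T ^ suc x * y ^ suc x)
        ≈⟨ trans (*-congˡ (^-inverse Ty≈1 (suc x))) (*-identityʳ _) ⟩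
      u (2 ℕ.+ x) * (T ^ (r ∸ suc x) * b ^ x) * V ∎
    small : T ^ r * Σ< r (λ x → (b ^ x * y ^ suc x) * (u (2 ℕ.+ x) * V)) ≈ A * V
    small = trans (Σ<-*ˡ r (T ^ r) _) (trans (Σ<-cong r term) (sym (Σ<-*ʳ r V _)))
    large : T ^ r * (S * D) ≈ c * u (r ℕ.+ 2) * b ^ r * V
    large = begin
      T ^ r * (S * D)
        ≈⟨ *-congˡ (*-congʳ S≈) ⟩
      T ^ r * (c * (T - b * u 1) * D)
        ≈⟨ solve 6 (λ p c T b u D → p :* (c :* (T :- b :* u) :* D) := p :* c :* (T :* D :- b :* :1 :* (u :* D))) refl
             (T ^ r) c T b (u 1) D ⟩
      T ^ r * c * (T * D - b * 1# * (u 1 * D))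
        -- The inserted 1# becomes T * y, after which both terms with u 1 * D cancel as polynomials.
        ≈⟨ *-congˡ (+-cong (*-congˡ D≈) (-‿cong (*-congʳ (*-congˡ (sym Ty≈1))))) ⟩
      T ^ r * c * (T * ((b ^ r * y ^ suc r) * (u (2 ℕ.+ r) * V) + b * y * (u 1 * D)) - b * (T * y) * (u 1 * D))
        ≈⟨ solve 10 (λ p c T q z v V b y w → p :* c :* (T :* ((q :* z) :* (v :* V) :+ b :* y :* w) :- b :* (T :* y) :* w) :=
             c :* v :* q :* V :* (T :* p :* z)) refl
             (T ^ r) c T (b ^ r) (y ^ suc r) (u (2 ℕ.+ r)) V b y (u 1 * D) ⟩
      c * u (2 ℕ.+ r) * b ^ r * V * (T ^ suc r * y ^ suc r)
        ≈⟨ trans (*-congˡ (^-inverse Ty≈1 (suc r))) (*-identityʳ _) ⟩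
      c * u (2 ℕ.+ r) * b ^ r * V
        ≡⟨ ≡.cong (λ m → c * u m * b ^ r * V) (ℕ.+-comm 2 r) ⟩
      c * u (r ℕ.+ 2) * b ^ r * V ∎
    difference : T ^ r * S * (Φ′ - Φ) ≈ Q * V
    difference = begin
      T ^ r * S * (Φ′ - Φ)
        ≈⟨ *-congˡ (+-congʳ Φ′≈) ⟩
      T ^ r * S * (Φ + (Σ< r (λ x → (b ^ x * y ^ suc x) * (u (2 ℕ.+ x) * V)) + D) - Φ)
        ≈⟨ solve 5 (λ p S Φ a D → p :* S :* (Φ :+ (a :+ D) :- Φ) := S :* (p :* a) :+ p :* (S :* D)) refl (T ^ r) S Φ _ D ⟩
      S * (T ^ r * Σ< r (λ x → (b ^ x * y ^ suc x) * (u (2 ℕ.+ x) * V))) + T ^ r * (S * D)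
        ≈⟨ +-cong (*-congˡ small) large ⟩
      S * (A * V) + c * u (r ℕ.+ 2) * b ^ r * V
        ≈⟨ solve 4 (λ S A V e → S :* (A :* V) :+ e :* V := (S :* A :+ e) :* V) refl S A V _ ⟩
      Q * V ∎

-- What is needed of S = Series A (r + 2). The ring is kept abstract because equality of series
-- would unfold to equality of coefficients, and implicit arguments would not be found.
record SeriesRing (A : CommutativeRing c ℓ₁) (r : ℕ) (S : CommutativeRing a ℓ₂) : Set (c ⊔ ℓ₁ ⊔ a ⊔ ℓ₂) where
  private
    module A = CommutativeRing A
    module S = CommutativeRing S
    E : Set
    E = Vec ℕ (suc (suc r))
  field
    [_]     : A.Carrier → S.Carrier
    []-hom  : IsHom A S [_]
    ε       : S.Carrier → A.Carrier
    ε-hom   : IsHom S A ε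
    ε-[]    : ∀ x → ε [ x ] A.≈ x
    u       : ℕ → S.Carrier
    ε-u     : ∀ j → ε (u j) A.≈ A.0#
    1/[1+u₁]         : S.Carrier
    1/[1+u₁]-inverse : (S.1# S.+ u 1) S.* 1/[1+u₁] S.≈ S.1#
    invertible   : ∀ f x → ε f A.* x A.≈ A.1# → ∃[ g ] f S.* g S.≈ S.1#
    series       : (E → A.Carrier) → S.Carrier
    series-cong  : ∀ {f g} → (∀ e → f e A.≈ g e) → series f S.≈ series g
    series-1     : ∀ {f} → f (Vec.replicate _ 0) A.≈ A.1# → (∀ e → ¬ e ≡ Vec.replicate _ 0 → f e A.≈ A.0#) → series f S.≈ S.1#
    series-+     : ∀ f g → series (λ e → f e A.+ g e) S.≈ series f S.+ series g
    series-Σ     : ∀ n (f : ℕ → E → A.Carrier) → series (λ e → RangeSum.Σ< A n λ i → f i e) S.≈ RangeSum.Σ< S n λ i → series (f i)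
    series-scale : ∀ k f → [ k ] S.* series f S.≈ series λ e → k A.* f e
    u-*          : ∀ j f → u (suc j) S.* series f S.≈ series (shift A.0# j f)

-- Generating functions of the interpolated sums.

module Generating (R : CommutativeRing c ℓ₁) (r : ℕ) (S : CommutativeRing a ℓ₂) (𝓢 : SeriesRing R r S)
  (t : CommutativeRing.Carrier R) (f : ℕ → ℕ → CommutativeRing.Carrier R) where

  private
    module R = CommutativeRing R
    module S = CommutativeRing S
  open SeriesRing 𝓢
  open Interpolation R t
  open Coefficients R r
  open SemiringExp R.semiring using (_^_)
  open SetoidReasoning S.setoid
  private module H = Hom R S []-hom

  Z : ℕ → MultiIndex → R.Carrier
  Z m = Σfillings (z f m)

  Φ : ℕ → S.Carrier
  Φ m = series (coeff (Z m))

  -- No m₁ satisfies 0 ≥ m₁ > 0, so only the empty multi-index contributes.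
  Φ-0 : Φ 0 S.≈ S.1#
  Φ-0 = series-1
    (R.trans (coeff≈W (Z 0) 0̂ (weight 0̂) 0 ℕ.≤-refl (≡.cong (Vec.head ∘ proj₂) (index-exps r [] [])))
      (on-true (exps r [] ≟ 0̂) ≡.refl))
    (λ e e≢0 → R.trans (coeff≈W (Z 0) e _ _ ℕ.≤-refl ≡.refl) (W-zero (weight e) (level e) λ ks _ → zero-at e e≢0 ks))
    where
    open ListSum R
    0̂ : Vec ℕ (suc (suc r))
    0̂ = Vec.replicate _ 0
    on-true : ∀ {p} {P : Set p} (P? : Dec P) → P → on P? R.1# R.≈ R.1#
    on-true (yes _) p = R.refl
    on-true (no ¬p) p = ⊥-elim (¬p p)
    zero-at : ∀ e → ¬ e ≡ 0̂ → ∀ ks → Positive ks → on (exps r ks ≟ e) (Z 0 ks) R.≈ R.0#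
    zero-at e e≢0 []       _ = on-false (exps r [] ≟ e) _ λ p → e≢0 (≡.sym p)
    zero-at e e≢0 (k ∷ ks) _ with exps r (k ∷ ks) ≟ e
    ... | yes _ = Σfill-0 f k ks
    ... | no  _ = R.refl

  -- Here y is 1/T. The form b^x y^(x+1) of f yields both the product rule `f-*` and the ratio b y
  -- of the geometric series.
  Φ-step : ∀ m {b T y} → (∀ x → f (suc x) (suc m) R.≈ b ^ x R.* y ^ suc x) → R.1# R.- T R.≈ b → T R.* y R.≈ R.1# →
    let open PolynomialP.Core S r u 1/[1+u₁] in
    core [ t ] [ b ] [ T ] S.* Φ (suc m) S.≈ core ([ t ] S.- S.1#) [ b ] [ T ] S.* Φ m
  Φ-step m {b} {T} {y} f≈ 1-T≈b Ty≈1 = Recurrence.core-step S r u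
    {y = [ y ]} {V = series (coeff V)} {D = series (large φ Δ V Δ[] Δ∷)}
    1/[1+u₁]-inverse
    (S.trans (S.+-congʳ (S.sym H.1#-homo)) (S.trans (S.sym (H.sub-homo R.1# T)) (H.f-cong 1-T≈b)))
    (S.trans (S.sym (H.*-homo T y)) (S.trans (H.f-cong Ty≈1) H.1#-homo))
    V-series Φ′-series D-series
    where
    φ : ℕ → R.Carrier
    φ x = b ^ x R.* y ^ suc x
    Δ V : MultiIndex → R.Carrier
    Δ ks = Z (suc m) ks R.- Z m ks
    V ks = t R.* Z (suc m) ks R.+ (R.1# R.- t) R.* Z m ks
    -- With k = i + 1 and k′ = j + 1 the right side has the common factor b^(i+j) y^(i+j+1); its
    -- cofactor b y + 1 equals y.
    f-* : ∀ {k k′} → 1 ℕ.≤ k → 1 ℕ.≤ k′ →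
      f k (suc m) R.* f k′ (suc m) R.≈ f (k ℕ.+ k′) (suc m) R.+ f (k ∸ 1 ℕ.+ k′) (suc m)
    f-* {suc i} {suc j} _ _ = R.trans (R.*-cong (f≈ i) (f≈ j)) (R.sym (R.trans
      (R.+-cong (f≈ (i ℕ.+ suc j)) (R.trans (R.reflexive (≡.cong (λ k → f k (suc m)) (ℕ.+-suc i j))) (f≈ (i ℕ.+ j))))
      (R.trans (R.+-cong (R.*-cong (^-homo-* b i (suc j)) (^-homo-* y (suc i) (suc j)))
                         (R.*-cong (^-homo-* b i j) (R.*-congˡ (^-homo-* y i j))))
      (R.trans (solve 6 (λ b y p q p′ q′ →
          (p :* (b :* p′)) :* ((y :* q) :* (y :* q′)) :+ (p :* p′) :* (y :* (q :* q′)) :=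
          ((p :* (y :* q)) :* (p′ :* q′)) :* (b :* y :+ :1)) R.refl b y (b ^ i) (y ^ i) (b ^ j) (y ^ j))
      (R.trans (R.*-congˡ by+1≈y) (solve 5 (λ y p q p′ q′ → ((p :* (y :* q)) :* (p′ :* q′)) :* y :=
          (p :* (y :* q)) :* (p′ :* (y :* q′))) R.refl y (b ^ i) (y ^ i) (b ^ j) (y ^ j)))))))
      where
      open IntegerSolver R
      open SemiringExp R.semiring using (^-homo-*)
      by+1≈y : b R.* y R.+ R.1# R.≈ y
      by+1≈y = R.trans (R.+-cong (R.*-congʳ (R.sym 1-T≈b)) (R.sym Ty≈1))
        (solve 2 (λ T y → (:1 :- T) :* y :+ T :* y := y) R.refl T y)
    Δ[] : Δ [] R.≈ R.0#
    Δ[] = R.-‿inverseʳ R.1#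
    Δ∷ : ∀ x ks → Positive ks → Δ (suc x ∷ ks) R.≈ φ x R.* V ks
    Δ∷ x ks pos = R.trans (R.+-congʳ (Σfillings-step f m f-* (suc x) ks (s≤s z≤n) pos))
      (R.trans (solve 2 (λ a e → a :+ e :- a := e) R.refl _ _) (R.*-congʳ (f≈ x)))
      where open IntegerSolver R
    φ-suc : ∀ x → φ (suc x) R.≈ (b R.* y) R.* φ x
    φ-suc x = solve 4 (λ b y p q → (b :* p) :* (y :* q) := (b :* y) :* (p :* q)) R.refl b y (b ^ x) (y ^ suc x)
      where open IntegerSolver R
    scale-shift : ∀ a j g → series (λ e → a R.* shift R.0# j g e) S.≈ [ a ] S.* (u (suc j) S.* series g)
    scale-shift a j g = S.sym (S.trans (S.*-congˡ (u-* j g)) (series-scale a (shift R.0# j g)))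
    open SemiringExp S.semiring using () renaming (_^_ to _^ₛ_)
    [φ] : ∀ x → [ φ x ] S.≈ [ b ] ^ₛ x S.* [ y ] ^ₛ suc x
    [φ] x = S.trans (H.*-homo (b ^ x) (y ^ suc x)) (S.*-cong (H.^-homo b x) (H.^-homo y (suc x)))
    V-series : series (coeff V) S.≈ [ t ] S.* Φ (suc m) S.+ (S.1# S.- [ t ]) S.* Φ m
    V-series = begin
      series (coeff V)
        ≈⟨ series-cong (λ e → R.trans (coeff-+ _ _ e) (R.+-cong (coeff-*ˡ t (Z (suc m)) e) (coeff-*ˡ _ (Z m) e))) ⟩
      series (λ e → t R.* coeff (Z (suc m)) e R.+ (R.1# R.- t) R.* coeff (Z m) e)
        ≈⟨ series-+ _ _ ⟩
      series (λ e → t R.* coeff (Z (suc m)) e) S.+ series (λ e → (R.1# R.- t) R.* coeff (Z m) e)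
        ≈⟨ S.+-cong (series-scale t _) (series-scale _ _) ⟨
      [ t ] S.* Φ (suc m) S.+ [ R.1# R.- t ] S.* Φ m
        ≈⟨ S.+-congˡ (S.*-congʳ (S.trans (H.sub-homo R.1# t) (S.+-congʳ H.1#-homo))) ⟩
      [ t ] S.* Φ (suc m) S.+ (S.1# S.- [ t ]) S.* Φ m ∎
    Φ′-series : Φ (suc m) S.≈ Φ m S.+ (RangeSum.Σ< S r (λ x → ([ b ] ^ₛ x S.* [ y ] ^ₛ suc x) S.* (u (2 ℕ.+ x) S.* series (coeff V)))
      S.+ series (large φ Δ V Δ[] Δ∷))
    Φ′-series = begin
      Φ (suc m)
        ≈⟨ series-cong (λ e → R.trans (coeff-cong (λ ks _ → solve 2 (λ a b → b := a :+ (b :- a)) R.refl (Z m ks) (Z (suc m) ks)) e)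
             (R.trans (coeff-+ (Z m) Δ e) (R.+-congˡ (coeff-split φ Δ V Δ[] Δ∷ e)))) ⟩
      series (λ e → coeff (Z m) e R.+ (RangeSum.Σ< R r (λ x → φ x R.* shift R.0# (suc x) (coeff V) e) R.+ large φ Δ V Δ[] Δ∷ e))
        ≈⟨ S.trans (series-+ _ _) (S.+-congˡ (series-+ _ _)) ⟩
      Φ m S.+ (series (λ e → RangeSum.Σ< R r (λ x → φ x R.* shift R.0# (suc x) (coeff V) e)) S.+ series (large φ Δ V Δ[] Δ∷))
        ≈⟨ S.+-congˡ (S.+-congʳ (S.trans (series-Σ r _) (RangeSum.Σ<-cong S r λ x _ →
             S.trans (scale-shift (φ x) (suc x) (coeff V)) (S.*-congʳ ([φ] x))))) ⟩
      _ ∎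
      where open IntegerSolver R
    D-series : series (large φ Δ V Δ[] Δ∷) S.≈
      ([ b ] ^ₛ r S.* [ y ] ^ₛ suc r) S.* (u (2 ℕ.+ r) S.* series (coeff V))
      S.+ [ b ] S.* [ y ] S.* (u 1 S.* series (large φ Δ V Δ[] Δ∷))
    D-series = begin
      series (large φ Δ V Δ[] Δ∷)
        ≈⟨ series-cong (large-step φ Δ V Δ[] Δ∷ (b R.* y) φ-suc) ⟩
      series (λ e → φ r R.* shift R.0# (suc r) (coeff V) e R.+ (b R.* y) R.* shift R.0# 0 (large φ Δ V Δ[] Δ∷) e)
        ≈⟨ series-+ _ _ ⟩
      _ S.+ _
        ≈⟨ S.+-cong (S.trans (scale-shift (φ r) (suc r) (coeff V)) (S.*-congʳ ([φ] r)))
             (S.trans (scale-shift (b R.* y) 0 (large φ Δ V Δ[] Δ∷)) (S.*-congʳ (H.*-homo b y))) ⟩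
      _ ∎

-- The sums of the statement in terms of `z`.

module PowerSums (F : CommutativeRing c ℓ₁) (A : CommutativeRing a ℓ₂)
  {h : CommutativeRing.Carrier F → CommutativeRing.Carrier A} (h-hom : IsHom F A h)
  (n : ℕ) (q : CommutativeRing.Carrier F) (y : ℕ → CommutativeRing.Carrier F) (t : CommutativeRing.Carrier A) where

  private
    module F = CommutativeRing F
    module A = CommutativeRing A
  open SemiringExp F.semiring using (_^_; ^-homo-*)
  open SemiringExp A.semiring using () renaming (_^_ to _^ₐ_)
  open ListSum F using () renaming (Σ[] to Σ[]F)
  open ListSum A
  open Interpolation A t
  open Hom F A h-hom

  factor : ℕ → ℕ → F.Carrier
  factor k m = q ^ ((k ∸ 1) ℕ.* m) F.* y m ^ k

  -- This and the next two definitions repeat those of the statement over general rings; for a field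
  -- and its polynomial ring they agree with them by computation.
  z̄-term : MultiIndex → List ℕ → F.Carrier
  z̄-term ks ms = q ^ ℕ.sum (zipWith (λ k m → (k ∸ 1) ℕ.* m) ks ms)
    F.* foldr F._*_ F.1# (zipWith (λ k m → y m ^ k) ks ms)

  z̄ : MultiIndex → F.Carrier
  z̄ ks = Σ[]F (decreasing n (dep ks)) (z̄-term ks)

  z̄ᵗ : MultiIndex → A.Carrier
  z̄ᵗ ks = Σ[] (fillings ks) λ ps → h (z̄ ps) A.* t ^ₐ (dep ks ∸ dep ps)

  z̄-term-product : ∀ ks ms → h (z̄-term ks ms) A.≈ foldr A._*_ A.1# (zipWith (λ k m → h (factor k m)) ks ms)
  z̄-term-product []       []       = A.trans (f-cong (F.*-identityˡ F.1#)) 1#-homo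
  z̄-term-product []       (m ∷ ms) = A.trans (f-cong (F.*-identityˡ F.1#)) 1#-homo
  z̄-term-product (k ∷ ks) []       = A.trans (f-cong (F.*-identityˡ F.1#)) 1#-homo
  z̄-term-product (k ∷ ks) (m ∷ ms) = A.trans (f-cong (F.trans
    (F.*-congʳ (^-homo-* q ((k ∸ 1) ℕ.* m) (ℕ.sum (zipWith (λ k m → (k ∸ 1) ℕ.* m) ks ms))))
    (solve 4 (λ a b e g → a :* b :* (e :* g) := a :* e :* (b :* g)) F.refl _ _ _ _)))
    (A.trans (*-homo (factor k m) (z̄-term ks ms)) (A.*-congˡ (z̄-term-product ks ms)))
    where open IntegerSolver F

  h-Σ[] : {B : Set} (xs : List B) (g : B → F.Carrier) → h (Σ[]F xs g) A.≈ Σ[] xs (h ∘ g)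
  h-Σ[] []       g = 0#-homo
  h-Σ[] (x ∷ xs) g = A.trans (+-homo (g x) _) (A.+-congˡ (h-Σ[] xs g))

  h-z̄ : ∀ ks → h (z̄ ks) A.≈ z (λ k m → h (factor k m)) (n ∸ 1) ks
  h-z̄ ks = A.trans (h-Σ[] (decreasing n (dep ks)) (z̄-term ks)) (A.trans
    (Σ[]-cong (decreasing n (dep ks)) (z̄-term-product ks)) (Σ-decreasing _ n ks))

  z̄ᵗ≈ : ∀ ks → z̄ᵗ ks A.≈ Σfillings (z (λ k m → h (factor k m)) (n ∸ 1)) ks
  z̄ᵗ≈ ks = A.trans (Σfillings-correct (h ∘ z̄) ks) (fillings-cong ks)
    where
    fillings-cong : ∀ ks → Σfillings (h ∘ z̄) ks A.≈ Σfillings (z (λ k m → h (factor k m)) (n ∸ 1)) ks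
    fillings-cong []       = h-z̄ []
    fillings-cong (k ∷ ks) = Σfill-cong h-z̄ k ks

  h-1-q^ : ∀ m → A.1# A.- h (F.1# F.- q ^ m) A.≈ h (q ^ m)
  h-1-q^ m = A.trans (A.+-congʳ (A.sym 1#-homo)) (A.trans (A.sym (sub-homo F.1# (F.1# F.- q ^ m)))
    (f-cong (solve 1 (λ a → :1 :- (:1 :- a) := a) F.refl (q ^ m))))
    where open IntegerSolver F

  h-factor : ∀ k m → h (factor (suc k) m) A.≈ h (q ^ m) ^ₐ k A.* h (y m) ^ₐ suc k
  h-factor k m = A.trans (*-homo _ _) (A.*-cong
    (A.trans (f-cong (F.trans (F.reflexive (≡.cong (q ^_) (ℕ.*-comm k m))) (F.sym (^-assocʳ q m k)))) (^-homo (q ^ m) k))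
    (^-homo (y m) (suc k)))
    where open SemiringExp F.semiring using (^-assocʳ)

  h-inverse : ∀ m → (F.1# F.- q ^ m) F.* y m F.≈ F.1# → h (F.1# F.- q ^ m) A.* h (y m) A.≈ A.1#
  h-inverse m p = A.trans (A.sym (*-homo _ _)) (A.trans (f-cong p) 1#-homo)

-- The tower of rings and the quotient formula.

IsInverse : (R : CommutativeRing c ℓ) (x y : CommutativeRing.Carrier R) → Set ℓ
IsInverse R x y = x * y ≈ 1#
  where open CommutativeRing R

Inverts-1-q^ : (F : CommutativeRing c ℓ) (n : ℕ) (q : CommutativeRing.Carrier F) (y : ℕ → CommutativeRing.Carrier F) → Set ℓ
Inverts-1-q^ F n q y = ∀ m → 1 ℕ.≤ m → m ℕ.< n → IsInverse F (1# - q ^ m) (y m)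
  where
  open CommutativeRing F
  open SemiringExp semiring using (_^_)

-- F ⊂ A = F[t] ⊂ S = A[[u₁,…,u_{r+2}]] ⊂ L, where u₁ is invertible in L.
module Tower (F : CommutativeRing c ℓ₁) (A : CommutativeRing a ℓ₂) (S : CommutativeRing ℓ ℓ₃) (L : CommutativeRing ℓ₄ ℓ₅)
  (r : ℕ) {h : CommutativeRing.Carrier F → CommutativeRing.Carrier A} (h-hom : IsHom F A h) (𝓢 : SeriesRing A r S)
  {ι : CommutativeRing.Carrier S → CommutativeRing.Carrier L} (ι-hom : IsHom S L ι)
  {v : CommutativeRing.Carrier L} (ιu₁*v≈1 : IsInverse L (ι (SeriesRing.u 𝓢 1)) v)
  (n : ℕ) (q : CommutativeRing.Carrier F) (y : ℕ → CommutativeRing.Carrier F) (y-inverse : Inverts-1-q^ F n q y)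
  (t : CommutativeRing.Carrier A) where

  private
    module F = CommutativeRing F
    module A = CommutativeRing A
    module S = CommutativeRing S
    module L = CommutativeRing L
  open SeriesRing 𝓢
  open SemiringExp F.semiring using (_^_)
  open PowerSums F A h-hom n q y t
  open Generating A r S 𝓢 t (λ k m → h (factor k m))
  open Coefficients A r using (coeff; coeff-cong)
  open PolynomialP.Core S r u 1/[1+u₁] using (core)
  open RangeProduct S using (Π<; telescope; Π<-invertible; quotient)
  open import Algebra.Definitions L._≈_ using (Invertible)
  open CMSum L.*-commutativeMonoid using () renaming (sum to product)
  private
    module ιH = Hom S L ι-hom
    module H = Hom A S []-hom

  b T : ℕ → A.Carrier
  b m = h (q ^ m)
  T m = h (F.1# F.- q ^ m)

  P : L.Carrier → L.Carrier → L.Carrier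
  P = PolynomialP.P L r (ι ∘ u) v (ι 1/[1+u₁])

  ∏P : L.Carrier → L.Carrier
  ∏P s = product {n ∸ 1} λ i → P s (ι [ T (suc (toℕ i)) ])

  Ψ : S.Carrier
  Ψ = series (coeff z̄ᵗ)

  cores : S.Carrier → ℕ → S.Carrier
  cores s i = core s [ b (suc i) ] [ T (suc i) ]

  T-inverse : ∀ i → i ℕ.< n ∸ 1 → T (suc i) A.* h (y (suc i)) A.≈ A.1#
  T-inverse i i<n∸1 = h-inverse (suc i) (y-inverse (suc i) (s≤s z≤n) (1+i<n n i<n∸1))
    where
    1+i<n : ∀ n → i ℕ.< n ∸ 1 → suc i ℕ.< n
    1+i<n (suc n) p = s≤s p

  -- Telescoping from Φ 0 = 1 up to Φ (n ∸ 1), which is Ψ; the index i stands for m = i + 1.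
  Π-cores : Π< (n ∸ 1) (cores [ t ]) S.* Ψ S.≈ Π< (n ∸ 1) (cores ([ t ] S.- S.1#))
  Π-cores = S.trans (S.*-congˡ (series-cong (coeff-cong λ ks _ → z̄ᵗ≈ ks)))
    (S.trans (telescope (n ∸ 1) (cores [ t ]) (cores ([ t ] S.- S.1#)) Φ λ i i<n∸1 →
      Φ-step i (λ k → h-factor k (suc i)) (h-1-q^ (suc i)) (T-inverse i i<n∸1))
    (S.trans (S.*-congˡ Φ-0) (S.*-identityʳ _)))

  -- `ε` kills every u j and leaves T^(r+1), whose inverse is the same power of y′.
  core-invertible : ∀ i → i ℕ.< n ∸ 1 → ∃[ x ] cores [ t ] i S.* x S.≈ S.1#
  core-invertible i i<n∸1 = invertible (cores [ t ] i) (y′ ^ₐ suc r) (A.trans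
    (A.*-congʳ (A.trans (Hom.core-homo S A ε-hom r u 1/[1+u₁] [ t ] [ b (suc i) ] [ T (suc i) ]) (A.trans
      (Recurrence.core-0 A r ε-u _ _ _ _) (A.*-cong (^-congˡ r (ε-[] (T (suc i)))) (ε-[] (T (suc i)))))))
    (A.trans (A.*-congʳ (A.*-comm _ _)) (Recurrence.^-inverse A r (T-inverse i i<n∸1) (suc r))))
    where
    open SemiringExp A.semiring using (^-congˡ) renaming (_^_ to _^ₐ_)
    y′ : A.Carrier
    y′ = h (y (suc i))

  P≈core : ∀ s i → P (ι s) (ι [ T (suc i) ]) L.≈ ι (cores s i)
  P≈core s i = L.trans
    (PolynomialP.P≈core L r (ι ∘ u) v (ι 1/[1+u₁]) ιu₁*v≈1
      (L.trans (L.*-congʳ (L.trans (L.+-congʳ (L.sym ιH.1#-homo)) (L.sym (ιH.+-homo S.1# (u 1)))))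
        (L.trans (L.sym (ιH.*-homo _ _)) (L.trans (ιH.f-cong 1/[1+u₁]-inverse) ιH.1#-homo)))
      (ι s) (ι [ b (suc i) ]) (ι [ T (suc i) ])
      (L.trans (L.+-congʳ (L.sym ιH.1#-homo)) (L.trans (L.sym (ιH.sub-homo _ _)) (ιH.f-cong
        (S.trans (S.+-congʳ (S.sym H.1#-homo)) (S.trans (S.sym (H.sub-homo _ _)) (H.f-cong (h-1-q^ (suc i)))))))))
    (L.sym (ιH.core-homo r u 1/[1+u₁] s [ b (suc i) ] [ T (suc i) ]))

  -- The parameter s′ is kept apart from ι s because the statement forms t - 1 in L, whereas the
  -- telescoping forms it in S.
  ∏P≈ : ∀ {s′} s → s′ L.≈ ι s → ∏P s′ L.≈ ι (Π< (n ∸ 1) (cores s))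
  ∏P≈ {s′} s s≈ = L.trans (L.reflexive (RangeProduct.product≡Π< L (n ∸ 1) λ i → P s′ (ι [ T (suc i) ])))
    (L.trans (RangeProduct.Π<-cong L (n ∸ 1) λ i _ → L.trans (P-cong (ι [ T (suc i) ])) (P≈core s i))
      (L.sym (Π<-homo S L ι-hom (n ∸ 1) (cores s))))
    where
    P-cong : ∀ T → P s′ T L.≈ P (ι s) T
    P-cong T = L.+-cong (L.+-congˡ (L.-‿cong (L.*-congʳ (L.+-congˡ (L.*-congʳ s≈))))) (L.-‿cong (L.*-congʳ s≈))

  -- The quotient is formed in S and then mapped by `ι`, so the inverse of the denominator is itself
  -- a power series.
  generating-function : Σ[ denominator ∈ Invertible L.1# L._*_ (∏P (ι [ t ])) ]
    (ι Ψ L.≈ ∏P (ι [ t ] L.- L.1#) L.* proj₁ denominator)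
  generating-function = (ι x , L.trans (L.*-comm (ι x) (∏P (ι [ t ]))) ∏P*x≈1 , ∏P*x≈1) ,
    L.trans (ιH.f-cong (quotient Π-cores core*x≈1)) (L.trans (ιH.*-homo _ x)
      (L.*-congʳ (L.sym (∏P≈ ([ t ] S.- S.1#) (L.trans (L.+-congˡ (L.-‿cong (L.sym ιH.1#-homo))) (L.sym (ιH.sub-homo [ t ] S.1#)))))))
    where
    x : S.Carrier
    x = proj₁ (Π<-invertible (n ∸ 1) (cores [ t ]) core-invertible)
    core*x≈1 : Π< (n ∸ 1) (cores [ t ]) S.* x S.≈ S.1#
    core*x≈1 = proj₂ (Π<-invertible (n ∸ 1) (cores [ t ]) core-invertible)
    ∏P*x≈1 : ∏P (ι [ t ]) L.* ι x L.≈ L.1#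
    ∏P*x≈1 = L.trans (L.*-congʳ (∏P≈ [ t ] L.refl))
      (L.trans (L.sym (ιH.*-homo _ x)) (L.trans (ιH.f-cong core*x≈1) ιH.1#-homo))

-- Instantiation at polynomial, power series and Laurent rings.

Poly-const-hom : (F : CommutativeRing c ℓ) → IsHom F (Polynomial.polynomialRing F) (Polynomial.const F)
Poly-const-hom F = mkHom F (Polynomial.polynomialRing F) (λ p → mk≈ₚ λ { zero → p ; (suc _) → refl })
  (λ x y → mk≈ₚ λ { zero → refl ; (suc _) → sym (+-identityˡ 0#) })
  (λ x y → mk≈ₚ λ i → trans (scale x y i) (sym (const-*ₛ F x (Powerseries.const F y) i)))
  (mk≈ₚ λ _ → refl)
  where
  open CommutativeRing F
  open Polynomial F using (mk≈ₚ)
  scale : ∀ x y i → Powerseries.const F (x * y) i ≈ x * Powerseries.const F y i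
  scale x y zero    = refl
  scale x y (suc _) = sym (zeroʳ x)

module _ (R : CommutativeRing c ℓ) where

  open Laurent R
  open Powerseries R using (powerseriesRing; X)
  open CommutativeRing powerseriesRing

  ι-hom : IsHom powerseriesRing laurentRing ι
  ι-hom = mkHom powerseriesRing laurentRing (λ p → mk≈ₗ (*-congˡ {1#} p))
    (λ f g → mk≈ₗ (*-congˡ {1#} (sym (+-cong {1# * f} {f} {1# * g} {g} (*-identityˡ f) (*-identityˡ g)))))
    (λ _ _ → CommutativeRing.refl laurentRing) (CommutativeRing.refl laurentRing)

  ιX*X⁻¹≈1 : ι X *ₗ X⁻¹ ≈ₗ 1ₗ
  ιX*X⁻¹≈1 = mk≈ₗ (trans (*-identityˡ (X * 1#)) (sym (*-identityʳ (X * 1#))))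

module _ (A : CommutativeRing c ℓ) (r : ℕ) where

  private
    d : ℕ
    d = suc (suc r)
  open Multivariate A

  seriesRing : SeriesRing A r (Series A d)
  seriesRing = record
    { [_] = constant A d ; []-hom = constant-hom d ; ε = constantTerm d ; ε-hom = constantTerm-hom d
    ; u = var A d ; 1/[1+u₁] = Powerseries.[1+X]⁻¹ (Series A (suc r))
    ; 1/[1+u₁]-inverse = Powerseries.[1+X]*[1+X]⁻¹ (Series A (suc r))
    ; ε-[] = λ x → CommutativeRing.reflexive A (constantTerm-constant d x) ; ε-u = constantTerm-var d
    ; invertible = invertible d
    ; series = fromCoeffs A d
    ; series-cong = λ {f} {g} → fromCoeffs-cong d {f} {g} ; series-1 = λ {f} → fromCoeffs-1 d {f}
    ; series-+ = fromCoeffs-+ d ; series-Σ = fromCoeffs-Σ d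
    ; series-scale = fromCoeffs-scale d ; u-* = var-* d
    }

module SeriesTower (F : CommutativeRing c ℓ₁) (A : CommutativeRing a ℓ₂)
  {h : CommutativeRing.Carrier F → CommutativeRing.Carrier A} (h-hom : IsHom F A h) (r : ℕ) where

  open Tower F A (Series A (suc (suc r))) (Laurent.laurentRing (Series A (suc r))) r h-hom (seriesRing A r)
    {Laurent.ι (Series A (suc r))} (ι-hom (Series A (suc r))) {Laurent.X⁻¹ (Series A (suc r))} (ιX*X⁻¹≈1 (Series A (suc r))) public

module PolynomialTower (F : CommutativeRing c ℓ) (r : ℕ) where
  open SeriesTower F (Polynomial.polynomialRing F) {Polynomial.const F} (Poly-const-hom F) r public

module _ (K : HeytingField c ℓ₁ ℓ₂) (n r : ℕ) (q : HeytingField.Carrier K) (q^m#1 : PowersApartFrom1 K n q) where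

  open GeneratingFunction K n r q q^m#1

  -- This translates apartness into the equation (1 - q^m) y = 1, the form in which the argument
  -- over commutative rings takes the hypothesis on q.
  [1-q^]⁻¹-inverse : ∀ m → 1 ℕ.≤ m → m ℕ.< n → (K.1# K.- q K.^ m) K.* [1-q^ m ]⁻¹ K.≈ K.1#
  [1-q^]⁻¹-inverse m 1≤m m<n with 1 ℕ.≤? m | m ℕ.<? n
  ... | yes p | yes p′ = proj₂ (proj₂ (K.#⇒invertible (K.#-sym (q^m#1 m p p′))))
  ... | no ¬p | _      = ⊥-elim (¬p 1≤m)
  ... | yes _ | no ¬p  = ⊥-elim (¬p m<n)

  generating-function : Σ[ denominator ∈ L.Invertible L.1# L._*_ (∏P t) ]
    (L.ι Ψ L.≈ ∏P (t L.- L.1#) L.* proj₁ denominator)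
  generating-function = PolynomialTower.generating-function (fieldRing K) r n q [1-q^_]⁻¹ [1-q^]⁻¹-inverse (Polynomial.X (fieldRing K))

theorem1p1 :
    (n r : ℕ) .{{_ : NonZero n}} .{{_ : NonZero r}} (q : ℂ) (q^m#1 : PowersApartFrom1 ℂ-field n q) →
    let open GeneratingFunction ℂ-field n r q q^m#1
        open L
    in Σ[ denominator ∈ Invertible 1# _*_ (∏P t) ] (ι Ψ ≈ ∏P (t - 1#) * proj₁ denominator)
theorem1p1 n r q q^m#1 = generating-function ℂ-field n r q q^m#1
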